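{- Let $k\ge 2$, $m\ge 1$ and $1\le r\le\log^*k$ be integers and let $c>1$ be a constant. There is an $r$-round probabilistic protocol (common random source) for $\mathrm{DISJ}^m_k$ such that: (1) its total communication is $O(k\log^{(r)}k)$ bits; (2) it makes no error when the two input sets intersect; (3) when the two input sets are disjoint its error probability is $$O\!\left(\frac{1}{\exp^{(r)}(c\log^{(r)}k)}+\exp(-\sqrt k)\right),$$ which is $\ll 1/k$. The constants implied by the $O(\cdot)$ may depend on $c$ but not on $k,m,r$. In particular, for $r=\log^*k-O(1)$ rounds (i.e. for $r=\log^*k-C$ with any fixed constant $C\ge 0$) there is an $O(k)$-bit $r$-round protocol for $\mathrm{DISJ}^m_k$ with error probability $O(\exp(-\sqrt k))$.
   Context: All logarithms are to base 2 and $\exp(x)=2^x$. Iterates: $\log^{(0)}x=x$, $\log^{(r)}x=\log(\log^{(r-1)}x)$; $\exp^{(0)}x=x$, $\exp^{(r)}x=\exp(\exp^{(r-1)}x)$ for $r\ge1$. $\log^*x$ is the smallest integer $r$ with $\log^{(r)}x<2$. $[m]=\{1,\dots,m\}$. In a two-player communication problem Alice receives $x$, Bob receives $y$, and they want to compute $f(x,y)$. In an $r$-round protocol the players take at most $r$ turns alternately sending each other a message, and the last player to receive a message declares the output. In a randomized (probabilistic) protocol the players may base their actions on a common random source; the error probability on an input $(x,y)$ is the probability that the output differs from $f(x,y)$, and the error probability of the protocol is the maximum of this over all inputs. In the problem $\mathrm{DISJ}^m_k$ each of the two players receives a subset of $[m]$ of size at most $k$, and they must decide whether the two sets are disjoint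 or not. -}

module Defs where

open import Algebra.Definitions.RawSemiring using () renaming (_^_ to pow)
open import Data.Bool.Base using (Bool)
open import Data.Bool.Properties using () renaming (_≟_ to _≟ᵇ_)
open import Data.Fin.Base using (Fin)
open import Data.Fin.Subset using (Subset; ∣_∣; _∩_; Empty)
open import Data.Fin.Subset.Properties using (nonempty?)
open import Data.Integer.Base as ℤ using (ℤ; +_; -[1+_])
open import Data.List.Base using (length; filter; allFin)
open import Data.Nat.Base as ℕ using (ℕ; zero; suc; NonZero)
open import Data.Product.Base using (Σ; ∃-syntax; _×_; proj₁)
open import Data.Rational.Base as ℚ using (ℚ; 0ℚ; 1ℚ; ½; ↥_; ↧ₙ_; +-*-rawSemiring)
open import Data.Sum.Base using (_⊎_)
open import Relation.Nullary using (¬_; does)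
open import Relation.Nullary.Decidable using (¬?)

------------------------------------------------------------------------
-- Real numbers

-- A two-sided Dedekind cut, without the laws: L q means q < x, U q means
-- x < q.  The laws are in IsReal.  On cuts satisfying IsReal the operations
-- below are the usual ones, log and inv on positive arguments and √ on
-- nonnegative ones; outside these domains they take conventional values
-- (log x is the cut -∞ for x ≤ 0).

record ℝ : Set₁ where
  constructor cut
  field
    L : ℚ → Set
    U : ℚ → Set

open ℝ public

record IsReal (x : ℝ) : Set where
  field
    L-inhabited : ∃[ q ] L x q
    U-inhabited : ∃[ q ] U x q
    L-lower     : ∀ {p q} → p ℚ.< q → L x q → L x p
    U-upper     : ∀ {p q} → p ℚ.< q → U x p → U x q
    L-open      : ∀ {p} → L x p → ∃[ q ] (p ℚ.< q × L x q)
    U-open      : ∀ {q} → U x q → ∃[ p ] (p ℚ.< q × U x p)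
    disjoint    : ∀ {q} → ¬ (L x q × U x q)
    located     : ∀ {p q} → p ℚ.< q → L x p ⊎ U x q

infix  4 _≤ᴿ_ _<ᴿ_
infixl 6 _+ᴿ_
infixl 7 _*ᴿ_
infix  8 -ᴿ_

_≤ᴿ_ : ℝ → ℝ → Set
x ≤ᴿ y = ∀ q → L x q → L y q

_<ᴿ_ : ℝ → ℝ → Set
x <ᴿ y = ∃[ q ] (U x q × L y q)

fromℚ : ℚ → ℝ
fromℚ p = cut (λ q → q ℚ.< p) (λ q → p ℚ.< q)

fromℕ : ℕ → ℝ
fromℕ n = fromℚ (+ n ℚ./ 1)

_+ᴿ_ : ℝ → ℝ → ℝ
x +ᴿ y = cut
  (λ q → ∃[ a ] ∃[ b ] (L x a × L y b × q ℚ.< a ℚ.+ b))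
  (λ q → ∃[ a ] ∃[ b ] (U x a × U y b × a ℚ.+ b ℚ.< q))

-ᴿ_ : ℝ → ℝ
-ᴿ x = cut (λ q → U x (ℚ.- q)) (λ q → L x (ℚ.- q))

-- Interval multiplication: if a < x < b and c < y < d, then xy lies between
-- the least and the greatest of ac, ad, bc, bd.

_*ᴿ_ : ℝ → ℝ → ℝ
x *ᴿ y = cut
  (λ q → ∃[ a ] ∃[ b ] ∃[ c ] ∃[ d ] (L x a × U x b × L y c × U y d ×
     q ℚ.< a ℚ.* c × q ℚ.< a ℚ.* d × q ℚ.< b ℚ.* c × q ℚ.< b ℚ.* d))
  (λ q → ∃[ a ] ∃[ b ] ∃[ c ] ∃[ d ] (L x a × U x b × L y c × U y d ×
     a ℚ.* c ℚ.< q × a ℚ.* d ℚ.< q × b ℚ.* c ℚ.< q × b ℚ.* d ℚ.< q))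

inv : ℝ → ℝ
inv x = cut
  (λ q → ∃[ p ] (U x p × 0ℚ ℚ.< p × q ℚ.* p ℚ.< 1ℚ))
  (λ q → ∃[ p ] (L x p × 0ℚ ℚ.< p × 1ℚ ℚ.< q ℚ.* p))

√_ : ℝ → ℝ
√ x = cut
  (λ q → q ℚ.< 0ℚ ⊎ L x (q ℚ.* q))
  (λ q → 0ℚ ℚ.< q × U x (q ℚ.* q))

infixr 8 _^_

_^_ : ℚ → ℕ → ℚ
_^_ = pow +-*-rawSemiring

2^_ : ℤ → ℚ
2^ (+ n)    = (+ 2 ℚ./ 1) ^ n
2^ -[1+ n ] = ½ ^ suc n

-- For a rational q = a/b, the comparison of p with the real number 2^(a/b),
-- made by comparing p^b with 2^a.

infix 4 _≺2^_ 2^_≺_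

_≺2^_ : ℚ → ℚ → Set
p ≺2^ q = p ℚ.< 0ℚ ⊎ p ^ ↧ₙ q ℚ.< 2^ (↥ q)

2^_≺_ : ℚ → ℚ → Set
2^ q ≺ p = 0ℚ ℚ.< p × 2^ (↥ q) ℚ.< p ^ ↧ₙ q

-- exp and log are to base 2.

exp : ℝ → ℝ
exp x = cut
  (λ q → ∃[ p ] (L x p × q ≺2^ p))
  (λ q → ∃[ p ] (U x p × 2^ p ≺ q))

log : ℝ → ℝ
log x = cut
  (λ q → ∃[ p ] (L x p × 2^ q ≺ p))
  (λ q → ∃[ p ] (U x p × p ≺2^ q))

exp^ : ℕ → ℝ → ℝ
exp^ zero    x = x
exp^ (suc r) x = exp (exp^ r x)

log^ : ℕ → ℝ → ℝ
log^ zero    x = x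
log^ (suc r) x = log (log^ r x)

-- IsLog* x s means s = log* x.

IsLog* : ℝ → ℕ → Set
IsLog* x s = log^ s x <ᴿ fromℕ 2 × (∀ {r} → r ℕ.< s → ¬ (log^ r x <ᴿ fromℕ 2))

------------------------------------------------------------------------
-- Communication protocols

-- Deterministic protocols in which at most r turns remain (the current one
-- included), the player whose turn it is holds an input in X and the other
-- player one in Y.  A message is sent bit by bit, so the possible messages of
-- a turn form a prefix-free code depending on the transcript so far.  `pass`
-- ends the turn and lets the other player speak; `output` ends the turn and
-- lets the other player, who has just received a message, declare the result.

data Protocol (X Y Z : Set) : ℕ → Set where
  send   : ∀ {r} → (X → Bool) → (Bool → Protocol X Y Z (suc r)) → Protocol X Y Z (suc r)
  pass   : ∀ {r} → Protocol Y X Z r → Protocol X Y Z (suc r)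
  output : ∀ {r} → (Y → Z) → Protocol X Y Z (suc r)

result : ∀ {X Y Z r} → Protocol X Y Z r → X → Y → Z
result (send b p) x y = result (p (b x)) x y
result (pass p)   x y = result p y x
result (output g) x y = g y

bits : ∀ {X Y Z r} → Protocol X Y Z r → X → Y → ℕ
bits (send b p) x y = suc (bits (p (b x)) x y)
bits (pass p)   x y = bits p y x
bits (output g) x y = 0

-- The common random source is a uniformly distributed element of Fin size.

record RandomizedProtocol (X Y Z : Set) (r : ℕ) : Set where
  field
    size         : ℕ
    {{size≢0}}   : NonZero size
    protocol     : Fin size → Protocol X Y Z r

open RandomizedProtocol public

errorProbability : ∀ {X Y r} → (X → Y → Bool) → RandomizedProtocol X Y Bool r → X → Y → ℚ
errorProbability f P x y =
  + length (filter (λ ω → ¬? (result (protocol P ω) x y ≟ᵇ f x y)) (allFin (size P)))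
    ℚ./ size P

TotalCommunication≤ : ∀ {X Y Z r} → RandomizedProtocol X Y Z r → ℝ → Set
TotalCommunication≤ P B = ∀ ω x y → fromℕ (bits (protocol P ω) x y) ≤ᴿ B

------------------------------------------------------------------------
-- Sparse set disjointness

Input : ℕ → ℕ → Set
Input m k = Σ (Subset m) λ S → ∣ S ∣ ℕ.≤ k

Disjoint : ∀ {m k} → Input m k → Input m k → Set
Disjoint S T = Empty (proj₁ S ∩ proj₁ T)

DISJ : ∀ m k → Input m k → Input m k → Bool
DISJ m k S T = does (¬? (nonempty? (proj₁ S ∩ proj₁ T)))

DISJ-Protocol : ℕ → ℕ → ℕ → Set
DISJ-Protocol m k r = RandomizedProtocol (Input m k) (Input m k) Bool r

errorBound : ℝ → ℕ → ℕ → ℝ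
errorBound c k r =
  inv (exp^ r (c *ᴿ log^ r (fromℕ k))) +ᴿ exp (-ᴿ (√ (fromℕ k)))

{-# OPTIONS --safe #-}
module Submission where

-- The players take turns announcing the image of their current set under a
-- common random hash function; the receiver keeps the elements of his own set
-- whose hash value was announced.  Common elements always survive, so declaring
-- the sets disjoint only when a set has become empty is never wrong for
-- intersecting sets.  If a set of n elements is hashed to n 2^b values, its
-- image costs O(n b) bits, and an element outside the set survives with
-- probability at most 2^-b.  By an exponential moment bound, a turn with b = 8t
-- leaves more than k / 2^(4t) elements with probability at most exp(-√k), as
-- long as k / 2^(4t) ≥ √k.  The next turn can then afford 8·2^t bits per
-- element: t is exponentiated in every turn, and starting from a multiple of
-- log^(r) k the r-th turn reaches exp^(r-1)(c log^(r) k).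
--
-- All parameters are integers: taking floors at every step,
-- lg i k ≤ log^(i) k < lg i k + 1.
--
-- The error bound is o(1/k) because c log^(r) k ≥ log^(r) k + δ, and such a gap
-- survives exponentiation: 2^(x+δ) ≥ 2^x + δ when 2^x ≥ 2.  At the last
-- exponentiation the gap is proportional to log k.

open import Defs
open import Data.Nat.Base using (ℕ; _+_; _≤_)
open import Data.Product.Base using (Σ; ∃-syntax; _×_)
open import Data.Rational.Base using (ℚ; 0ℚ) renaming (_<_ to _<ℚ_)
open import Relation.Binary.PropositionalEquality using (_≡_)
open import Relation.Nullary using (¬_)

import Algebra.Properties.CommutativeSemiring.Exp as Exp
open import Algebra.Bundles using (CommutativeRing)
open import Data.Bool.Base using (Bool; true; false; not; if_then_else_; _∧_) renaming (T to IsTrue)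
import Data.Bool.Properties as Bool
open import Data.Empty using (⊥-elim)
open import Data.Fin.Base using (Fin; zero; suc)
open import Data.Fin.Subset using (Subset; ∣_∣; _∩_; Empty; _∈_)
open import Data.Fin.Subset.Properties using (nonempty?)
import Data.Fin.Subset.Properties as Subset
open import Data.Integer.Base as ℤ using (ℤ; +_; -[1+_])
import Data.Integer.Properties as ℤ
open import Data.List.Base as List using (List; []; _∷_; _++_; cartesianProductWith; length; filter; tabulate; allFin)
import Data.List.Properties as List
open import Data.Maybe.Base using (nothing)
open import Data.Nat.Base as ℕ using (zero; suc; _*_; _∸_; _<_; _<ᵇ_; _≤ᵇ_; z≤n; s≤s; NonZero) renaming (_^_ to _^ℕ_)
import Data.Nat.DivMod as ℕ
import Data.Nat.Properties as ℕ
open import Data.Nat.Induction using (<-rec)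
open import Data.Nat.Logarithm using (⌊log₂_⌋; ⌊log₂⌋-mono-≤; ⌊log₂⌊n/2⌋⌋≡⌊log₂n⌋∸1; ⌊log₂[2^n]⌋≡n)
open import Data.Nat.Tactic.RingSolver using (solve-∀)
open import Data.Product.Base using (_,_; proj₁; proj₂)
open import Data.Rational.Base as ℚ using (1ℚ; ½; ↥_; ↧_; ↧ₙ_)
import Data.Rational.Properties as ℚ
open import Data.Rational.Unnormalised.Base as ℚᵘ using (mkℚᵘ; *≤*; *<*; *≡*)
import Data.Rational.Unnormalised.Properties as ℚᵘ
open import Data.Sum.Base using (inj₁; inj₂)
open import Data.Unit.Base using (tt)
open import Data.Vec.Base using (Vec; []; _∷_; here; there)
open import Function.Base using (_∘_; id; case_of_)
open import Level using (0ℓ)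
open import Relation.Binary.Definitions using (tri<; tri≈; tri>)
open import Relation.Binary.PropositionalEquality using (refl; sym; trans; cong; cong₂; subst; subst₂)
open import Relation.Nullary using (yes; no; does; Dec; contradiction)
open import Relation.Nullary.Decidable using (¬?; dec-true; dec-false)
import Tactic.RingSolver as Solver
import Tactic.RingSolver.Core.AlmostCommutativeRing as ACR

-- Finite sums

-- The `8t` extra bits of a turn are split in halves, `2^(8t) = z (2j)` with `z = 2j = 2^(4t)`. For
-- `n = 2^(8u - 4t)` the mean of `z^|T′|` is at most `(1 + 1/(2j))^|T| ≤ 2^(2n)`, and Markov's
-- inequality divides it by `z^n = 2^(4tn)`. The exponent left, `4tn - 2n`, covers `2^(4u) > √k` and
-- a further `t`. That further `t` is what keeps the constants independent of the number of turns: a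
-- turn adds only `2^(-t) exp(-√k)` to the error, and as `t` becomes `2^t` in every turn, the series
-- is at most twice its first term. The costs of the later turns are summed in the same way, so both
-- inductions carry a correction term relative to `2^t`. Only the speaker's set is known to have
-- shrunk; for the receiver's set the bound `2^(8u)` is used throughout. Probabilities are counts
-- over lists of samples, compared after multiplication by all denominators. Cuts are open, so each
-- passage to real numbers needs strict rational witnesses; the offsets by one half and the enlarged
-- constants come from there.

∑ : {A : Set} → List A → (A → ℕ) → ℕ
∑ []       f = 0
∑ (x ∷ xs) f = f x + ∑ xs f

infix 5 ∑
syntax ∑ xs (λ x → e) = ∑[ x ← xs ] e

∑-mono : ∀ {A : Set} (xs : List A) {f g : A → ℕ} → (∀ x → f x ≤ g x) → ∑ xs f ≤ ∑ xs g
∑-mono []       f≤g = z≤n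
∑-mono (x ∷ xs) f≤g = ℕ.+-mono-≤ (f≤g x) (∑-mono xs f≤g)

∑-cong : ∀ {A : Set} (xs : List A) {f g : A → ℕ} → (∀ x → f x ≡ g x) → ∑ xs f ≡ ∑ xs g
∑-cong []       f≡g = refl
∑-cong (x ∷ xs) f≡g = cong₂ _+_ (f≡g x) (∑-cong xs f≡g)

∑-+ : ∀ {A : Set} (xs : List A) {f g : A → ℕ} → ∑ xs (λ x → f x + g x) ≡ ∑ xs f + ∑ xs g
∑-+ []               = refl
∑-+ (x ∷ xs) {f} {g} = trans (cong (_+_ _) (∑-+ xs)) (lemma (f x) (g x) _ _)
  where
  lemma : ∀ a b c d → a + b + (c + d) ≡ a + c + (b + d)
  lemma = solve-∀

∑-*ʳ : ∀ {A : Set} (xs : List A) {f : A → ℕ} c → ∑ xs (λ x → f x * c) ≡ ∑ xs f * c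
∑-*ʳ []           c = refl
∑-*ʳ (x ∷ xs) {f} c = trans (cong (_+_ _) (∑-*ʳ xs c)) (sym (ℕ.*-distribʳ-+ c (f x) _))

∑-const : ∀ {A : Set} (xs : List A) c → ∑ xs (λ _ → c) ≡ length xs * c
∑-const []       c = refl
∑-const (x ∷ xs) c = cong (_+_ c) (∑-const xs c)

∑-zero : ∀ {A : Set} (xs : List A) {f : A → ℕ} → (∀ x → f x ≡ 0) → ∑ xs f ≡ 0
∑-zero xs f≡0 = trans (∑-cong xs f≡0) (trans (∑-const xs 0) (ℕ.*-zeroʳ (length xs)))

∑-swap : ∀ {A B : Set} (xs : List A) (ys : List B) {f : A → B → ℕ} →
         ∑[ x ← xs ] ∑[ y ← ys ] f x y ≡ ∑[ y ← ys ] ∑[ x ← xs ] f x y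
∑-swap []       ys = sym (∑-zero ys (λ _ → refl))
∑-swap (x ∷ xs) ys = trans (cong (_+_ _) (∑-swap xs ys)) (sym (∑-+ ys))

∑-++ : ∀ {A : Set} (xs ys : List A) {f : A → ℕ} → ∑ (xs ++ ys) f ≡ ∑ xs f + ∑ ys f
∑-++ []       ys     = refl
∑-++ (x ∷ xs) ys {f} = trans (cong (_+_ (f x)) (∑-++ xs ys)) (sym (ℕ.+-assoc (f x) _ _))

∑-map : ∀ {A B : Set} (g : A → B) (xs : List A) {f : B → ℕ} → ∑ (List.map g xs) f ≡ ∑ xs (λ x → f (g x))
∑-map g []           = refl
∑-map g (x ∷ xs) {f} = cong (_+_ (f (g x))) (∑-map g xs)

∑-cartesian : ∀ {A B C : Set} (g : A → B → C) (xs : List A) (ys : List B) {f : C → ℕ} →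
              ∑ (cartesianProductWith g xs ys) f ≡ ∑[ x ← xs ] ∑[ y ← ys ] f (g x y)
∑-cartesian g []       ys = refl
∑-cartesian g (x ∷ xs) ys =
  trans (∑-++ (List.map (g x) ys) _) (cong₂ _+_ (∑-map (g x) ys) (∑-cartesian g xs ys))

tuples : {A : Set} → List A → ∀ m → List (Vec A m)
tuples xs zero    = [] ∷ []
tuples xs (suc m) = cartesianProductWith _∷_ xs (tuples xs m)

length-cartesian : ∀ {A B C : Set} (g : A → B → C) (xs : List A) (ys : List B) →
                   length (cartesianProductWith g xs ys) ≡ length xs * length ys
length-cartesian g []       ys = refl
length-cartesian g (x ∷ xs) ys = trans (List.length-++ (List.map (g x) ys))
  (cong₂ _+_ (List.length-map (g x) ys) (length-cartesian g xs ys))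

length-tuples : ∀ {A : Set} (xs : List A) m → length (tuples xs m) ≡ length xs ^ℕ m
length-tuples xs zero    = refl
length-tuples xs (suc m) =
  trans (length-cartesian _∷_ xs (tuples xs m)) (cong (length xs *_) (length-tuples xs m))

-- Hashing

Word : ℕ → Set
Word = Vec Bool

words : ∀ d → List (Word d)
words = tuples (true ∷ false ∷ [])

indicator : Bool → ℕ
indicator false = 0
indicator true  = 1

-- A subset of the words of length d, as a binary tree.

data Tree : ℕ → Set where
  leaf : Bool → Tree 0
  node : ∀ {d} → Tree d → Tree d → Tree (suc d)

root₀ : Tree 0 → Bool
root₀ (leaf b) = b

left right : ∀ {d} → Tree (suc d) → Tree d
left  (node l r) = l
right (node l r) = r

empty : ∀ {d} → Tree d
empty {zero}  = leaf false
empty {suc d} = node empty empty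

insert : ∀ {d} → Word d → Tree d → Tree d
insert []          (leaf _)   = leaf true
insert (true  ∷ w) (node l r) = node (insert w l) r
insert (false ∷ w) (node l r) = node l (insert w r)

member : ∀ {d} → Word d → Tree d → Bool
member []          (leaf b)   = b
member (true  ∷ w) (node l r) = member w l
member (false ∷ w) (node l r) = member w r

cardinality : ∀ {d} → Tree d → ℕ
cardinality (leaf b)   = indicator b
cardinality (node l r) = cardinality l + cardinality r

cardinality-empty : ∀ d → cardinality (empty {d}) ≡ 0
cardinality-empty zero    = refl
cardinality-empty (suc d) = cong₂ _+_ (cardinality-empty d) (cardinality-empty d)

cardinality≡0⇒empty : ∀ {d} (A : Tree d) → cardinality A ≡ 0 → A ≡ empty
cardinality≡0⇒empty (leaf false) refl = refl
cardinality≡0⇒empty (node l r)   eq   =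
  cong₂ node (cardinality≡0⇒empty l (ℕ.m+n≡0⇒m≡0 (cardinality l) eq))
             (cardinality≡0⇒empty r (ℕ.m+n≡0⇒n≡0 (cardinality l) eq))

cardinality-insert : ∀ {d} (w : Word d) A → cardinality (insert w A) ≤ suc (cardinality A)
cardinality-insert []          (leaf _)   = s≤s z≤n
cardinality-insert (true  ∷ w) (node l r) = ℕ.+-monoˡ-≤ (cardinality r) (cardinality-insert w l)
cardinality-insert (false ∷ w) (node l r) =
  ℕ.≤-trans (ℕ.+-monoʳ-≤ (cardinality l) (cardinality-insert w r)) (ℕ.≤-reflexive (ℕ.+-suc (cardinality l) _))

member-insert : ∀ {d} (w : Word d) A → member w (insert w A) ≡ true
member-insert []          (leaf _)   = refl
member-insert (true  ∷ w) (node l r) = member-insert w l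
member-insert (false ∷ w) (node l r) = member-insert w r

insert-preserves : ∀ {d} (v w : Word d) A → member v A ≡ true → member v (insert w A) ≡ true
insert-preserves []          []          (leaf _)   _ = refl
insert-preserves (true  ∷ v) (true  ∷ w) (node l r) p = insert-preserves v w l p
insert-preserves (true  ∷ v) (false ∷ w) (node l r) p = p
insert-preserves (false ∷ v) (true  ∷ w) (node l r) p = p
insert-preserves (false ∷ v) (false ∷ w) (node l r) p = insert-preserves v w r p

weight : ℕ → Bool → ℕ
weight z b = if b then z else 1

∑-weight : ∀ z {d} (A : Tree d) → ∑[ w ← words d ] weight z (member w A) ≤ 2 ^ℕ d + z * cardinality A
∑-weight z (leaf false) = ℕ.m≤m+n 1 _
∑-weight z (leaf true)  = ℕ.m≤n⇒m≤1+n (ℕ.≤-reflexive (lemma z))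
  where
  lemma : ∀ z → z + 0 ≡ z * 1
  lemma = solve-∀
∑-weight z {suc d} (node l r) = begin
  ∑ (words (suc d)) (λ w → weight z (member w (node l r)))
    ≡⟨ ∑-cartesian _∷_ (true ∷ false ∷ []) (words d) ⟩
  ∑ (words d) (λ w → weight z (member w l)) + (∑ (words d) (λ w → weight z (member w r)) + 0)
    ≤⟨ ℕ.+-mono-≤ (∑-weight z l) (ℕ.+-monoˡ-≤ 0 (∑-weight z r)) ⟩
  2 ^ℕ d + z * cardinality l + (2 ^ℕ d + z * cardinality r + 0)
    ≡⟨ lemma (2 ^ℕ d) z (cardinality l) (cardinality r) ⟩
  2 ^ℕ suc d + z * cardinality (node l r) ∎
  where
  open ℕ.≤-Reasoning
  lemma : ∀ n z a b → n + z * a + (n + z * b + 0) ≡ 2 * n + z * (a + b)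
  lemma = solve-∀

-- A uniform word lies in `A` with probability at most `n / N`, so its mean weight is at most
-- `1 + z n / N`. The parameter `M` stands for `N / (z n)`, which turns this into `1 + 1/M` and lets
-- it be stated in ℕ.
∑-weight-bound : ∀ z M N n {d} (A : Tree d) → N ≡ 2 ^ℕ d → N ≡ n * (z * M) → cardinality A ≤ n →
                 ∑[ w ← words d ] weight z (member w A) * M ≤ N * suc M
∑-weight-bound z M N n {d} A refl eq c≤n = begin
  ∑ (words d) (λ w → weight z (member w A) * M) ≡⟨ ∑-*ʳ (words d) M ⟩
  ∑ (words d) (λ w → weight z (member w A)) * M ≤⟨ ℕ.*-monoˡ-≤ M (∑-weight z A) ⟩
  (N + z * cardinality A) * M                   ≤⟨ ℕ.*-monoˡ-≤ M (ℕ.+-monoʳ-≤ N (ℕ.*-monoʳ-≤ z c≤n)) ⟩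
  (N + z * n) * M                               ≡⟨ lemma N z n M ⟩
  N * M + n * (z * M)                           ≡⟨ cong (_+_ _) eq ⟨
  N * M + N                                     ≡⟨ trans (ℕ.+-comm (N * M) N) (sym (ℕ.*-suc N M)) ⟩
  N * suc M                                     ∎
  where
  open ℕ.≤-Reasoning
  lemma : ∀ N z n M → (N + z * n) * M ≡ N * M + n * (z * M)
  lemma = solve-∀

Hash : ℕ → ℕ → Set
Hash d m = Vec (Word d) m

image : ∀ {d m} → Subset m → Hash d m → Tree d → Tree d
image []          []      A = A
image (true  ∷ S) (w ∷ h) A = image S h (insert w A)
image (false ∷ S) (w ∷ h) A = image S h A

survivors : ∀ {d m} → Subset m → Hash d m → Tree d → Subset m
survivors []      []      A = []
survivors (b ∷ T) (w ∷ h) A = (b ∧ member w A) ∷ survivors T h A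

cardinality-image : ∀ {d m} (S : Subset m) h (A : Tree d) →
                    cardinality (image S h A) ≤ cardinality A + ∣ S ∣
cardinality-image []          []      A = ℕ.≤-reflexive (sym (ℕ.+-identityʳ _))
cardinality-image (true  ∷ S) (w ∷ h) A =
  ℕ.≤-trans (cardinality-image S h (insert w A))
    (ℕ.≤-trans (ℕ.+-monoˡ-≤ ∣ S ∣ (cardinality-insert w A)) (ℕ.≤-reflexive (sym (ℕ.+-suc _ ∣ S ∣))))
cardinality-image (false ∷ S) (w ∷ h) A = cardinality-image S h A

-- Disjointness position by position, so that it can be decomposed together with the vector of hash
-- values.
data Apart : ∀ {m} → Subset m → Subset m → Set where
  []  : Apart [] []
  _∷_ : ∀ {m s t} {S T : Subset m} → s ∧ t ≡ false → Apart S T → Apart (s ∷ S) (t ∷ T)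

-- Hash values at different positions are independent, and a position of `T` is not one of `S`, so
-- its word is independent of the image of `S`. Each element of `T` therefore contributes a factor
-- of at most `1 + 1/M` to the mean of `z` to the number of survivors. The accumulator `A` holds the
-- words of the elements of `S` already passed.
moment : ∀ z M N n {d m} {S T : Subset m} → Apart S T → (A : Tree d) → N ≡ 2 ^ℕ d → N ≡ n * (z * M) →
         cardinality A + ∣ S ∣ ≤ n →
         (∑[ h ← tuples (words d) m ] z ^ℕ ∣ survivors T h (image S h A) ∣) * M ^ℕ ∣ T ∣
           ≤ N ^ℕ m * suc M ^ℕ ∣ T ∣
moment z M N n [] A N≡ eq c≤n = ℕ.≤-refl
moment z M N n {d} {suc m} {s ∷ S} {t ∷ T} (dis ∷ ST) A N≡ eq c≤n =
  ℕ.≤-trans (ℕ.≤-reflexive (cong (_* M ^ℕ ∣ t ∷ T ∣) (∑-cartesian _∷_ (words d) (tuples (words d) m))))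
            (cases s t dis c≤n)
  where
  open ℕ.≤-Reasoning
  F : Subset (suc m) → Subset (suc m) → Word d → Hash d m → ℕ
  F S′ T′ w h = z ^ℕ ∣ survivors T′ (w ∷ h) (image S′ (w ∷ h) A) ∣
  #words : length (words d) ≡ N
  #words = trans (length-tuples _ d) (sym N≡)
  lemma : ∀ {X : Set} (ws : List X) f {x y z} → length ws ≡ N → (∀ w → f w * x ≤ y * z) → ∑ ws f * x ≤ N * y * z
  lemma ws f {x} {y} {z} refl hyp = begin
    ∑ ws f * x             ≡⟨ ∑-*ʳ ws x ⟨
    ∑ ws (λ w → f w * x)   ≤⟨ ∑-mono ws hyp ⟩
    ∑ ws (λ w → y * z)     ≡⟨ ∑-const ws _ ⟩
    length ws * (y * z)    ≡⟨ ℕ.*-assoc (length ws) y z ⟨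
    length ws * y * z      ∎
  z^survivors : ∀ (w : Word d) h B →
                z ^ℕ ∣ survivors (true ∷ T) (w ∷ h) B ∣ ≡ z ^ℕ ∣ survivors T h B ∣ * weight z (member w B)
  z^survivors w h B with member w B
  ... | true  = ℕ.*-comm z _
  ... | false = sym (ℕ.*-identityʳ _)
  swap : ∀ a b c → a * b * c ≡ a * c * b
  swap = solve-∀
  cases : ∀ s t → s ∧ t ≡ false → cardinality A + ∣ s ∷ S ∣ ≤ n →
          (∑[ w ← words d ] ∑[ h ← tuples (words d) m ] F (s ∷ S) (t ∷ T) w h) * M ^ℕ ∣ t ∷ T ∣
            ≤ N ^ℕ suc m * suc M ^ℕ ∣ t ∷ T ∣
  cases false false _ c≤n = lemma (words d) _ #words (λ w → moment z M N n ST A N≡ eq c≤n)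
  cases true  false _ c≤n = lemma (words d) _ #words λ w → moment z M N n ST (insert w A) N≡ eq
    (ℕ.≤-trans (ℕ.+-monoˡ-≤ ∣ S ∣ (cardinality-insert w A))
               (ℕ.≤-trans (ℕ.≤-reflexive (sym (ℕ.+-suc (cardinality A) ∣ S ∣))) c≤n))
  cases false true  _ c≤n = begin
    ∑ (words d) (λ w → ∑ H (F (false ∷ S) (true ∷ T) w)) * (M * M ^ℕ ∣ T ∣)
      -- The remaining hash values are fixed before the word of the current element of `T` is
      -- averaged: they alone determine the image of `S`, since this position is not in `S`.
      ≡⟨ cong (_* (M * M ^ℕ ∣ T ∣)) (∑-swap (words d) H) ⟩
    ∑ H (λ h → ∑ (words d) (λ w → F (false ∷ S) (true ∷ T) w h)) * (M * M ^ℕ ∣ T ∣)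
      ≡⟨ ℕ.*-assoc (∑ H (λ h → ∑ (words d) (λ w → F (false ∷ S) (true ∷ T) w h))) M (M ^ℕ ∣ T ∣) ⟨
    ∑ H (λ h → ∑ (words d) (λ w → F (false ∷ S) (true ∷ T) w h)) * M * M ^ℕ ∣ T ∣
      ≡⟨ cong (_* M ^ℕ ∣ T ∣) (∑-*ʳ H M) ⟨
    ∑ H (λ h → ∑ (words d) (λ w → F (false ∷ S) (true ∷ T) w h) * M) * M ^ℕ ∣ T ∣
      ≤⟨ ℕ.*-monoˡ-≤ (M ^ℕ ∣ T ∣) (∑-mono H inner) ⟩
    ∑ H (λ h → G h * (N * suc M)) * M ^ℕ ∣ T ∣
      ≡⟨ cong (_* M ^ℕ ∣ T ∣) (∑-*ʳ H (N * suc M)) ⟩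
    ∑ H G * (N * suc M) * M ^ℕ ∣ T ∣
      ≡⟨ swap (∑ H G) (N * suc M) (M ^ℕ ∣ T ∣) ⟩
    ∑ H G * M ^ℕ ∣ T ∣ * (N * suc M)
      ≤⟨ ℕ.*-monoˡ-≤ (N * suc M) (moment z M N n ST A N≡ eq c≤n) ⟩
    N ^ℕ m * suc M ^ℕ ∣ T ∣ * (N * suc M)
      ≡⟨ rearrange (N ^ℕ m) (suc M ^ℕ ∣ T ∣) N (suc M) ⟩
    N * N ^ℕ m * (suc M * suc M ^ℕ ∣ T ∣) ∎
    where
    rearrange : ∀ a b c d → a * b * (c * d) ≡ c * a * (d * b)
    rearrange = solve-∀
    H : List (Hash d m)
    H = tuples (words d) m
    G : Hash d m → ℕ
    G h = z ^ℕ ∣ survivors T h (image S h A) ∣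
    factor : ∀ h w → F (false ∷ S) (true ∷ T) w h * M ≡ weight z (member w (image S h A)) * M * G h
    factor h w = trans (cong (_* M) (z^survivors w h (image S h A)))
      (rot (G h) (weight z (member w (image S h A))) M)
      where
      rot : ∀ a b c → a * b * c ≡ b * c * a
      rot = solve-∀
    inner : ∀ h → ∑ (words d) (λ w → F (false ∷ S) (true ∷ T) w h) * M ≤ G h * (N * suc M)
    inner h = begin
      ∑ (words d) (λ w → F (false ∷ S) (true ∷ T) w h) * M
        ≡⟨ ∑-*ʳ (words d) M ⟨
      ∑ (words d) (λ w → F (false ∷ S) (true ∷ T) w h * M)
        ≡⟨ ∑-cong (words d) (factor h) ⟩
      ∑ (words d) (λ w → weight z (member w (image S h A)) * M * G h)
        ≡⟨ ∑-*ʳ (words d) (G h) ⟩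
      ∑ (words d) (λ w → weight z (member w (image S h A)) * M) * G h
        ≤⟨ ℕ.*-monoˡ-≤ (G h) (∑-weight-bound z M N n (image S h A) N≡ eq (ℕ.≤-trans (cardinality-image S h A) c≤n)) ⟩
      N * suc M * G h
        ≡⟨ ℕ.*-comm _ (G h) ⟩
      G h * (N * suc M) ∎

image-preserves : ∀ {d m} (S : Subset m) h (v : Word d) A → member v A ≡ true → member v (image S h A) ≡ true
image-preserves []          []      v A p = p
image-preserves (true  ∷ S) (w ∷ h) v A p = image-preserves S h v (insert w A) (insert-preserves v w A p)
image-preserves (false ∷ S) (w ∷ h) v A p = image-preserves S h v A p

common⇒survives : ∀ {d m} {S T : Subset m} {i} h (A : Tree d) →
                  i ∈ S → i ∈ T → i ∈ survivors T h (image S h A)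
common⇒survives {S = true ∷ S} (w ∷ h) A here here
  rewrite image-preserves S h w (insert w A) (member-insert w A) = here
common⇒survives {S = true  ∷ S} (w ∷ h) A (there i∈S) (there i∈T) = there (common⇒survives h (insert w A) i∈S i∈T)
common⇒survives {S = false ∷ S} (w ∷ h) A (there i∈S) (there i∈T) = there (common⇒survives h A i∈S i∈T)

∣survivors∣≤ : ∀ {d m} (T : Subset m) h (A : Tree d) → ∣ survivors T h A ∣ ≤ ∣ T ∣
∣survivors∣≤ []          []      A = z≤n
∣survivors∣≤ (false ∷ T) (w ∷ h) A = ∣survivors∣≤ T h A
∣survivors∣≤ (true  ∷ T) (w ∷ h) A with member w A
... | true  = s≤s (∣survivors∣≤ T h A)
... | false = ℕ.m≤n⇒m≤1+n (∣survivors∣≤ T h A)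

Apart-survivors : ∀ {d m} {S T : Subset m} h (A : Tree d) → Apart S T → Apart (survivors T h A) S
Apart-survivors []      A []         = []
Apart-survivors (w ∷ h) A (_∷_ {s = s} {t = t} st ST) = lemma s t (member w A) st ∷ Apart-survivors h A ST
  where
  lemma : ∀ s t b → s ∧ t ≡ false → (t ∧ b) ∧ s ≡ false
  lemma s     false b     _ = refl
  lemma false true  false _ = refl
  lemma false true  true  _ = refl

Empty⇒Apart : ∀ {m} (S T : Subset m) → Empty (S ∩ T) → Apart S T
Empty⇒Apart []      []      _ = []
Empty⇒Apart (s ∷ S) (t ∷ T) e = head s t e ∷ Empty⇒Apart S T (Subset.drop-∷-Empty e)
  where
  head : ∀ s t → Empty (s ∧ t ∷ S ∩ T) → s ∧ t ≡ false
  head false t     e = refl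
  head true  false e = refl
  head true  true  e = contradiction (_ , here) e

-- Protocols

sendTree : ∀ {d r X Y Z} → (X → Tree d) → (Tree d → Protocol X Y Z (suc r)) → Protocol X Y Z (suc r)
sendTree {zero}  f p = send (root₀ ∘ f) (p ∘ leaf)
sendTree {suc d} f p = send (λ x → 0 <ᵇ cardinality (f x)) λ where
  false → p empty
  true  → sendTree (left ∘ f) λ l → sendTree (right ∘ f) λ r → p (node l r)

0≮ᵇ⇒≡0 : ∀ n → (0 <ᵇ n) ≡ false → n ≡ 0
0≮ᵇ⇒≡0 zero _ = refl

result-sendTree : ∀ {d r X Y Z} f (p : Tree d → Protocol X Y Z (suc r)) x y {A} → f x ≡ A →
                  result (sendTree f p) x y ≡ result (p A) x y
result-sendTree f p x y {leaf b} eq rewrite eq = refl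
result-sendTree {suc d} f p x y {node l r} eq with 0 <ᵇ cardinality (f x) in nz
... | true  = trans (result-sendTree (left ∘ f) _ x y (cong left eq))
                    (result-sendTree (right ∘ f) _ x y (cong right eq))
... | false = cong (λ A → result (p A) x y) (trans (sym (cardinality≡0⇒empty (f x) (0≮ᵇ⇒≡0 (cardinality (f x)) nz))) eq)

-- Every nonempty inner node pays for the first bits of its two children. Each of the `d` inner
-- levels has at most as many nonempty nodes as `A` has words, which gives the factor 2; the leading
-- 1 is the bit of the root.
bits-sendTree : ∀ {d r X Y Z} f (p : Tree d → Protocol X Y Z (suc r)) x y {A} → f x ≡ A →
                bits (sendTree f p) x y ≤ 1 + 2 * (d * cardinality A) + bits (p A) x y
bits-sendTree f p x y {leaf b} eq rewrite eq = ℕ.≤-refl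
bits-sendTree {suc d} f p x y {node l r} eq with 0 <ᵇ cardinality (f x) in nz
... | true = begin
  suc (bits (sendTree (left ∘ f) _) x y)
    ≤⟨ s≤s (bits-sendTree (left ∘ f) _ x y (cong left eq)) ⟩
  suc (1 + 2 * (d * cl) + bits (sendTree (right ∘ f) _) x y)
    ≤⟨ s≤s (ℕ.+-monoʳ-≤ (1 + 2 * (d * cl)) (bits-sendTree (right ∘ f) _ x y (cong right eq))) ⟩
  suc (1 + 2 * (d * cl) + (1 + 2 * (d * cr) + rest))
    ≡⟨ lemma d cl cr rest ⟩
  1 + 2 * (d * (cl + cr)) + rest + 2 * 1
    ≤⟨ ℕ.+-monoʳ-≤ (1 + 2 * (d * (cl + cr)) + rest) (ℕ.*-monoʳ-≤ 2 (positive (cl + cr) (trans (cong (λ A → 0 <ᵇ cardinality A) (sym eq)) nz))) ⟩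
  1 + 2 * (d * (cl + cr)) + rest + 2 * (cl + cr)
    ≡⟨ lemma′ d (cl + cr) rest ⟩
  1 + 2 * (suc d * (cl + cr)) + rest ∎
  where
  open ℕ.≤-Reasoning
  cl = cardinality l
  cr = cardinality r
  rest = bits (p (node l r)) x y
  lemma : ∀ d a b c → suc (1 + 2 * (d * a) + (1 + 2 * (d * b) + c)) ≡ 1 + 2 * (d * (a + b)) + c + 2 * 1
  lemma = solve-∀
  lemma′ : ∀ d a c → 1 + 2 * (d * a) + c + 2 * a ≡ 1 + 2 * (suc d * a) + c
  lemma′ = solve-∀
  positive : ∀ n → (0 <ᵇ n) ≡ true → 1 ≤ n
  positive (suc n) _ = s≤s z≤n
... | false rewrite sym (trans (sym (cardinality≡0⇒empty (f x) (0≮ᵇ⇒≡0 (cardinality (f x)) nz))) eq) =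
  s≤s (ℕ.m≤n+m _ _)

-- The top a levels carry no flags for empty subtrees: at most 2^a words of
-- length a + b then cost 2^a (1 + 2 b) bits, with no dependence on a in the
-- number of bits per word.

sendBlocks : ∀ a {b r X Y Z} → (X → Tree (a + b)) → (Tree (a + b) → Protocol X Y Z (suc r)) →
             Protocol X Y Z (suc r)
sendBlocks zero    f p = sendTree f p
sendBlocks (suc a) f p = sendBlocks a (left ∘ f) λ l → sendBlocks a (right ∘ f) λ r → p (node l r)

result-sendBlocks : ∀ a {b r X Y Z} f (p : Tree (a + b) → Protocol X Y Z (suc r)) x y {A} → f x ≡ A →
                    result (sendBlocks a f p) x y ≡ result (p A) x y
result-sendBlocks zero    f p x y eq = result-sendTree f p x y eq
result-sendBlocks (suc a) f p x y {node l r} eq =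
  trans (result-sendBlocks a (left ∘ f) _ x y (cong left eq)) (result-sendBlocks a (right ∘ f) _ x y (cong right eq))

bits-sendBlocks : ∀ a {b r X Y Z} f (p : Tree (a + b) → Protocol X Y Z (suc r)) x y {A} → f x ≡ A →
                  bits (sendBlocks a f p) x y ≤ 2 ^ℕ a + 2 * (b * cardinality A) + bits (p A) x y
bits-sendBlocks zero    f p x y eq = bits-sendTree f p x y eq
bits-sendBlocks (suc a) {b} f p x y {node l r} eq = begin
  bits (sendBlocks a (left ∘ f) _) x y
    ≤⟨ bits-sendBlocks a (left ∘ f) _ x y (cong left eq) ⟩
  2 ^ℕ a + 2 * (b * cl) + bits (sendBlocks a (right ∘ f) _) x y
    ≤⟨ ℕ.+-monoʳ-≤ (2 ^ℕ a + 2 * (b * cl)) (bits-sendBlocks a (right ∘ f) _ x y (cong right eq)) ⟩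
  2 ^ℕ a + 2 * (b * cl) + (2 ^ℕ a + 2 * (b * cr) + rest)
    ≡⟨ lemma (2 ^ℕ a) b cl cr rest ⟩
  2 ^ℕ suc a + 2 * (b * (cl + cr)) + rest ∎
  where
  open ℕ.≤-Reasoning
  cl = cardinality l
  cr = cardinality r
  rest = bits (p (node l r)) x y
  lemma : ∀ e d a b c → e + 2 * (d * a) + (e + 2 * (d * b) + c) ≡ 2 * e + 2 * (d * (a + b)) + c
  lemma = solve-∀

isEmpty : ∀ {m} → Subset m → Bool
isEmpty S = does (¬? (nonempty? S))

-- A turn (a , b) of a schedule transmits the hash values of at most 2^a
-- elements, hashed to a + b bits.

data Schedule : ℕ → Set where
  last : ∀ {r} → ℕ → ℕ → Schedule (suc r)
  more : ∀ {r} → ℕ → ℕ → Schedule r → Schedule (suc r)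

cost : ∀ {r} → Schedule r → ℕ
cost (last a b)   = 1 + 2 ^ℕ a * (1 + 2 * b)
cost (more a b s) = 1 + 2 ^ℕ a * (1 + 2 * b) + cost s

Sample : ∀ {r} → Schedule r → ℕ → Set
Sample (last a b)   m = Hash (a + b) m
Sample (more a b s) m = Hash (a + b) m × Sample s m

samples : ∀ {r} (s : Schedule r) m → List (Sample s m)
samples (last a b)   m = tuples (words (a + b)) m
samples (more a b s) m = cartesianProductWith _,_ (tuples (words (a + b)) m) (samples s m)

-- The initial bit caps the communication for every random choice: a set that is too large is not
-- sent, and the answer is then "not disjoint", so that an overflow can never cause an error on
-- intersecting sets.
transmit : ∀ {m r X Y} a b → Hash (a + b) m → (X → Subset m) → (Tree (a + b) → Protocol X Y Bool (suc r)) →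
           Protocol X Y Bool (suc r)
transmit a b h f p = send (λ x → ∣ f x ∣ ≤ᵇ 2 ^ℕ a) λ where
  false → output (λ _ → false)
  true  → sendBlocks a (λ x → image (f x) h empty) p

run : ∀ {m r X Y} (s : Schedule r) → Sample s m → (X → Subset m) → (Y → Subset m) → Protocol X Y Bool r
run (last a b)   h       f g = transmit a b h f λ A → output (λ y → isEmpty (survivors (g y) h A))
run (more a b s) (h , ω) f g = transmit a b h f λ A → pass (run s ω (λ y → survivors (g y) h A) f)

-- The answer of `run` as a function of the two current sets, without messages. The first set
-- belongs to the speaker, so the arguments change places at every turn.
outcome : ∀ {m r} (s : Schedule r) → Sample s m → Subset m → Subset m → Bool
outcome (last a b) h S T =
  if ∣ S ∣ ≤ᵇ 2 ^ℕ a then isEmpty (survivors T h (image S h empty)) else false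
outcome (more a b s) (h , ω) S T =
  if ∣ S ∣ ≤ᵇ 2 ^ℕ a then outcome s ω (survivors T h (image S h empty)) S else false

result-run : ∀ {m r X Y} (s : Schedule r) (ω : Sample s m) (f : X → Subset m) (g : Y → Subset m) x y →
             result (run s ω f g) x y ≡ outcome s ω (f x) (g y)
result-run (last a b) h f g x y with ∣ f x ∣ ≤ᵇ 2 ^ℕ a
... | true  = result-sendBlocks a _ _ x y refl
... | false = refl
result-run (more a b s) (h , ω) f g x y with ∣ f x ∣ ≤ᵇ 2 ^ℕ a
... | true  = trans (result-sendBlocks a _ _ x y refl) (result-run s ω _ f y x)
... | false = refl

bits-transmit : ∀ {m r X Y} a b (h : Hash (a + b) m) (f : X → Subset m) p {x y n} →
                (∀ A → bits {Y = Y} {r = suc r} (p A) x y ≤ n) →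
                bits (transmit a b h f p) x y ≤ 1 + 2 ^ℕ a * (1 + 2 * b) + n
bits-transmit a b h f p {x} {y} {n} hyp with ∣ f x ∣ ≤ᵇ 2 ^ℕ a in small
... | false = s≤s z≤n
... | true  = s≤s (begin
  bits (sendBlocks a (λ x → image (f x) h empty) p) x y
    ≤⟨ bits-sendBlocks a _ p x y refl ⟩
  2 ^ℕ a + 2 * (b * cardinality A) + bits (p A) x y
    ≤⟨ ℕ.+-mono-≤ (ℕ.+-monoʳ-≤ (2 ^ℕ a) (ℕ.*-monoʳ-≤ 2 (ℕ.*-monoʳ-≤ b ∣A∣≤))) (hyp A) ⟩
  2 ^ℕ a + 2 * (b * 2 ^ℕ a) + n
    ≡⟨ lemma (2 ^ℕ a) b n ⟩
  2 ^ℕ a * (1 + 2 * b) + n ∎)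
  where
  open ℕ.≤-Reasoning
  A = image (f x) h empty
  lemma : ∀ e b n → e + 2 * (b * e) + n ≡ e * (1 + 2 * b) + n
  lemma = solve-∀
  ∣A∣≤ : cardinality A ≤ 2 ^ℕ a
  ∣A∣≤ = begin
    cardinality A                                ≤⟨ cardinality-image (f x) h empty ⟩
    cardinality (empty {a + b}) + ∣ f x ∣        ≡⟨ cong (_+ ∣ f x ∣) (cardinality-empty (a + b)) ⟩
    ∣ f x ∣                                      ≤⟨ ℕ.≤ᵇ⇒≤ _ _ (subst IsTrue (sym small) tt) ⟩
    2 ^ℕ a                                       ∎

bits-run : ∀ {m r X Y} (s : Schedule r) (ω : Sample s m) (f : X → Subset m) (g : Y → Subset m) x y →
           bits (run s ω f g) x y ≤ cost s
bits-run (last a b)   h       f g x y =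
  ℕ.≤-trans (bits-transmit a b h f _ (λ _ → z≤n)) (ℕ.≤-reflexive (ℕ.+-identityʳ _))
bits-run (more a b s) (h , ω) f g x y = bits-transmit a b h f _ (λ A → bits-run s ω _ f y x)

isEmpty-false : ∀ {m} {S : Subset m} {i} → i ∈ S → isEmpty S ≡ false
isEmpty-false {S = S} i∈S = cong not (dec-true (nonempty? S) (_ , i∈S))

outcome-common : ∀ {m r} (s : Schedule r) (ω : Sample s m) {S T i} → i ∈ S → i ∈ T → outcome s ω S T ≡ false
outcome-common (last a b) h {S} i∈S i∈T with ∣ S ∣ ≤ᵇ 2 ^ℕ a
... | true  = isEmpty-false (common⇒survives h empty i∈S i∈T)
... | false = refl
outcome-common (more a b s) (h , ω) {S} i∈S i∈T with ∣ S ∣ ≤ᵇ 2 ^ℕ a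
... | true  = outcome-common s ω (common⇒survives h empty i∈S i∈T) i∈S
... | false = refl

-- (1 + 1/M)^x ≤ 1 / (1 - x/M), with M = x + y.

bernoulli : ∀ x y M → x + y ≡ M → suc M ^ℕ x * y ≤ M ^ℕ x * M
bernoulli zero    y M refl = ℕ.≤-refl
bernoulli (suc x) y M refl = begin
  suc M * suc M ^ℕ x * y      ≡⟨ lemma (suc M) (suc M ^ℕ x) y ⟩
  suc M ^ℕ x * (y + M * y)    ≤⟨ ℕ.*-monoʳ-≤ (suc M ^ℕ x) (ℕ.+-monoˡ-≤ (M * y) (ℕ.m≤n+m y (suc x))) ⟩
  suc M ^ℕ x * (M + M * y)    ≡⟨ lemma′ (suc M ^ℕ x) M y ⟩
  M * (suc M ^ℕ x * suc y)    ≤⟨ ℕ.*-monoʳ-≤ M (bernoulli x (suc y) M (ℕ.+-suc x y)) ⟩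
  M * (M ^ℕ x * M)            ≡⟨ ℕ.*-assoc M (M ^ℕ x) M ⟨
  M * M ^ℕ x * M              ∎
  where
  open ℕ.≤-Reasoning
  lemma : ∀ m p y → m * p * y ≡ p * (m * y)
  lemma = solve-∀
  lemma′ : ∀ p M y → p * (M + M * y) ≡ M * (p * suc y)
  lemma′ = solve-∀

-- With `M = 2j` and `x ≤ M/2`, the bound `1 / (1 - x/M)` of `bernoulli` is at most 2. Read for
-- `x = j`, it also says `2^(1/j) ≥ 1 + 1/(2j)`.
suc-^-half : ∀ {j x} → x ≤ j → suc (2 * j) ^ℕ x ≤ 2 * (2 * j) ^ℕ x
suc-^-half {zero}      {zero} z≤n = s≤s z≤n
suc-^-half {j@(suc _)} {x}    x≤j = ℕ.*-cancelʳ-≤ _ _ M (begin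
  suc M ^ℕ x * M             ≤⟨ ℕ.*-monoʳ-≤ (suc M ^ℕ x) M≤ ⟩
  suc M ^ℕ x * (2 * y)       ≡⟨ lemma (suc M ^ℕ x) 2 y ⟩
  2 * (suc M ^ℕ x * y)       ≤⟨ ℕ.*-monoʳ-≤ 2 (bernoulli x y M (ℕ.m+[n∸m]≡n (ℕ.≤-trans x≤j (ℕ.m≤n*m j 2)))) ⟩
  2 * (M ^ℕ x * M)           ≡⟨ ℕ.*-assoc 2 (M ^ℕ x) M ⟨
  2 * M ^ℕ x * M             ∎)
  where
  open ℕ.≤-Reasoning
  M y : ℕ
  M = 2 * j
  y = M ∸ x
  lemma : ∀ a b c → a * (b * c) ≡ b * (a * c)
  lemma = solve-∀
  M≤ : M ≤ 2 * y
  M≤ = ℕ.*-monoʳ-≤ 2 (ℕ.≤-trans (ℕ.m+n≤o⇒m≤o∸n j (ℕ.≤-trans (ℕ.+-monoʳ-≤ j x≤j) (ℕ.≤-reflexive (cong (_+_ j) (sym (ℕ.+-identityʳ j)))))) ℕ.≤-refl)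

-- The exponent is cut into at most `q` blocks of length at most `j`; each costs a factor 2.
suc-^-bound : ∀ j q x → x ≤ j * q → suc (2 * j) ^ℕ x ≤ 2 ^ℕ q * (2 * j) ^ℕ x
suc-^-bound j zero    x x≤ rewrite ℕ.*-zeroʳ j with z≤n ← x≤ = ℕ.≤-refl
suc-^-bound j (suc q) x x≤ with ℕ.≤-total x j
... | inj₁ x≤j = ℕ.≤-trans (suc-^-half x≤j) (ℕ.*-monoˡ-≤ ((2 * j) ^ℕ x) (ℕ.^-monoʳ-≤ 2 {1} {suc q} (s≤s z≤n)))
... | inj₂ j≤x with y , refl ← ℕ.m≤n⇒∃[o]m+o≡n j≤x = begin
  suc M ^ℕ (j + y)                      ≡⟨ ℕ.^-distribˡ-+-* (suc M) j y ⟩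
  suc M ^ℕ j * suc M ^ℕ y               ≤⟨ ℕ.*-mono-≤ (suc-^-half {j} ℕ.≤-refl) (suc-^-bound j q y y≤) ⟩
  2 * M ^ℕ j * (2 ^ℕ q * M ^ℕ y)        ≡⟨ lemma 2 (M ^ℕ j) (2 ^ℕ q) (M ^ℕ y) ⟩
  2 ^ℕ suc q * (M ^ℕ j * M ^ℕ y)        ≡⟨ cong (2 ^ℕ suc q *_) (ℕ.^-distribˡ-+-* M j y) ⟨
  2 ^ℕ suc q * M ^ℕ (j + y)             ∎
  where
  open ℕ.≤-Reasoning
  M : ℕ
  M = 2 * j
  lemma : ∀ a b c d → a * b * (c * d) ≡ a * c * (b * d)
  lemma = solve-∀
  y≤ : y ≤ j * q
  y≤ = ℕ.+-cancelˡ-≤ j y (j * q) (ℕ.≤-trans x≤ (ℕ.≤-reflexive (ℕ.*-suc j q)))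

length-words : ∀ d → length (words d) ≡ 2 ^ℕ d
length-words d = length-tuples _ d

-- The instance `M = 2j`, `N = 2^(a+b)` of `moment`: the extra factor `2^b` of the hash range is
-- shared between the base `z` of the moment and the smallness `1/(2j)` of the increment per
-- element.
moment-bound : ∀ a b z j q .{{_ : NonZero j}} {m} {S T : Subset m} → Apart S T → 2 ^ℕ b ≡ z * (2 * j) →
               ∣ S ∣ ≤ 2 ^ℕ a → ∣ T ∣ ≤ j * q →
               ∑[ h ← tuples (words (a + b)) m ] z ^ℕ ∣ survivors T h (image S h empty) ∣
                 ≤ 2 ^ℕ q * length (tuples (words (a + b)) m)
moment-bound a b z j q {m} {S} {T} ST eq ∣S∣≤ ∣T∣≤ = ℕ.*-cancelʳ-≤ _ _ (M ^ℕ ∣ T ∣) {{ℕ.m^n≢0 M ∣ T ∣ {{ℕ.m*n≢0 2 j}}}} (begin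
  X * M ^ℕ ∣ T ∣
    ≤⟨ moment z M N (2 ^ℕ a) ST empty refl (trans (ℕ.^-distribˡ-+-* 2 a b) (cong (2 ^ℕ a *_) eq))
        (ℕ.≤-trans (ℕ.≤-reflexive (cong (_+ ∣ S ∣) (cardinality-empty (a + b)))) ∣S∣≤) ⟩
  N ^ℕ m * suc M ^ℕ ∣ T ∣
    ≤⟨ ℕ.*-monoʳ-≤ (N ^ℕ m) (suc-^-bound j q ∣ T ∣ ∣T∣≤) ⟩
  N ^ℕ m * (2 ^ℕ q * M ^ℕ ∣ T ∣)
    ≡⟨ lemma (N ^ℕ m) (2 ^ℕ q) (M ^ℕ ∣ T ∣) ⟩
  2 ^ℕ q * N ^ℕ m * M ^ℕ ∣ T ∣
    ≡⟨ cong (λ n → 2 ^ℕ q * n * M ^ℕ ∣ T ∣) (trans (length-tuples (words (a + b)) m) (cong (_^ℕ m) (length-words (a + b)))) ⟨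
  2 ^ℕ q * length H * M ^ℕ ∣ T ∣ ∎)
  where
  open ℕ.≤-Reasoning
  M N X : ℕ
  M = 2 * j
  N = 2 ^ℕ (a + b)
  H : List (Hash (a + b) m)
  H = tuples (words (a + b)) m
  X = ∑[ h ← H ] z ^ℕ ∣ survivors T h (image S h empty) ∣
  lemma : ∀ a b c → a * (b * c) ≡ b * a * c
  lemma = solve-∀

-- Failure probabilities

failures : ∀ {m r} (s : Schedule r) → Subset m → Subset m → ℕ
failures {m} s S T = ∑[ ω ← samples s m ] indicator (not (outcome s ω S T))

∈⇒1≤∣∣ : ∀ {m} {S : Subset m} {i} → i ∈ S → 1 ≤ ∣ S ∣
∈⇒1≤∣∣ {S = true  ∷ S} _           = s≤s z≤n
∈⇒1≤∣∣ {S = false ∷ S} (there i∈S) = ∈⇒1≤∣∣ i∈S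

≤⇒≤ᵇ≡true : ∀ {m n} → m ≤ n → (m ≤ᵇ n) ≡ true
≤⇒≤ᵇ≡true {m} {n} m≤n with m ≤ᵇ n in eq
... | true  = refl
... | false = ⊥-elim (subst IsTrue eq (ℕ.≤⇒≤ᵇ m≤n))

-- The moment bound with `z = 2^w`, `j = 2^κ`, `q = 1` has right-hand side 2, and a single survivor
-- already contributes `2^w`. So the last turn fails with probability at most `2 / 2^w`.
failures-last : ∀ {m r} a w κ {S T : Subset m} → Apart S T → ∣ S ∣ ≤ 2 ^ℕ a → ∣ T ∣ ≤ 2 ^ℕ κ →
                failures (last {r} a (w + suc κ)) S T * 2 ^ℕ w ≤ 2 * length (samples (last {r} a (w + suc κ)) m)
failures-last {m} a w κ {S} {T} ST ∣S∣≤ ∣T∣≤ = begin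
  ∑ H (λ h → indicator (not (if ∣ S ∣ ≤ᵇ 2 ^ℕ a then isEmpty (T′ h) else false))) * 2 ^ℕ w
    ≡⟨ ∑-*ʳ H (2 ^ℕ w) ⟨
  ∑ H (λ h → indicator (not (if ∣ S ∣ ≤ᵇ 2 ^ℕ a then isEmpty (T′ h) else false)) * 2 ^ℕ w)
    ≤⟨ ∑-mono H pointwise ⟩
  ∑ H (λ h → (2 ^ℕ w) ^ℕ ∣ T′ h ∣)
    ≤⟨ moment-bound a (w + suc κ) (2 ^ℕ w) (2 ^ℕ κ) 1 {{ℕ.m^n≢0 2 κ}} ST (ℕ.^-distribˡ-+-* 2 w (suc κ)) ∣S∣≤
         (ℕ.≤-trans ∣T∣≤ (ℕ.≤-reflexive (sym (ℕ.*-identityʳ _)))) ⟩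
  2 * length H ∎
  where
  open ℕ.≤-Reasoning
  H : List (Hash (a + (w + suc κ)) m)
  H = tuples (words (a + (w + suc κ))) m
  T′ : Hash (a + (w + suc κ)) m → Subset m
  T′ h = survivors T h (image S h empty)
  nonempty : ∀ (U : Subset m) → indicator (not (isEmpty U)) * 2 ^ℕ w ≤ (2 ^ℕ w) ^ℕ ∣ U ∣
  nonempty U with nonempty? U
  ... | no  _         = z≤n
  ... | yes (i , i∈U) = begin
    2 ^ℕ w + 0          ≡⟨ ℕ.+-identityʳ _ ⟩
    2 ^ℕ w              ≡⟨ ℕ.^-identityʳ _ ⟨
    (2 ^ℕ w) ^ℕ 1       ≤⟨ ℕ.^-monoʳ-≤ (2 ^ℕ w) {{ℕ.m^n≢0 2 w}} (∈⇒1≤∣∣ i∈U) ⟩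
    (2 ^ℕ w) ^ℕ ∣ U ∣   ∎
  pointwise : ∀ h → indicator (not (if ∣ S ∣ ≤ᵇ 2 ^ℕ a then isEmpty (T′ h) else false)) * 2 ^ℕ w
                    ≤ (2 ^ℕ w) ^ℕ ∣ T′ h ∣
  pointwise h rewrite ≤⇒≤ᵇ≡true ∣S∣≤ = nonempty (T′ h)

failures≤ : ∀ {m r} (s : Schedule r) (S T : Subset m) → failures s S T ≤ length (samples s m)
failures≤ {m} s S T = ℕ.≤-trans (∑-mono (samples s m) (λ ω → indicator≤1 (not (outcome s ω S T))))
  (ℕ.≤-reflexive (trans (∑-const (samples s m) 1) (ℕ.*-identityʳ _)))
  where
  indicator≤1 : ∀ b → indicator b ≤ 1
  indicator≤1 false = z≤n
  indicator≤1 true  = ℕ.≤-refl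

-- Markov's inequality for z^|T′|, T′ being the set of survivors.

oversized : ∀ a b z j q n .{{_ : NonZero j}} .{{_ : NonZero z}} {m} {S T : Subset m} → Apart S T → 2 ^ℕ b ≡ z * (2 * j) →
            ∣ S ∣ ≤ 2 ^ℕ a → ∣ T ∣ ≤ j * q →
            (∑[ h ← tuples (words (a + b)) m ] indicator (n <ᵇ ∣ survivors T h (image S h empty) ∣)) * z ^ℕ n
              ≤ 2 ^ℕ q * length (tuples (words (a + b)) m)
oversized a b z j q n {m} {S} {T} ST eq ∣S∣≤ ∣T∣≤ = begin
  ∑ H (λ h → indicator (n <ᵇ ∣ T′ h ∣)) * z ^ℕ n      ≡⟨ ∑-*ʳ H (z ^ℕ n) ⟨
  ∑ H (λ h → indicator (n <ᵇ ∣ T′ h ∣) * z ^ℕ n)      ≤⟨ ∑-mono H (λ h → pointwise ∣ T′ h ∣) ⟩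
  ∑ H (λ h → z ^ℕ ∣ T′ h ∣)                           ≤⟨ moment-bound a b z j q ST eq ∣S∣≤ ∣T∣≤ ⟩
  2 ^ℕ q * length H                                   ∎
  where
  open ℕ.≤-Reasoning
  H : List (Hash (a + b) m)
  H = tuples (words (a + b)) m
  T′ : Hash (a + b) m → Subset m
  T′ h = survivors T h (image S h empty)
  pointwise : ∀ x → indicator (n <ᵇ x) * z ^ℕ n ≤ z ^ℕ x
  pointwise x with n <ᵇ x in lt
  ... | false = z≤n
  ... | true  = ℕ.≤-trans (ℕ.≤-reflexive (ℕ.+-identityʳ _))
                          (ℕ.^-monoʳ-≤ z (ℕ.<⇒≤ (ℕ.<ᵇ⇒< n x (subst IsTrue (sym lt) tt))))

-- A union bound over the common denominator `X`. More than `n` survivors have probability at most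
-- `2^q / z^n ≤ B′/X` and are counted as a certain failure; otherwise the remaining schedule fails
-- with probability at most `B/X`.
failures-more : ∀ {m r} a b z j q n (s : Schedule r) X B B′ .{{_ : NonZero j}} .{{_ : NonZero z}} {S T : Subset m} →
                Apart S T → 2 ^ℕ b ≡ z * (2 * j) → ∣ S ∣ ≤ 2 ^ℕ a → ∣ T ∣ ≤ j * q →
                X * 2 ^ℕ q ≤ B′ * z ^ℕ n →
                (∀ T′ → Apart T′ S → ∣ T′ ∣ ≤ ∣ T ∣ → ∣ T′ ∣ ≤ n → failures s T′ S * X ≤ length (samples s m) * B) →
                failures (more a b s) S T * X ≤ length (samples (more a b s) m) * (B + B′)
failures-more {m} a b z j q n s X B B′ {S} {T} ST eq ∣S∣≤ ∣T∣≤ X≤ rec = begin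
  failures (more a b s) S T * X
    ≡⟨ cong (_* X) (∑-cartesian _,_ H (samples s m)) ⟩
  ∑ H (λ h → ∑ (samples s m) (λ ω → indicator (not (outcome (more a b s) (h , ω) S T)))) * X
    ≡⟨ cong (_* X) (∑-cong H (λ h → unflag h)) ⟩
  ∑ H (λ h → failures s (T′ h) S) * X
    ≡⟨ ∑-*ʳ H X ⟨
  ∑ H (λ h → failures s (T′ h) S * X)
    ≤⟨ ∑-mono H pointwise ⟩
  ∑ H (λ h → l * B + indicator (n <ᵇ ∣ T′ h ∣) * (l * X))
    ≡⟨ trans (∑-+ H) (cong₂ _+_ (∑-const H (l * B)) (∑-*ʳ H (l * X))) ⟩
  length H * (l * B) + bad * (l * X)
    ≤⟨ ℕ.+-monoʳ-≤ (length H * (l * B)) bad≤ ⟩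
  length H * (l * B) + length H * (l * B′)
    ≡⟨ lemma (length H) l B B′ ⟩
  length H * l * (B + B′)
    ≡⟨ cong (_* (B + B′)) (length-cartesian _,_ H (samples s m)) ⟨
  length (samples (more a b s) m) * (B + B′) ∎
  where
  open ℕ.≤-Reasoning
  H : List (Hash (a + b) m)
  H = tuples (words (a + b)) m
  T′ : Hash (a + b) m → Subset m
  T′ h = survivors T h (image S h empty)
  l bad : ℕ
  l = length (samples s m)
  bad = ∑[ h ← H ] indicator (n <ᵇ ∣ T′ h ∣)
  lemma : ∀ h l b c → h * (l * b) + h * (l * c) ≡ h * l * (b + c)
  lemma = solve-∀
  unflag : ∀ h → ∑ (samples s m) (λ ω → indicator (not (outcome (more a b s) (h , ω) S T))) ≡ failures s (T′ h) S
  unflag h rewrite ≤⇒≤ᵇ≡true ∣S∣≤ = refl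
  pointwise : ∀ h → failures s (T′ h) S * X ≤ l * B + indicator (n <ᵇ ∣ T′ h ∣) * (l * X)
  pointwise h with n <ᵇ ∣ T′ h ∣ in lt
  ... | true  = ℕ.≤-trans (ℕ.*-monoˡ-≤ X (failures≤ s (T′ h) S))
                          (ℕ.≤-trans (ℕ.≤-reflexive (sym (ℕ.+-identityʳ _))) (ℕ.m≤n+m _ (l * B)))
  ... | false = ℕ.≤-trans (rec (T′ h) (Apart-survivors h _ ST) (∣survivors∣≤ T h _)
                             (ℕ.≮⇒≥ (λ n< → subst IsTrue lt (ℕ.<⇒<ᵇ n<))))
                          (ℕ.m≤m+n (l * B) _)
  swap : ∀ a b c d → a * (b * c) * d ≡ b * (a * (c * d))
  swap = solve-∀
  bad≤ : bad * (l * X) ≤ length H * (l * B′)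
  bad≤ = ℕ.*-cancelʳ-≤ _ _ (2 ^ℕ q) {{ℕ.m^n≢0 2 q}} (begin
    bad * (l * X) * 2 ^ℕ q              ≡⟨ swap bad l X (2 ^ℕ q) ⟩
    l * (bad * (X * 2 ^ℕ q))            ≤⟨ ℕ.*-monoʳ-≤ l (ℕ.*-monoʳ-≤ bad X≤) ⟩
    l * (bad * (B′ * z ^ℕ n))           ≡⟨ swap₂ l bad B′ (z ^ℕ n) ⟩
    l * B′ * (bad * z ^ℕ n)             ≤⟨ ℕ.*-monoʳ-≤ (l * B′) (oversized a b z j q n ST eq ∣S∣≤ ∣T∣≤) ⟩
    l * B′ * (2 ^ℕ q * length H)        ≡⟨ swap₃ (l * B′) (2 ^ℕ q) (length H) ⟩
    length H * (l * B′) * 2 ^ℕ q        ∎)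
    where
    swap₂ : ∀ a b c d → a * (b * (c * d)) ≡ a * c * (b * d)
    swap₂ = solve-∀
    swap₃ : ∀ a b c → a * (b * c) ≡ c * a * b
    swap₃ = solve-∀

-- The schedule of growing hash widths: failure probability and cost

-- The innermost exponential is taken first, following the parameter `t` of a schedule from turn to
-- turn; `tower-suc` exposes the outermost one.
tower : ℕ → ℕ → ℕ
tower zero    t = t
tower (suc n) t = tower n (2 ^ℕ t)

-- Here k < 2^(8u).  A turn with t ≤ u leaves at most 2^(8u - 4t) elements.  When
-- t > u, one turn with 8u bits per element already goes down to 2^(4u) elements,
-- and the next turn can afford 2^(4u) ≥ √k bits for each of them.

schedule : ℕ → ∀ r → ℕ → ℕ → Schedule (suc r)
schedule u zero    a t = last a (t + suc (8 * u))
schedule u (suc r) a t with t ℕ.≤? u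
... | yes _ = more a (8 * t) (schedule u r (8 * u ∸ 4 * t) (2 ^ℕ t))
... | no  _ = more a (8 * u) (last (4 * u) (2 ^ℕ (4 * u) + suc (8 * u)))

1≤2^ : ∀ n → 1 ≤ 2 ^ℕ n
1≤2^ n = ℕ.m^n>0 2 n

n<2^n : ∀ n → n < 2 ^ℕ n
n<2^n zero    = s≤s z≤n
n<2^n (suc n) = begin
  1 + suc n              ≤⟨ ℕ.+-mono-≤ (1≤2^ n) (n<2^n n) ⟩
  2 ^ℕ n + 2 ^ℕ n        ≡⟨ cong (_+_ (2 ^ℕ n)) (ℕ.+-identityʳ _) ⟨
  2 ^ℕ suc n             ∎
  where open ℕ.≤-Reasoning

-- After division the bound reads `2/R + 3/W + 2/(W 2^t)`. The summand `2/R` comes from a last turn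
-- reached by growth of `t`, `3/W` from the two turns of the branch `t > u`, and the last one from
-- oversized sets: a turn adds `1/(W 2^t)`, and the later ones add at most
-- `2/(W 2^(2^t)) ≤ 1/(W 2^t)`.
failures-schedule : ∀ {m} u r a t {S T : Subset m} → 1 ≤ u → 1 ≤ t → Apart S T →
  ∣ S ∣ ≤ 2 ^ℕ a → ∣ S ∣ ≤ 2 ^ℕ (8 * u) → ∣ T ∣ ≤ 2 ^ℕ (8 * u) →
  let W = 2 ^ℕ (2 ^ℕ (4 * u)); R = 2 ^ℕ tower r t; s = schedule u r a t in
  failures s S T * (W * R * 2 ^ℕ t) ≤ length (samples s m) * ((2 * W + 3 * R) * 2 ^ℕ t + 2 * R)
failures-schedule {m} u zero a t {S} {T} 1≤u 1≤t ST ∣S∣≤a ∣S∣≤ ∣T∣≤ = begin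
  f * (W * R * R)               ≡⟨ lemma f W R ⟩
  f * R * (W * R)               ≤⟨ ℕ.*-monoˡ-≤ (W * R) (failures-last {r = 0} a t (8 * u) ST ∣S∣≤a ∣T∣≤) ⟩
  2 * l * (W * R)               ≡⟨ lemma′ l W R ⟩
  l * (2 * W * R)               ≤⟨ ℕ.*-monoʳ-≤ l (ℕ.≤-trans (ℕ.*-monoˡ-≤ R (ℕ.m≤m+n (2 * W) (3 * R))) (ℕ.m≤m+n _ _)) ⟩
  l * ((2 * W + 3 * R) * R + 2 * R) ∎
  where
  open ℕ.≤-Reasoning
  f l W R : ℕ
  f = failures (schedule u 0 a t) S T
  l = length (samples (schedule u 0 a t) m)
  W = 2 ^ℕ (2 ^ℕ (4 * u))
  R = 2 ^ℕ t
  lemma : ∀ f W R → f * (W * R * R) ≡ f * R * (W * R)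
  lemma = solve-∀
  lemma′ : ∀ l W R → 2 * l * (W * R) ≡ l * (2 * W * R)
  lemma′ = solve-∀
failures-schedule {m} u (suc r) a t {S} {T} 1≤u 1≤t ST ∣S∣≤a ∣S∣≤ ∣T∣≤ with t ℕ.≤? u
... | yes t≤u = begin
  failures (more a (8 * t) s) S T * (W * R * 2 ^ℕ t)
    ≤⟨ failures-more a (8 * t) z j (2 * n) n s (W * R * 2 ^ℕ t) (F * 2 ^ℕ t + R) R
         {{ℕ.m^n≢0 2 (ℕ.pred (4 * t))}} {{ℕ.m^n≢0 2 (4 * t)}}
         ST 2^8t ∣S∣≤a ∣T∣≤jq X≤ rec ⟩
  length (samples (more a (8 * t) s) m) * (F * 2 ^ℕ t + R + R)
    ≡⟨ cong (length (samples (more a (8 * t) s) m) *_) (double (F * 2 ^ℕ t) R) ⟩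
  length (samples (more a (8 * t) s) m) * (F * 2 ^ℕ t + 2 * R) ∎
  where
  open ℕ.≤-Reasoning
  W R F z j n : ℕ
  W = 2 ^ℕ (2 ^ℕ (4 * u))
  R = 2 ^ℕ tower r (2 ^ℕ t)
  F = 2 * W + 3 * R
  z = 2 ^ℕ (4 * t)
  j = 2 ^ℕ ℕ.pred (4 * t)
  n = 2 ^ℕ (8 * u ∸ 4 * t)
  s : Schedule (suc r)
  s = schedule u r (8 * u ∸ 4 * t) (2 ^ℕ t)
  instance
    4t≢0 : NonZero (4 * t)
    4t≢0 = ℕ.m*n≢0 4 t {{_}} {{ℕ.>-nonZero 1≤t}}
  double : ∀ a b → a + b + b ≡ a + 2 * b
  double = solve-∀
  2j : z ≡ 2 * j
  2j = cong (2 ^ℕ_) (sym (ℕ.suc-pred (4 * t)))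
  2^8t : 2 ^ℕ (8 * t) ≡ z * (2 * j)
  2^8t = trans (cong (2 ^ℕ_) (8t t)) (trans (ℕ.^-distribˡ-+-* 2 (4 * t) (4 * t)) (cong (z *_) 2j))
    where
    8t : ∀ t → 8 * t ≡ 4 * t + 4 * t
    8t = solve-∀
  4t≤8u : 4 * t ≤ 8 * u
  4t≤8u = ℕ.≤-trans (ℕ.*-monoʳ-≤ 4 t≤u) (ℕ.*-monoˡ-≤ u {4} {8} (ℕ.m≤m+n 4 4))
  Q≤n : 2 ^ℕ (4 * u) ≤ n
  Q≤n = ℕ.^-monoʳ-≤ 2 (ℕ.m+n≤o⇒m≤o∸n (4 * u) (ℕ.≤-trans (ℕ.+-monoʳ-≤ (4 * u) (ℕ.*-monoʳ-≤ 4 t≤u)) (ℕ.≤-reflexive (8u u))))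
    where
    8u : ∀ u → 4 * u + 4 * u ≡ 8 * u
    8u = solve-∀
  ∣T∣≤jq : ∣ T ∣ ≤ j * (2 * n)
  ∣T∣≤jq = begin
    ∣ T ∣                            ≤⟨ ∣T∣≤ ⟩
    2 ^ℕ (8 * u)                     ≡⟨ cong (2 ^ℕ_) (ℕ.m+[n∸m]≡n 4t≤8u) ⟨
    2 ^ℕ (4 * t + (8 * u ∸ 4 * t))   ≡⟨ ℕ.^-distribˡ-+-* 2 (4 * t) _ ⟩
    z * n                            ≡⟨ cong (_* n) 2j ⟩
    2 * j * n                        ≡⟨ trans (cong (_* n) (ℕ.*-comm 2 j)) (ℕ.*-assoc j 2 n) ⟩
    j * (2 * n)                      ∎
  -- On the left are the exponents of `W`, of `2^t` and of the moment bound, on the right that of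
  -- `z^n`. Here `t ≤ u` is used: it gives `2^(4u) ≤ n`.
  exponents : 2 ^ℕ (4 * u) + t + 2 * n ≤ 4 * t * n
  exponents = begin
    2 ^ℕ (4 * u) + t + 2 * n          ≤⟨ ℕ.+-mono-≤ (ℕ.+-mono-≤ (ℕ.≤-trans Q≤n n≤tn) (ℕ.m≤m*n t n {{ℕ.m^n≢0 2 (8 * u ∸ 4 * t)}})) (ℕ.*-monoʳ-≤ 2 n≤tn) ⟩
    t * n + t * n + 2 * (t * n)       ≡⟨ four t n ⟩
    4 * t * n                         ∎
    where
    n≤tn : n ≤ t * n
    n≤tn = ℕ.m≤n*m n t {{ℕ.>-nonZero 1≤t}}
    four : ∀ t n → t * n + t * n + 2 * (t * n) ≡ 4 * t * n
    four = solve-∀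
  X≤ : W * R * 2 ^ℕ t * 2 ^ℕ (2 * n) ≤ R * z ^ℕ n
  X≤ = begin
    W * R * 2 ^ℕ t * 2 ^ℕ (2 * n)       ≡⟨ rot W R (2 ^ℕ t) (2 ^ℕ (2 * n)) ⟩
    R * (W * 2 ^ℕ t * 2 ^ℕ (2 * n))     ≡⟨ cong (λ x → R * (x * 2 ^ℕ (2 * n))) (ℕ.^-distribˡ-+-* 2 (2 ^ℕ (4 * u)) t) ⟨
    R * (2 ^ℕ (2 ^ℕ (4 * u) + t) * 2 ^ℕ (2 * n)) ≡⟨ cong (R *_) (ℕ.^-distribˡ-+-* 2 (2 ^ℕ (4 * u) + t) (2 * n)) ⟨
    R * 2 ^ℕ (2 ^ℕ (4 * u) + t + 2 * n) ≤⟨ ℕ.*-monoʳ-≤ R (ℕ.^-monoʳ-≤ 2 exponents) ⟩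
    R * 2 ^ℕ (4 * t * n)                ≡⟨ cong (R *_) (ℕ.^-*-assoc 2 (4 * t) n) ⟨
    R * z ^ℕ n                          ∎
    where
    rot : ∀ a b c d → a * b * c * d ≡ b * (a * c * d)
    rot = solve-∀
  rec : ∀ T′ → Apart T′ S → ∣ T′ ∣ ≤ ∣ T ∣ → ∣ T′ ∣ ≤ n →
        failures s T′ S * (W * R * 2 ^ℕ t) ≤ length (samples s m) * (F * 2 ^ℕ t + R)
  -- Writing `2^t = 1 + t + e` gives `2^(2^t) = 2 · 2^t · 2^e`. The factor 2 halves the correction
  -- term of the later turns, and the surplus `2^e` is cancelled.
  rec T′ T′S ∣T′∣≤∣T∣ ∣T′∣≤n with e , 2^t≡ ← ℕ.m≤n⇒∃[o]m+o≡n (n<2^n t) =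
    ℕ.*-cancelʳ-≤ _ _ (2 * 2 ^ℕ e) {{ℕ.m*n≢0 2 (2 ^ℕ e) {{_}} {{ℕ.m^n≢0 2 e}}}} (begin
    f * (W * R * 2 ^ℕ t) * (2 * E)       ≡⟨ lemma₁ f (W * R) (2 ^ℕ t) E ⟩
    f * (W * R * (2 * 2 ^ℕ t * E))       ≡⟨ cong (λ x → f * (W * R * x)) 2^2^t ⟨
    f * (W * R * 2 ^ℕ (2 ^ℕ t))          ≤⟨ failures-schedule u r (8 * u ∸ 4 * t) (2 ^ℕ t) 1≤u (1≤2^ t) T′S
                                              ∣T′∣≤n (ℕ.≤-trans ∣T′∣≤∣T∣ ∣T∣≤) ∣S∣≤ ⟩
    l * (F * 2 ^ℕ (2 ^ℕ t) + 2 * R)      ≡⟨ cong (λ x → l * (F * x + 2 * R)) 2^2^t ⟩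
    l * (F * (2 * 2 ^ℕ t * E) + 2 * R)   ≤⟨ ℕ.*-monoʳ-≤ l (ℕ.+-monoʳ-≤ (F * (2 * 2 ^ℕ t * E)) (ℕ.m≤m*n (2 * R) E {{ℕ.m^n≢0 2 e}})) ⟩
    l * (F * (2 * 2 ^ℕ t * E) + 2 * R * E) ≡⟨ lemma₂ l F (2 ^ℕ t) E R ⟩
    l * (F * 2 ^ℕ t + R) * (2 * E)       ∎)
    where
    E f l : ℕ
    E = 2 ^ℕ e
    f = failures s T′ S
    l = length (samples s m)
    2^2^t : 2 ^ℕ (2 ^ℕ t) ≡ 2 * 2 ^ℕ t * E
    2^2^t = trans (cong (2 ^ℕ_) (sym 2^t≡)) (ℕ.^-distribˡ-+-* 2 (suc t) e)
    lemma₁ : ∀ f a b e → f * (a * b) * (2 * e) ≡ f * (a * (2 * b * e))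
    lemma₁ = solve-∀
    lemma₂ : ∀ l f b e r → l * (f * (2 * b * e) + 2 * r * e) ≡ l * (f * b + r) * (2 * e)
    lemma₂ = solve-∀
... | no t≰u = begin
  failures (more a (8 * u) s) S T * (W * R * 2 ^ℕ t)
    ≤⟨ failures-more a (8 * u) n j (2 * n) n s (W * R * 2 ^ℕ t) (2 * (R * 2 ^ℕ t)) (R * 2 ^ℕ t)
         {{ℕ.m^n≢0 2 (ℕ.pred (4 * u))}} {{ℕ.m^n≢0 2 (4 * u)}}
         ST 2^8u ∣S∣≤a ∣T∣≤jq X≤ rec ⟩
  length (samples (more a (8 * u) s) m) * (2 * (R * 2 ^ℕ t) + R * 2 ^ℕ t)
    ≡⟨ cong (length (samples (more a (8 * u) s) m) *_) (triple R (2 ^ℕ t)) ⟩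
  length (samples (more a (8 * u) s) m) * (3 * R * 2 ^ℕ t)
    ≤⟨ ℕ.*-monoʳ-≤ (length (samples (more a (8 * u) s) m)) (ℕ.≤-trans (ℕ.*-monoˡ-≤ (2 ^ℕ t) (ℕ.m≤n+m (3 * R) (2 * W))) (ℕ.m≤m+n _ (2 * R))) ⟩
  length (samples (more a (8 * u) s) m) * ((2 * W + 3 * R) * 2 ^ℕ t + 2 * R) ∎
  where
  open ℕ.≤-Reasoning
  n W R j : ℕ
  n = 2 ^ℕ (4 * u)
  W = 2 ^ℕ n
  R = 2 ^ℕ tower r (2 ^ℕ t)
  j = 2 ^ℕ ℕ.pred (4 * u)
  s : Schedule (suc r)
  s = last (4 * u) (n + suc (8 * u))
  instance
    4u≢0 : NonZero (4 * u)
    4u≢0 = ℕ.m*n≢0 4 u {{_}} {{ℕ.>-nonZero 1≤u}}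
  triple : ∀ a b → 2 * (a * b) + a * b ≡ 3 * a * b
  triple = solve-∀
  2j : n ≡ 2 * j
  2j = cong (2 ^ℕ_) (sym (ℕ.suc-pred (4 * u)))
  2^8u′ : 2 ^ℕ (8 * u) ≡ n * n
  2^8u′ = trans (cong (2 ^ℕ_) (8u u)) (ℕ.^-distribˡ-+-* 2 (4 * u) (4 * u))
    where
    8u : ∀ t → 8 * t ≡ 4 * t + 4 * t
    8u = solve-∀
  2^8u : 2 ^ℕ (8 * u) ≡ n * (2 * j)
  2^8u = trans 2^8u′ (cong (n *_) 2j)
  ∣T∣≤jq : ∣ T ∣ ≤ j * (2 * n)
  ∣T∣≤jq = begin
    ∣ T ∣          ≤⟨ ∣T∣≤ ⟩
    2 ^ℕ (8 * u)   ≡⟨ 2^8u′ ⟩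
    n * n          ≡⟨ cong (_* n) 2j ⟩
    2 * j * n      ≡⟨ trans (cong (_* n) (ℕ.*-comm 2 j)) (ℕ.*-assoc j 2 n) ⟩
    j * (2 * n)    ∎
  X≤ : W * R * 2 ^ℕ t * 2 ^ℕ (2 * n) ≤ R * 2 ^ℕ t * n ^ℕ n
  X≤ = begin
    W * R * 2 ^ℕ t * 2 ^ℕ (2 * n)       ≡⟨ rot W R (2 ^ℕ t) (2 ^ℕ (2 * n)) ⟩
    R * 2 ^ℕ t * (W * 2 ^ℕ (2 * n))     ≡⟨ cong (R * 2 ^ℕ t *_) (ℕ.^-distribˡ-+-* 2 n (2 * n)) ⟨
    R * 2 ^ℕ t * 2 ^ℕ (n + 2 * n)       ≤⟨ ℕ.*-monoʳ-≤ (R * 2 ^ℕ t) (ℕ.^-monoʳ-≤ 2 (ℕ.*-monoˡ-≤ n {3} {4 * u}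
                                             (ℕ.≤-trans (ℕ.m≤m+n 3 1) (ℕ.*-monoʳ-≤ 4 1≤u)))) ⟩
    R * 2 ^ℕ t * 2 ^ℕ (4 * u * n)       ≡⟨ cong (R * 2 ^ℕ t *_) (ℕ.^-*-assoc 2 (4 * u) n) ⟨
    R * 2 ^ℕ t * n ^ℕ n                 ∎
    where
    rot : ∀ a b c d → a * b * c * d ≡ b * c * (a * d)
    rot = solve-∀
  rec : ∀ T′ → Apart T′ S → ∣ T′ ∣ ≤ ∣ T ∣ → ∣ T′ ∣ ≤ n →
        failures s T′ S * (W * R * 2 ^ℕ t) ≤ length (samples s m) * (2 * (R * 2 ^ℕ t))
  -- The closing turn spends `w = 2^(4u)` bits against failure, hence fails with probability at most
  -- `2/W`.
  rec T′ T′S ∣T′∣≤∣T∣ ∣T′∣≤n = begin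
    failures s T′ S * (W * R * 2 ^ℕ t)        ≡⟨ lemma₁ (failures s T′ S) W R (2 ^ℕ t) ⟩
    failures s T′ S * W * (R * 2 ^ℕ t)        ≤⟨ ℕ.*-monoˡ-≤ (R * 2 ^ℕ t) (failures-last {r = r} (4 * u) n (8 * u) T′S ∣T′∣≤n ∣S∣≤) ⟩
    2 * length (samples s m) * (R * 2 ^ℕ t)   ≡⟨ lemma₂ (length (samples s m)) (R * 2 ^ℕ t) ⟩
    length (samples s m) * (2 * (R * 2 ^ℕ t)) ∎
    where
    lemma₁ : ∀ a b c d → a * (b * c * d) ≡ a * b * (c * d)
    lemma₁ = solve-∀
    lemma₂ : ∀ a b → 2 * a * b ≡ a * (2 * b)
    lemma₂ = solve-∀

cost-turn : ∀ a t b → 1 ≤ t → 1 + 2 ^ℕ a * (1 + b * t) ≤ (2 + b) * (2 ^ℕ a * t)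
cost-turn a t b 1≤t = begin
  1 + x * (1 + b * t)            ≤⟨ ℕ.+-mono-≤ (ℕ.*-mono-≤ (1≤2^ a) 1≤t) (ℕ.*-monoʳ-≤ x (ℕ.+-monoˡ-≤ (b * t) 1≤t)) ⟩
  x * t + x * (t + b * t)        ≡⟨ lemma x t b ⟩
  (2 + b) * (x * t)              ∎
  where
  open ℕ.≤-Reasoning
  x : ℕ
  x = 2 ^ℕ a
  lemma : ∀ x t b → x * t + x * (t + b * t) ≡ (2 + b) * (x * t)
  lemma = solve-∀

-- With `K = 2^(8u)` and after division by `2^t`: the current turn costs at most `18 · 2^a t`,
-- everything later at most `K (10 + 36/2^t)`. The `10 K` pays for the closing turn of the branch
-- `t > u`. The rest is a series: the next turn costs at most `18 K/2^t`, since its set has only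
-- `K/2^(4t)` elements, and what follows it adds `36/2^(2^t) ≤ 18/2^t`. The assumption on
-- `tower r t` keeps the summand `8u + 1` in the width of the last turn proportional to its
-- parameter.
cost-schedule : ∀ u r a t → 1 ≤ t → suc (8 * u) ≤ 2 * tower r t →
  cost (schedule u r a t) * 2 ^ℕ t ≤ 18 * (2 ^ℕ a * t) * 2 ^ℕ t + 2 ^ℕ (8 * u) * (10 * 2 ^ℕ t + 36)
cost-schedule u zero a t 1≤t 8u< = ℕ.m≤n⇒m≤n+o _ (ℕ.*-monoˡ-≤ (2 ^ℕ t) (begin
  1 + 2 ^ℕ a * (1 + 2 * (t + suc (8 * u)))  ≤⟨ s≤s (ℕ.*-monoʳ-≤ (2 ^ℕ a) (s≤s (ℕ.*-monoʳ-≤ 2 (ℕ.+-monoʳ-≤ t 8u<)))) ⟩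
  1 + 2 ^ℕ a * (1 + 2 * (t + 2 * t))        ≡⟨ cong (λ x → 1 + 2 ^ℕ a * (1 + x)) (six t) ⟩
  1 + 2 ^ℕ a * (1 + 6 * t)                  ≤⟨ cost-turn a t 6 1≤t ⟩
  8 * (2 ^ℕ a * t)                          ≤⟨ ℕ.*-monoˡ-≤ (2 ^ℕ a * t) (ℕ.m≤m+n 8 10) ⟩
  18 * (2 ^ℕ a * t)                         ∎))
  where
  open ℕ.≤-Reasoning
  six : ∀ t → 2 * (t + 2 * t) ≡ 6 * t
  six = solve-∀
cost-schedule u (suc r) a t 1≤t 8u< with t ℕ.≤? u
... | yes t≤u = begin
  (1 + 2 ^ℕ a * (1 + 2 * (8 * t)) + c) * 2 ^ℕ t
    ≡⟨ cong (λ x → (1 + 2 ^ℕ a * (1 + x) + c) * 2 ^ℕ t) (ℕ.*-assoc 2 8 t) ⟨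
  (1 + 2 ^ℕ a * (1 + 16 * t) + c) * 2 ^ℕ t
    ≤⟨ ℕ.*-monoˡ-≤ (2 ^ℕ t) (ℕ.+-monoˡ-≤ c (cost-turn a t 16 1≤t)) ⟩
  (18 * (2 ^ℕ a * t) + c) * 2 ^ℕ t
    ≡⟨ ℕ.*-distribʳ-+ (2 ^ℕ t) (18 * (2 ^ℕ a * t)) c ⟩
  18 * (2 ^ℕ a * t) * 2 ^ℕ t + c * 2 ^ℕ t
    ≤⟨ ℕ.+-monoʳ-≤ (18 * (2 ^ℕ a * t) * 2 ^ℕ t) rest ⟩
  18 * (2 ^ℕ a * t) * 2 ^ℕ t + 2 ^ℕ (8 * u) * (10 * 2 ^ℕ t + 36) ∎
  where
  open ℕ.≤-Reasoning
  a′ c K : ℕ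
  a′ = 8 * u ∸ 4 * t
  c = cost (schedule u r a′ (2 ^ℕ t))
  K = 2 ^ℕ (8 * u)
  4t≤8u : 4 * t ≤ 8 * u
  4t≤8u = ℕ.≤-trans (ℕ.*-monoʳ-≤ 4 t≤u) (ℕ.*-monoˡ-≤ u {4} {8} (ℕ.m≤m+n 4 4))
  shrink : 2 ^ℕ a′ * 2 ^ℕ t * 2 ^ℕ t ≤ K
  shrink = begin
    2 ^ℕ a′ * 2 ^ℕ t * 2 ^ℕ t    ≡⟨ ℕ.*-assoc (2 ^ℕ a′) (2 ^ℕ t) (2 ^ℕ t) ⟩
    2 ^ℕ a′ * (2 ^ℕ t * 2 ^ℕ t)  ≡⟨ cong (2 ^ℕ a′ *_) (ℕ.^-distribˡ-+-* 2 t t) ⟨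
    2 ^ℕ a′ * 2 ^ℕ (t + t)       ≡⟨ ℕ.^-distribˡ-+-* 2 a′ (t + t) ⟨
    2 ^ℕ (a′ + (t + t))          ≤⟨ ℕ.^-monoʳ-≤ 2 (ℕ.≤-trans (ℕ.+-monoʳ-≤ a′ (ℕ.≤-trans (ℕ.m≤m+n (t + t) (t + t)) (ℕ.≤-reflexive (four t)))) (ℕ.≤-reflexive (ℕ.m∸n+n≡m 4t≤8u))) ⟩
    K                            ∎
    where
    four : ∀ t → t + t + (t + t) ≡ 4 * t
    four = solve-∀
  rest : c * 2 ^ℕ t ≤ K * (10 * 2 ^ℕ t + 36)
  rest with e , 2^t≡ ← ℕ.m≤n⇒∃[o]m+o≡n (n<2^n t) =
    ℕ.*-cancelʳ-≤ _ _ (2 * 2 ^ℕ e) {{ℕ.m*n≢0 2 (2 ^ℕ e) {{_}} {{ℕ.m^n≢0 2 e}}}} (begin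
    c * 2 ^ℕ t * (2 * E)          ≡⟨ lemma₁ c (2 ^ℕ t) E ⟩
    c * (2 * 2 ^ℕ t * E)          ≡⟨ cong (c *_) 2^2^t ⟨
    c * 2 ^ℕ (2 ^ℕ t)             ≤⟨ cost-schedule u r a′ (2 ^ℕ t) (1≤2^ t) 8u< ⟩
    18 * (2 ^ℕ a′ * 2 ^ℕ t) * 2 ^ℕ (2 ^ℕ t) + K * (10 * 2 ^ℕ (2 ^ℕ t) + 36)
      ≡⟨ cong (λ x → 18 * (2 ^ℕ a′ * 2 ^ℕ t) * x + K * (10 * x + 36)) 2^2^t ⟩
    18 * (2 ^ℕ a′ * 2 ^ℕ t) * (2 * 2 ^ℕ t * E) + K * (10 * (2 * 2 ^ℕ t * E) + 36)
      ≤⟨ ℕ.+-monoʳ-≤ (18 * (2 ^ℕ a′ * 2 ^ℕ t) * (2 * 2 ^ℕ t * E)) (ℕ.*-monoʳ-≤ K (ℕ.+-monoʳ-≤ (10 * (2 * 2 ^ℕ t * E)) (ℕ.m≤m*n 36 E {{ℕ.m^n≢0 2 e}}))) ⟩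
    18 * (2 ^ℕ a′ * 2 ^ℕ t) * (2 * 2 ^ℕ t * E) + K * (10 * (2 * 2 ^ℕ t * E) + 36 * E)
      ≡⟨ lemma₂ (2 ^ℕ a′) (2 ^ℕ t) E K ⟩
    (36 * (2 ^ℕ a′ * 2 ^ℕ t * 2 ^ℕ t) + K * (20 * 2 ^ℕ t + 36)) * E
      ≤⟨ ℕ.*-monoˡ-≤ E (ℕ.+-monoˡ-≤ (K * (20 * 2 ^ℕ t + 36)) (ℕ.*-monoʳ-≤ 36 shrink)) ⟩
    (36 * K + K * (20 * 2 ^ℕ t + 36)) * E
      ≡⟨ lemma₃ K (2 ^ℕ t) E ⟩
    K * (10 * 2 ^ℕ t + 36) * (2 * E) ∎)
    where
    E : ℕ
    E = 2 ^ℕ e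
    2^2^t : 2 ^ℕ (2 ^ℕ t) ≡ 2 * 2 ^ℕ t * E
    2^2^t = trans (cong (2 ^ℕ_) (sym 2^t≡)) (ℕ.^-distribˡ-+-* 2 (suc t) e)
    lemma₁ : ∀ c b e → c * b * (2 * e) ≡ c * (2 * b * e)
    lemma₁ = solve-∀
    lemma₂ : ∀ a b e k → 18 * (a * b) * (2 * b * e) + k * (10 * (2 * b * e) + 36 * e)
                         ≡ (36 * (a * b * b) + k * (20 * b + 36)) * e
    lemma₂ = solve-∀
    lemma₃ : ∀ k b e → (36 * k + k * (20 * b + 36)) * e ≡ k * (10 * b + 36) * (2 * e)
    lemma₃ = solve-∀
... | no t≰u = begin
  (1 + 2 ^ℕ a * (1 + 2 * (8 * u)) + (1 + n * (1 + 2 * (n + suc (8 * u))))) * 2 ^ℕ t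
    ≤⟨ ℕ.*-monoˡ-≤ (2 ^ℕ t) (ℕ.+-mono-≤ first second) ⟩
  (18 * (2 ^ℕ a * t) + 10 * (n * n)) * 2 ^ℕ t
    ≡⟨ lemma (18 * (2 ^ℕ a * t)) (n * n) (2 ^ℕ t) ⟩
  18 * (2 ^ℕ a * t) * 2 ^ℕ t + n * n * (10 * 2 ^ℕ t)
    ≤⟨ ℕ.+-monoʳ-≤ (18 * (2 ^ℕ a * t) * 2 ^ℕ t) (ℕ.*-monoʳ-≤ (n * n) (ℕ.m≤m+n (10 * 2 ^ℕ t) 36)) ⟩
  18 * (2 ^ℕ a * t) * 2 ^ℕ t + n * n * (10 * 2 ^ℕ t + 36)
    ≡⟨ cong (λ x → 18 * (2 ^ℕ a * t) * 2 ^ℕ t + x * (10 * 2 ^ℕ t + 36)) 2^8u ⟨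
  18 * (2 ^ℕ a * t) * 2 ^ℕ t + 2 ^ℕ (8 * u) * (10 * 2 ^ℕ t + 36) ∎
  where
  open ℕ.≤-Reasoning
  n : ℕ
  n = 2 ^ℕ (4 * u)
  2^8u : 2 ^ℕ (8 * u) ≡ n * n
  2^8u = trans (cong (2 ^ℕ_) (8u u)) (ℕ.^-distribˡ-+-* 2 (4 * u) (4 * u))
    where
    8u : ∀ t → 8 * t ≡ 4 * t + 4 * t
    8u = solve-∀
  lemma : ∀ x y p → (x + 10 * y) * p ≡ x * p + y * (10 * p)
  lemma = solve-∀
  first : 1 + 2 ^ℕ a * (1 + 2 * (8 * u)) ≤ 18 * (2 ^ℕ a * t)
  first = begin
    1 + 2 ^ℕ a * (1 + 2 * (8 * u)) ≡⟨ cong (λ x → 1 + 2 ^ℕ a * (1 + x)) (ℕ.*-assoc 2 8 u) ⟨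
    1 + 2 ^ℕ a * (1 + 16 * u)      ≤⟨ s≤s (ℕ.*-monoʳ-≤ (2 ^ℕ a) (s≤s (ℕ.*-monoʳ-≤ 16 (ℕ.<⇒≤ (ℕ.≰⇒> t≰u))))) ⟩
    1 + 2 ^ℕ a * (1 + 16 * t)      ≤⟨ cost-turn a t 16 1≤t ⟩
    18 * (2 ^ℕ a * t)              ∎
  second : 1 + n * (1 + 2 * (n + suc (8 * u))) ≤ 10 * (n * n)
  second = begin
    1 + n * (1 + 2 * (n + suc (8 * u)))   ≡⟨ expand n u ⟩
    1 + n * (1 + 2 * n + 2 + 4 * (4 * u)) ≤⟨ ℕ.+-mono-≤ (ℕ.*-mono-≤ 1≤n 1≤n) (ℕ.*-monoʳ-≤ n (ℕ.+-mono-≤ (ℕ.+-mono-≤ (ℕ.+-monoˡ-≤ (2 * n) 1≤n) (ℕ.*-monoʳ-≤ 2 1≤n)) (ℕ.*-monoʳ-≤ 4 (ℕ.<⇒≤ (n<2^n (4 * u)))))) ⟩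
    n * n + n * (n + 2 * n + 2 * n + 4 * n) ≡⟨ collect n ⟩
    10 * (n * n)                          ∎
    where
    1≤n : 1 ≤ n
    1≤n = 1≤2^ (4 * u)
    expand : ∀ n u → 1 + n * (1 + 2 * (n + suc (8 * u))) ≡ 1 + n * (1 + 2 * n + 2 + 4 * (4 * u))
    expand = solve-∀
    collect : ∀ n → n * n + n * (n + 2 * n + 2 * n + 4 * n) ≡ 10 * (n * n)
    collect = solve-∀

-- Integer logarithms and powers of two near `k`

2^⌊log₂n⌋≤n : ∀ n → 1 ≤ n → 2 ^ℕ ⌊log₂ n ⌋ ≤ n
2^⌊log₂n⌋≤n = <-rec _ step
  where
  open ℕ.≤-Reasoning
  step : ∀ n → (∀ {m} → m < n → 1 ≤ m → 2 ^ℕ ⌊log₂ m ⌋ ≤ m) → 1 ≤ n → 2 ^ℕ ⌊log₂ n ⌋ ≤ n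
  step 1                 _   _ = s≤s z≤n
  step n@(suc (suc n-2)) rec _ = begin
    2 ^ℕ ⌊log₂ n ⌋                    ≡⟨ cong (2 ^ℕ_) (ℕ.m+[n∸m]≡n (⌊log₂⌋-mono-≤ {2} {n} (s≤s (s≤s z≤n)))) ⟨
    2 * 2 ^ℕ (⌊log₂ n ⌋ ∸ 1)          ≡⟨ cong (λ x → 2 * 2 ^ℕ x) (⌊log₂⌊n/2⌋⌋≡⌊log₂n⌋∸1 n) ⟨
    2 * 2 ^ℕ ⌊log₂ ℕ.⌊ n /2⌋ ⌋        ≤⟨ ℕ.*-monoʳ-≤ 2 (rec (ℕ.⌊n/2⌋<n (suc n-2)) (s≤s z≤n)) ⟩
    2 * ℕ.⌊ n /2⌋                     ≡⟨ cong (_+_ ℕ.⌊ n /2⌋) (ℕ.+-identityʳ _) ⟩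
    ℕ.⌊ n /2⌋ + ℕ.⌊ n /2⌋             ≤⟨ ℕ.+-monoʳ-≤ ℕ.⌊ n /2⌋ (ℕ.⌊n/2⌋≤⌈n/2⌉ n) ⟩
    ℕ.⌊ n /2⌋ + ℕ.⌈ n /2⌉             ≡⟨ ℕ.⌊n/2⌋+⌈n/2⌉≡n n ⟩
    n                                 ∎

n<2^1+⌊log₂n⌋ : ∀ n → n < 2 ^ℕ suc ⌊log₂ n ⌋
n<2^1+⌊log₂n⌋ n = ℕ.≰⇒> λ 2^≤n → ℕ.<-irrefl refl
  (ℕ.≤-trans (ℕ.≤-reflexive (sym (⌊log₂[2^n]⌋≡n (suc ⌊log₂ n ⌋)))) (⌊log₂⌋-mono-≤ 2^≤n))

-- Within a constant factor, root k = 2^(4u) is the square root of k.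

eighth : ℕ → ℕ
eighth k = suc (⌊log₂ k ⌋ ℕ./ 8)

root : ℕ → ℕ
root k = 2 ^ℕ (4 * eighth k)

2^8eighth : ∀ k → 2 ^ℕ (8 * eighth k) ≡ root k * root k
2^8eighth k = trans (cong (2 ^ℕ_) (8u (eighth k))) (ℕ.^-distribˡ-+-* 2 (4 * eighth k) (4 * eighth k))
  where
  8u : ∀ t → 8 * t ≡ 4 * t + 4 * t
  8u = solve-∀

8eighth≤ : ∀ k → 8 * eighth k ≤ ⌊log₂ k ⌋ + 8
8eighth≤ k = begin
  8 * suc q                     ≡⟨ trans (ℕ.*-suc 8 q) (ℕ.+-comm 8 (8 * q)) ⟩
  8 * q + 8                     ≡⟨ cong (_+ 8) (ℕ.*-comm 8 q) ⟩
  q * 8 + 8                     ≤⟨ ℕ.+-monoˡ-≤ 8 (ℕ.m/n*n≤m ⌊log₂ k ⌋ 8) ⟩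
  ⌊log₂ k ⌋ + 8                 ∎
  where
  open ℕ.≤-Reasoning
  q : ℕ
  q = ⌊log₂ k ⌋ ℕ./ 8

k<root² : ∀ k → k < root k * root k
k<root² k = begin-strict
  k                         <⟨ n<2^1+⌊log₂n⌋ k ⟩
  2 ^ℕ suc ⌊log₂ k ⌋        ≤⟨ ℕ.^-monoʳ-≤ 2 log< ⟩
  2 ^ℕ (8 * eighth k)       ≡⟨ 2^8eighth k ⟩
  root k * root k           ∎
  where
  open ℕ.≤-Reasoning
  q : ℕ
  q = ⌊log₂ k ⌋ ℕ./ 8
  log< : ⌊log₂ k ⌋ < 8 * eighth k
  log< = begin-strict
    ⌊log₂ k ⌋                     ≡⟨ ℕ.m≡m%n+[m/n]*n ⌊log₂ k ⌋ 8 ⟩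
    ⌊log₂ k ⌋ ℕ.% 8 + q * 8       <⟨ ℕ.+-monoˡ-< (q * 8) (ℕ.m%n<n ⌊log₂ k ⌋ 8) ⟩
    8 + q * 8                     ≡⟨ ℕ.*-comm (suc q) 8 ⟩
    8 * suc q                     ∎

root²≤256k : ∀ k → 1 ≤ k → root k * root k ≤ 256 * k
root²≤256k k 1≤k = begin
  root k * root k              ≡⟨ 2^8eighth k ⟨
  2 ^ℕ (8 * eighth k)          ≤⟨ ℕ.^-monoʳ-≤ 2 (8eighth≤ k) ⟩
  2 ^ℕ (⌊log₂ k ⌋ + 8)         ≡⟨ trans (ℕ.^-distribˡ-+-* 2 ⌊log₂ k ⌋ 8) (ℕ.*-comm (2 ^ℕ ⌊log₂ k ⌋) 256) ⟩
  256 * 2 ^ℕ ⌊log₂ k ⌋         ≤⟨ ℕ.*-monoʳ-≤ 256 (2^⌊log₂n⌋≤n k 1≤k) ⟩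
  256 * k                      ∎
  where open ℕ.≤-Reasoning

-- From counted failures to randomized protocols

1≤length-samples : ∀ {r} (s : Schedule r) m → 1 ≤ length (samples s m)
1≤length-samples (last a b)   m = ℕ.≤-trans
  (ℕ.m^n>0 (length (words (a + b))) {{ℕ.>-nonZero (ℕ.≤-trans (1≤2^ (a + b)) (ℕ.≤-reflexive (sym (length-words (a + b)))))}} m)
  (ℕ.≤-reflexive (sym (length-tuples (words (a + b)) m)))
1≤length-samples (more a b s) m = ℕ.≤-trans (ℕ.*-mono-≤ (1≤length-samples (last {0} a b) m) (1≤length-samples s m))
  (ℕ.≤-reflexive (sym (length-cartesian _,_ (tuples (words (a + b)) m) (samples s m))))

randomized : ∀ {r m k} → Schedule r → DISJ-Protocol m k r
randomized {m = m} s = record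
  { size     = length (samples s m)
  ; size≢0   = ℕ.>-nonZero (1≤length-samples s m)
  ; protocol = λ i → run s (List.lookup (samples s m) i) proj₁ proj₁
  }

-- The error probability filters indices while `failures` sums over samples. The function `f`
-- generalises the enumeration `allFin`, which is not stable under removing the first index.
length-filter≤∑ : ∀ {A B : Set} {P : B → Set} (P? : ∀ b → Dec (P b)) (xs : List A) (f : Fin (length xs) → B) (g : A → ℕ) →
                  (∀ i → P (f i) → 1 ≤ g (List.lookup xs i)) → length (filter P? (tabulate f)) ≤ ∑ xs g
length-filter≤∑ P? []       f g hyp = z≤n
length-filter≤∑ P? (x ∷ xs) f g hyp with P? (f zero)
... | yes p = ℕ.+-mono-≤ (hyp zero p) (length-filter≤∑ P? xs (f ∘ suc) g (hyp ∘ suc))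
... | no  _ = ℕ.m≤n⇒m≤o+n (g x) (length-filter≤∑ P? xs (f ∘ suc) g (hyp ∘ suc))

errors : ∀ {m k r} → DISJ-Protocol m k r → Input m k → Input m k → ℕ
errors {m} {k} P S T = length (filter (λ ω → ¬? (result (protocol P ω) S T Bool.≟ DISJ m k S T)) (allFin (size P)))

errors-intersecting : ∀ {m k r} (s : Schedule r) (S T : Input m k) → ¬ Disjoint S T → errors (randomized s) S T ≡ 0
errors-intersecting {m} {k} s S T ¬dis with nonempty? (proj₁ S ∩ proj₁ T)
... | no  empty       = contradiction empty ¬dis
... | yes (i , i∈S∩T) = ℕ.n≤0⇒n≡0 (ℕ.≤-trans
  (length-filter≤∑ _ (samples s m) id (λ _ → 0) λ ω ≢false → contradiction (result≡false ω) ≢false)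
  (ℕ.≤-reflexive (∑-zero (samples s m) (λ _ → refl))))
  where
  i∈ = Subset.x∈p∩q⁻ (proj₁ S) (proj₁ T) i∈S∩T
  result≡false : ∀ ω → result (protocol (randomized {k = k} s) ω) S T ≡ false
  result≡false ω = trans (result-run s (List.lookup (samples s m) ω) proj₁ proj₁ S T)
    (outcome-common s (List.lookup (samples s m) ω) (proj₁ i∈) (proj₂ i∈))

errors-disjoint : ∀ {m k r} (s : Schedule r) (S T : Input m k) → Disjoint S T →
                  errors (randomized s) S T ≤ failures s (proj₁ S) (proj₁ T)
errors-disjoint {m} {k} s S T dis rewrite dec-false (nonempty? (proj₁ S ∩ proj₁ T)) dis =
  length-filter≤∑ _ (samples s m) id _ λ ω ≢true →
    subst (λ b → 1 ≤ indicator (not b)) (sym (trans (sym (result-run s (List.lookup (samples s m) ω) proj₁ proj₁ S T)) (Bool.¬-not ≢true))) ℕ.≤-refl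

abstract

  -- Here `64 = 18 + 10 + 36` collects the constants of `cost-schedule`, and 256 is the loss in
  -- rounding `k` up to `2^(8u)`. The number is opaque so that it is never unfolded during type
  -- checking.
  costFactor : ℕ
  costFactor = 16384

  costFactor≡ : costFactor ≡ 64 * 256
  costFactor≡ = refl

-- The failure probability is at most `2/R + 5/W`, where `W` exceeds `exp(√k)`. The starting
-- multiple `D` is left open: one application needs `R` to dominate the tower over `c log^(r) k`,
-- the other needs `R ≥ W`.
integer-bounds : ∀ k m r l D → 2 ≤ k → 1 ≤ l → 1 ≤ D → ⌊log₂ k ⌋ + 9 ≤ 2 * tower r (D * l) →
  let W = 2 ^ℕ root k; R = 2 ^ℕ tower r (D * l) in
  Σ (DISJ-Protocol m k (suc r)) λ P →
    (∀ ω x y → bits (protocol P ω) x y ≤ costFactor * D * (k * l))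
  × (∀ S T → ¬ Disjoint S T → errors P S T ≡ 0)
  × (∀ S T → Disjoint S T → errors P S T * (W * R) ≤ size P * (2 * W + 5 * R))
integer-bounds k m r l D 2≤k 1≤l 1≤D log≤ = randomized s , bits≤ , errors-intersecting s , errors≤
  where
  open ℕ.≤-Reasoning
  u t W R K : ℕ
  u = eighth k
  t = D * l
  W = 2 ^ℕ root k
  R = 2 ^ℕ tower r t
  K = 2 ^ℕ (8 * u)
  1≤t : 1 ≤ t
  1≤t = ℕ.*-mono-≤ 1≤D 1≤l
  s : Schedule (suc r)
  s = schedule u r (8 * u) t
  K≤256k : K ≤ 256 * k
  K≤256k = ℕ.≤-trans (ℕ.≤-reflexive (2^8eighth k)) (root²≤256k k (ℕ.<⇒≤ 2≤k))
  instance
    2^t≢0 : NonZero (2 ^ℕ t)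
    2^t≢0 = ℕ.m^n≢0 2 t
  cost≤ : cost s ≤ 64 * (K * t)
  cost≤ = ℕ.*-cancelʳ-≤ _ _ (2 ^ℕ t) (begin
    cost s * 2 ^ℕ t
      ≤⟨ cost-schedule u r (8 * u) t 1≤t (ℕ.≤-trans (s≤s (8eighth≤ k)) (ℕ.≤-trans (ℕ.≤-reflexive (sym (ℕ.+-suc ⌊log₂ k ⌋ 8))) log≤)) ⟩
    18 * (K * t) * 2 ^ℕ t + K * (10 * 2 ^ℕ t + 36)
      ≤⟨ ℕ.+-monoʳ-≤ (18 * (K * t) * 2 ^ℕ t) (ℕ.*-mono-≤ (ℕ.m≤m*n K t {{ℕ.>-nonZero 1≤t}}) (ℕ.+-monoʳ-≤ (10 * 2 ^ℕ t) (ℕ.*-monoʳ-≤ 36 (1≤2^ t)))) ⟩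
    18 * (K * t) * 2 ^ℕ t + K * t * (10 * 2 ^ℕ t + 36 * 2 ^ℕ t)
      ≡⟨ lemma (K * t) (2 ^ℕ t) ⟩
    64 * (K * t) * 2 ^ℕ t ∎)
    where
    lemma : ∀ a b → 18 * a * b + a * (10 * b + 36 * b) ≡ 64 * a * b
    lemma = solve-∀
  bits≤ : ∀ ω x y → bits (protocol (randomized {k = k} s) ω) x y ≤ costFactor * D * (k * l)
  bits≤ ω x y = begin
    bits (protocol (randomized {k = k} s) ω) x y ≤⟨ bits-run s (List.lookup (samples s m) ω) proj₁ proj₁ x y ⟩
    cost s                        ≤⟨ cost≤ ⟩
    64 * (K * t)                  ≤⟨ ℕ.*-monoʳ-≤ 64 (ℕ.*-monoˡ-≤ t K≤256k) ⟩
    64 * (256 * k * (D * l))      ≡⟨ lemma k D l ⟩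
    64 * 256 * D * (k * l)        ≡⟨ cong (λ F → F * D * (k * l)) costFactor≡ ⟨
    costFactor * D * (k * l)      ∎
    where
    lemma : ∀ k D l → 64 * (256 * k * (D * l)) ≡ 64 * 256 * D * (k * l)
    lemma = solve-∀
  errors≤ : ∀ S T → Disjoint S T → errors (randomized s) S T * (W * R) ≤ length (samples s m) * (2 * W + 5 * R)
  errors≤ (S , ∣S∣≤k) (T , ∣T∣≤k) dis = ℕ.*-cancelʳ-≤ _ _ (2 ^ℕ t) (begin
    errors (randomized s) (S , ∣S∣≤k) (T , ∣T∣≤k) * (W * R) * 2 ^ℕ t
      ≡⟨ ℕ.*-assoc (errors (randomized s) (S , ∣S∣≤k) (T , ∣T∣≤k)) (W * R) (2 ^ℕ t) ⟩
    errors (randomized s) (S , ∣S∣≤k) (T , ∣T∣≤k) * (W * R * 2 ^ℕ t)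
      ≤⟨ ℕ.*-monoˡ-≤ (W * R * 2 ^ℕ t) (errors-disjoint s (S , ∣S∣≤k) (T , ∣T∣≤k) dis) ⟩
    failures s S T * (W * R * 2 ^ℕ t)
      ≤⟨ failures-schedule u r (8 * u) t (s≤s z≤n) 1≤t (Empty⇒Apart S T dis) (k≤K ∣S∣≤k) (k≤K ∣S∣≤k) (k≤K ∣T∣≤k) ⟩
    length (samples s m) * ((2 * W + 3 * R) * 2 ^ℕ t + 2 * R)
      ≤⟨ ℕ.*-monoʳ-≤ (length (samples s m)) (ℕ.+-monoʳ-≤ ((2 * W + 3 * R) * 2 ^ℕ t) (ℕ.m≤m*n (2 * R) (2 ^ℕ t))) ⟩
    length (samples s m) * ((2 * W + 3 * R) * 2 ^ℕ t + 2 * R * 2 ^ℕ t)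
      ≡⟨ lemma (length (samples s m)) W R (2 ^ℕ t) ⟩
    length (samples s m) * (2 * W + 5 * R) * 2 ^ℕ t ∎)
    where
    k≤K : ∀ {n} → n ≤ k → n ≤ K
    k≤K n≤k = ℕ.≤-trans n≤k (ℕ.≤-trans (ℕ.<⇒≤ (k<root² k)) (ℕ.≤-reflexive (sym (2^8eighth k))))
    lemma : ∀ l W R p → l * ((2 * W + 3 * R) * p + 2 * R * p) ≡ l * (2 * W + 5 * R) * p
    lemma = solve-∀

-- Integer iterated logarithms

lg : ℕ → ℕ → ℕ
lg zero    k = k
lg (suc i) k = ⌊log₂ lg i k ⌋

tower-mono : ∀ n {s t} → s ≤ t → tower n s ≤ tower n t
tower-mono zero    s≤t = s≤t
tower-mono (suc n) s≤t = tower-mono n (ℕ.^-monoʳ-≤ 2 s≤t)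

tower-suc : ∀ n t → tower (suc n) t ≡ 2 ^ℕ tower n t
tower-suc zero    t = refl
tower-suc (suc n) t = tower-suc n (2 ^ℕ t)

tower-+ : ∀ n t c → tower n t + c ≤ tower n (t + c)
tower-+ zero    t c = ℕ.≤-refl
tower-+ (suc n) t c = ℕ.≤-trans (tower-+ n (2 ^ℕ t) c) (tower-mono n (begin
  2 ^ℕ t + c                ≤⟨ ℕ.+-monoʳ-≤ (2 ^ℕ t) (ℕ.m≤n*m c (2 ^ℕ t) {{ℕ.m^n≢0 2 t}}) ⟩
  2 ^ℕ t + 2 ^ℕ t * c       ≡⟨ ℕ.*-suc (2 ^ℕ t) c ⟨
  2 ^ℕ t * suc c            ≤⟨ ℕ.*-monoʳ-≤ (2 ^ℕ t) (n<2^n c) ⟩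
  2 ^ℕ t * 2 ^ℕ c           ≡⟨ ℕ.^-distribˡ-+-* 2 t c ⟨
  2 ^ℕ (t + c)              ∎))
  where open ℕ.≤-Reasoning

16*tower≤ : ∀ n t → 1 ≤ t → 16 * tower n t ≤ tower n (16 * t)
16*tower≤ zero    t 1≤t = ℕ.≤-refl
16*tower≤ (suc n) t 1≤t = ℕ.≤-trans (16*tower≤ n (2 ^ℕ t) (1≤2^ t)) (tower-mono n (begin
  16 * 2 ^ℕ t          ≡⟨ trans (ℕ.^-distribˡ-+-* 2 4 t) refl ⟨
  2 ^ℕ (4 + t)         ≤⟨ ℕ.^-monoʳ-≤ 2 (ℕ.+-monoˡ-≤ t (ℕ.*-mono-≤ {4} {15} (ℕ.m≤m+n 4 11) 1≤t)) ⟩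
  2 ^ℕ (15 * t + t)    ≡⟨ cong (2 ^ℕ_) (ℕ.+-comm (15 * t) t) ⟩
  2 ^ℕ (16 * t)        ∎))
  where open ℕ.≤-Reasoning

-- Rounding down costs less than one at every level, and adding one before exponentiating makes up
-- for it: `n + 1 ≤ 2^(⌊log₂ n⌋ + 1)`.
lg<tower : ∀ j i k → suc (lg i k) ≤ tower j (suc (lg (j + i) k))
lg<tower zero    i k = ℕ.≤-refl
lg<tower (suc j) i k = ℕ.≤-trans (lg<tower j i k) (tower-mono j (n<2^1+⌊log₂n⌋ (lg (j + i) k)))

-- A tower grows at least as fast as its argument, so the additive 9 can be moved inside; there
-- `l + 9 ≤ 10 l`.
log-budget : ∀ r k D → 10 ≤ D → 1 ≤ lg (suc r) k → ⌊log₂ k ⌋ + 9 ≤ 2 * tower r (D * lg (suc r) k)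
log-budget r k D 10≤D 1≤l = begin
  ⌊log₂ k ⌋ + 9                ≡⟨ ℕ.+-suc ⌊log₂ k ⌋ 8 ⟩
  suc (lg 1 k) + 8             ≤⟨ ℕ.+-monoˡ-≤ 8 (lg<tower r 1 k) ⟩
  tower r (suc (lg (r + 1) k)) + 8 ≡⟨ cong (λ i → tower r (suc (lg i k)) + 8) (ℕ.+-comm r 1) ⟩
  tower r (suc l) + 8          ≤⟨ tower-+ r (suc l) 8 ⟩
  tower r (suc l + 8)          ≤⟨ tower-mono r (begin
    suc l + 8      ≡⟨ trans (sym (ℕ.+-suc l 8)) (cong (_+_ l) (sym (ℕ.*-identityʳ 9))) ⟩
    l + 9 * 1      ≤⟨ ℕ.+-monoʳ-≤ l (ℕ.*-monoʳ-≤ 9 1≤l) ⟩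
    l + 9 * l      ≤⟨ ℕ.*-monoˡ-≤ l 10≤D ⟩
    D * l          ∎) ⟩
  tower r (D * l)              ≤⟨ ℕ.m≤n*m (tower r (D * l)) 2 ⟩
  2 * tower r (D * l)          ∎
  where
  open ℕ.≤-Reasoning
  l : ℕ
  l = lg (suc r) k

root≤16k : ∀ k → 1 ≤ k → root k ≤ 16 * k
root≤16k k 1≤k = ℕ.≮⇒≥ λ 16k<root → ℕ.<-irrefl refl (begin-strict
  16 * k * (16 * k)     <⟨ ℕ.*-mono-< 16k<root 16k<root ⟩
  root k * root k       ≤⟨ root²≤256k k 1≤k ⟩
  256 * k               ≤⟨ ℕ.m≤m*n (256 * k) k {{ℕ.>-nonZero 1≤k}} ⟩
  256 * k * k           ≡⟨ lemma k ⟩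
  16 * k * (16 * k)     ∎)
  where
  open ℕ.≤-Reasoning
  lemma : ∀ k → 256 * k * k ≡ 16 * k * (16 * k)
  lemma = solve-∀

-- When the iterated logarithm is bounded by `Λ`, a multiple depending only on `Λ` is worth one more
-- exponential. The tower then reaches `k` itself, so `R ≥ W` and the error is governed by
-- `exp(-√k)` alone.
root≤tower : ∀ r k Λ → 1 ≤ k → 1 ≤ lg (suc r) k → lg (suc r) k ≤ Λ → root k ≤ tower r (16 * 2 ^ℕ suc Λ * lg (suc r) k)
root≤tower r k Λ 1≤k 1≤l l≤Λ = begin
  root k                              ≤⟨ root≤16k k 1≤k ⟩
  16 * k                              ≤⟨ ℕ.*-monoʳ-≤ 16 (ℕ.n≤1+n k) ⟩
  16 * suc k                          ≤⟨ ℕ.*-monoʳ-≤ 16 (lg<tower (suc r) 0 k) ⟩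
  16 * tower (suc r) (suc (lg (suc r + 0) k)) ≡⟨ cong (λ i → 16 * tower (suc r) (suc (lg i k))) (ℕ.+-identityʳ (suc r)) ⟩
  16 * tower r (2 ^ℕ suc l)           ≤⟨ ℕ.*-monoʳ-≤ 16 (tower-mono r (ℕ.^-monoʳ-≤ 2 (s≤s l≤Λ))) ⟩
  16 * tower r (2 ^ℕ suc Λ)           ≤⟨ 16*tower≤ r (2 ^ℕ suc Λ) (1≤2^ (suc Λ)) ⟩
  tower r (16 * 2 ^ℕ suc Λ)           ≤⟨ tower-mono r (ℕ.m≤m*n (16 * 2 ^ℕ suc Λ) l {{ℕ.>-nonZero 1≤l}}) ⟩
  tower r (16 * 2 ^ℕ suc Λ * l)       ∎
  where
  open ℕ.≤-Reasoning
  l : ℕ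
  l = lg (suc r) k

-- Rational powers

ℚ-ring : ACR.AlmostCommutativeRing 0ℓ 0ℓ
ℚ-ring = ACR.fromCommutativeRing ℚ.+-*-commutativeRing (λ _ → nothing)

open Exp (CommutativeRing.commutativeSemiring ℚ.+-*-commutativeRing) using (^-assocʳ; ^-distrib-*)

ℚ<⇒≱ : ∀ {p q} → p ℚ.< q → ¬ (q ℚ.≤ p)
ℚ<⇒≱ p<q q≤p = ℚ.<-irrefl refl (ℚ.<-≤-trans p<q q≤p)

ι : ℕ → ℚ
ι n = + n ℚ./ 1

toℚᵘ-ι : ∀ n → ℚ.toℚᵘ (ι n) ℚᵘ.≃ mkℚᵘ (+ n) 0
toℚᵘ-ι n = ℚ.toℚᵘ-fromℚᵘ (mkℚᵘ (+ n) 0)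

ι-+ : ∀ m n → ι (m + n) ≡ ι m ℚ.+ ι n
ι-+ m n = ℚ.toℚᵘ-injective (ℚᵘ.≃-trans (toℚᵘ-ι (m + n)) (ℚᵘ.≃-sym (ℚᵘ.≃-trans (ℚ.toℚᵘ-homo-+ (ι m) (ι n))
  (ℚᵘ.≃-trans (ℚᵘ.+-cong (toℚᵘ-ι m) (toℚᵘ-ι n))
    (*≡* (cong (ℤ._* + 1) (cong₂ ℤ._+_ (ℤ.*-identityʳ (+ m)) (ℤ.*-identityʳ (+ n)))))))))

ι-* : ∀ m n → ι (m * n) ≡ ι m ℚ.* ι n
ι-* m n = ℚ.toℚᵘ-injective (ℚᵘ.≃-trans (toℚᵘ-ι (m * n)) (ℚᵘ.≃-sym (ℚᵘ.≃-trans (ℚ.toℚᵘ-homo-* (ι m) (ι n))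
  (ℚᵘ.≃-trans (ℚᵘ.*-cong (toℚᵘ-ι m) (toℚᵘ-ι n))
    (*≡* (cong (ℤ._* + 1) (sym (ℤ.pos-* m n))))))))

ι-mono-≤ : ∀ {m n} → m ≤ n → ι m ℚ.≤ ι n
ι-mono-≤ {m} {n} m≤n = ℚ.toℚᵘ-cancel-≤ (ℚᵘ.≤-respˡ-≃ (ℚᵘ.≃-sym (toℚᵘ-ι m)) (ℚᵘ.≤-respʳ-≃ (ℚᵘ.≃-sym (toℚᵘ-ι n))
  (*≤* (ℤ.*-monoʳ-≤-nonNeg (+ 1) (ℤ.+≤+ m≤n)))))

ι-mono-< : ∀ {m n} → m < n → ι m ℚ.< ι n
ι-mono-< {m} {n} m<n = ℚ.toℚᵘ-cancel-< (ℚᵘ.<-respˡ-≃ (ℚᵘ.≃-sym (toℚᵘ-ι m)) (ℚᵘ.<-respʳ-≃ (ℚᵘ.≃-sym (toℚᵘ-ι n))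
  (*<* (ℤ.*-monoʳ-<-pos (+ 1) (ℤ.+<+ m<n)))))

ι-cancel-< : ∀ {m n} → ι m ℚ.< ι n → m < n
ι-cancel-< {m} {n} ιm<ιn = ℕ.≰⇒> λ n≤m → ℚ<⇒≱ ιm<ιn (ι-mono-≤ {n} {m} n≤m)

0≤ι : ∀ n → 0ℚ ℚ.≤ ι n
0≤ι n = ι-mono-≤ {0} {n} z≤n

0<ι : ∀ {n} → 1 ≤ n → 0ℚ ℚ.< ι n
0<ι {n} = ι-mono-< {0} {n}

/-*-ι : ∀ i n .{{_ : NonZero n}} → + i ℚ./ n ℚ.* ι n ≡ ι i
/-*-ι i (suc n) = ℚ.toℚᵘ-injective (ℚᵘ.≃-trans (ℚ.toℚᵘ-homo-* (+ i ℚ./ suc n) (ι (suc n)))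
  (ℚᵘ.≃-trans (ℚᵘ.*-cong (ℚ.toℚᵘ-fromℚᵘ (mkℚᵘ (+ i) n)) (toℚᵘ-ι (suc n)))
    (ℚᵘ.≃-trans (*≡* (trans (ℤ.*-assoc (+ i) (+ suc n) (+ 1)) (cong (λ x → + i ℤ.* + x) eq))) (ℚᵘ.≃-sym (toℚᵘ-ι i)))))
  where
  eq : suc n * 1 ≡ suc (ℕ.pred (suc n * 1))
  eq = refl

ℚ*-mono-≤ : ∀ {a b c d} → 0ℚ ℚ.≤ a → a ℚ.≤ b → 0ℚ ℚ.≤ c → c ℚ.≤ d → a ℚ.* c ℚ.≤ b ℚ.* d
ℚ*-mono-≤ {a} {b} {c} {d} 0≤a a≤b 0≤c c≤d = ℚ.≤-trans
  (ℚ.*-monoʳ-≤-nonNeg c {{ℚ.nonNegative 0≤c}} a≤b)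
  (ℚ.*-monoˡ-≤-nonNeg b {{ℚ.nonNegative (ℚ.≤-trans 0≤a a≤b)}} c≤d)

ℚ*-monoˡ-≤ : ∀ {a b c} → 0ℚ ℚ.≤ c → a ℚ.≤ b → a ℚ.* c ℚ.≤ b ℚ.* c
ℚ*-monoˡ-≤ {c = c} 0≤c = ℚ.*-monoʳ-≤-nonNeg c {{ℚ.nonNegative 0≤c}}

ℚ*-monoʳ-≤ : ∀ {a b c} → 0ℚ ℚ.≤ a → b ℚ.≤ c → a ℚ.* b ℚ.≤ a ℚ.* c
ℚ*-monoʳ-≤ {a} 0≤a = ℚ.*-monoˡ-≤-nonNeg a {{ℚ.nonNegative 0≤a}}

ℚ*-monoˡ-< : ∀ {a b c} → 0ℚ ℚ.< c → a ℚ.< b → a ℚ.* c ℚ.< b ℚ.* c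
ℚ*-monoˡ-< {c = c} 0<c = ℚ.*-monoˡ-<-pos c {{ℚ.positive 0<c}}

ℚ*-cancelʳ-< : ∀ {a b} c → 0ℚ ℚ.≤ c → a ℚ.* c ℚ.< b ℚ.* c → a ℚ.< b
ℚ*-cancelʳ-< c 0≤c = ℚ.*-cancelʳ-<-nonNeg c {{ℚ.nonNegative 0≤c}}

ℚ*-cancelʳ-≤ : ∀ {a b} c → 0ℚ ℚ.< c → a ℚ.* c ℚ.≤ b ℚ.* c → a ℚ.≤ b
ℚ*-cancelʳ-≤ c 0<c = ℚ.*-cancelʳ-≤-pos c {{ℚ.positive 0<c}}

0≤* : ∀ {a b} → 0ℚ ℚ.≤ a → 0ℚ ℚ.≤ b → 0ℚ ℚ.≤ a ℚ.* b
0≤* {a} {b} 0≤a 0≤b = subst (ℚ._≤ a ℚ.* b) (ℚ.*-zeroˡ b) (ℚ*-monoˡ-≤ 0≤b 0≤a)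

0<* : ∀ {a b} → 0ℚ ℚ.< a → 0ℚ ℚ.< b → 0ℚ ℚ.< a ℚ.* b
0<* {a} {b} 0<a 0<b = subst (ℚ._< a ℚ.* b) (ℚ.*-zeroˡ b) (ℚ*-monoˡ-< 0<b 0<a)

0≤^ : ∀ {p} n → 0ℚ ℚ.≤ p → 0ℚ ℚ.≤ p ^ n
0≤^ zero    0≤p = 0≤ι 1
0≤^ (suc n) 0≤p = 0≤* 0≤p (0≤^ n 0≤p)

0<^ : ∀ {p} n → 0ℚ ℚ.< p → 0ℚ ℚ.< p ^ n
0<^ zero    0<p = 0<ι {1} ℕ.≤-refl
0<^ (suc n) 0<p = 0<* 0<p (0<^ n 0<p)

^-mono-≤ : ∀ {p q} n → 0ℚ ℚ.≤ p → p ℚ.≤ q → p ^ n ℚ.≤ q ^ n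
^-mono-≤ zero    0≤p p≤q = ℚ.≤-refl
^-mono-≤ (suc n) 0≤p p≤q = ℚ*-mono-≤ 0≤p p≤q (0≤^ n 0≤p) (^-mono-≤ n 0≤p p≤q)

^-mono-< : ∀ {p q} n → 1 ≤ n → 0ℚ ℚ.≤ p → p ℚ.< q → p ^ n ℚ.< q ^ n
^-mono-< (suc n) _ 0≤p p<q = ℚ.≤-<-trans (ℚ*-monoʳ-≤ 0≤p (^-mono-≤ n 0≤p (ℚ.<⇒≤ p<q)))
                                         (ℚ*-monoˡ-< (0<^ n (ℚ.≤-<-trans 0≤p p<q)) p<q)

^-cancel-< : ∀ {p q} n → 0ℚ ℚ.≤ q → p ^ n ℚ.< q ^ n → p ℚ.< q
^-cancel-< n 0≤q p^n<q^n = ℚ.≰⇒> λ q≤p → ℚ<⇒≱ p^n<q^n (^-mono-≤ n 0≤q q≤p)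

^-comm : ∀ p m n → (p ^ m) ^ n ≡ (p ^ n) ^ m
^-comm p m n = trans (^-assocʳ p m n) (trans (cong (p ^_) (ℕ.*-comm m n)) (sym (^-assocʳ p n m)))

ι-^ : ∀ a n → ι (a ^ℕ n) ≡ ι a ^ n
ι-^ a zero    = refl
ι-^ a (suc n) = trans (ι-* a (a ^ℕ n)) (cong (ι a ℚ.*_) (ι-^ a n))

2^-suc : ∀ i → 2^ (ℤ.suc i) ≡ ι 2 ℚ.* 2^ i
2^-suc (+ n)          = refl
2^-suc -[1+ zero ]    = refl
2^-suc -[1+ suc n ]   = sym (trans (sym (ℚ.*-assoc (ι 2) ½ (½ ^ suc n))) (ℚ.*-identityˡ (½ ^ suc n)))

2^-+ : ∀ i n → 2^ (i ℤ.+ + n) ≡ 2^ i ℚ.* ι 2 ^ n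
2^-+ i zero    = trans (cong 2^_ (ℤ.+-identityʳ i)) (sym (ℚ.*-identityʳ (2^ i)))
2^-+ i (suc n) = trans (cong 2^_ (shift i (+ n))) (trans (2^-suc (i ℤ.+ + n)) (trans (cong (ι 2 ℚ.*_) (2^-+ i n)) (swap (ι 2) (2^ i) (ι 2 ^ n))))
  where
  shift : ∀ i j → i ℤ.+ ℤ.suc j ≡ ℤ.suc (i ℤ.+ j)
  shift i j = trans (sym (ℤ.+-assoc i (+ 1) j)) (trans (cong (ℤ._+ j) (ℤ.+-comm i (+ 1))) (ℤ.+-assoc (+ 1) i j))
  swap : ∀ a b c → a ℚ.* (b ℚ.* c) ≡ b ℚ.* (a ℚ.* c)
  swap a b c = trans (sym (ℚ.*-assoc a b c)) (trans (cong (ℚ._* c) (ℚ.*-comm a b)) (ℚ.*-assoc b a c))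

0<2^ : ∀ i → 0ℚ ℚ.< 2^ i
0<2^ (+ n)     = 0<^ n (0<ι {2} (s≤s z≤n))
0<2^ -[1+ n ]  = 0<^ {½} (suc n) (ℚ.*<* (ℤ.+<+ ℕ.≤-refl))

2^-* : ∀ i n → 2^ (i ℤ.* + n) ≡ (2^ i) ^ n
2^-* i zero    = cong 2^_ (ℤ.*-zeroʳ i)
2^-* (+ m) (suc n) = trans (cong 2^_ (sym (ℤ.pos-* m (suc n)))) (sym (^-assocʳ (ι 2) m (suc n)))
2^-* -[1+ m ] (suc n) = sym (^-assocʳ ½ (suc m) (suc n))

2^-mono-≤ : ∀ {i j} → i ℤ.≤ j → 2^ i ℚ.≤ 2^ j
2^-mono-≤ {i} {j} i≤j = subst (2^ i ℚ.≤_) (trans (sym (2^-+ i n)) (cong 2^_ eq))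
  (subst (ℚ._≤ 2^ i ℚ.* ι 2 ^ n) (ℚ.*-identityʳ (2^ i)) (ℚ*-monoʳ-≤ (ℚ.<⇒≤ (0<2^ i)) 1≤2ⁿ))
  where
  n : ℕ
  n = ℤ.∣ j ℤ.- i ∣
  eq : i ℤ.+ + n ≡ j
  eq = trans (cong (ℤ._+_ i) (ℤ.0≤i⇒+∣i∣≡i (ℤ.i≤j⇒0≤j-i i≤j))) (trans (ℤ.+-comm i (j ℤ.- i)) (trans (ℤ.+-assoc j (ℤ.- i) i) (trans (cong (ℤ._+_ j) (ℤ.+-inverseˡ i)) (ℤ.+-identityʳ j))))
  1≤2ⁿ : 1ℚ ℚ.≤ ι 2 ^ n
  1≤2ⁿ = subst (1ℚ ℚ.≤_) (ι-^ 2 n) (ι-mono-≤ {1} {2 ^ℕ n} (1≤2^ n))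

2^-cancel-< : ∀ {i j} → 2^ i ℚ.< 2^ j → i ℤ.< j
2^-cancel-< 2^i<2^j = ℤ.≰⇒> λ j≤i → ℚ<⇒≱ 2^i<2^j (2^-mono-≤ j≤i)

2^-swap : ∀ {i j d e} → i ℤ.* + e ≡ j ℤ.* + d → (2^ i) ^ e ≡ (2^ j) ^ d
2^-swap {i} {j} {d} {e} eq = trans (sym (2^-* i e)) (trans (cong 2^_ eq) (2^-* j d))

-- Comparing `p` with `2^(i/d)` does not depend on the fraction representing the exponent: raise to
-- the power `e`, rewrite the exponent, cancel the power `d`. This bridges to the reduced fractions
-- in `≺2^`.
^<2^-transport : ∀ {p i j d e} → 1 ≤ e → 0ℚ ℚ.≤ p → i ℤ.* + e ≡ j ℤ.* + d →
                 p ^ d ℚ.< 2^ i → p ^ e ℚ.< 2^ j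
^<2^-transport {p} {i} {j} {d} {e} 1≤e 0≤p eq p^d<2^i = ^-cancel-< d (ℚ.<⇒≤ (0<2^ j))
  (subst (ℚ._< (2^ j) ^ d) (^-comm p d e) (subst ((p ^ d) ^ e ℚ.<_) (2^-swap {i} {j} {d} {e} eq)
    (^-mono-< e 1≤e (0≤^ d 0≤p) p^d<2^i)))

2^<^-transport : ∀ {p i j d e} → 1 ≤ e → 0ℚ ℚ.≤ p → i ℤ.* + e ≡ j ℤ.* + d →
                 2^ i ℚ.< p ^ d → 2^ j ℚ.< p ^ e
2^<^-transport {p} {i} {j} {d} {e} 1≤e 0≤p eq 2^i<p^d = ^-cancel-< d (0≤^ e 0≤p)
  (subst ((2^ j) ^ d ℚ.<_) (^-comm p d e) (subst (ℚ._< (p ^ d) ^ e) (2^-swap {i} {j} {d} {e} eq)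
    (^-mono-< e 1≤e (ℚ.<⇒≤ (0<2^ i)) 2^i<p^d)))

/-cross : ∀ i d .{{_ : NonZero d}} → i ℤ.* + ↧ₙ (i ℚ./ d) ≡ ↥ (i ℚ./ d) ℤ.* + d
/-cross i (suc d) = cross (i ℚ./ suc d) (ℚ.toℚᵘ-fromℚᵘ (mkℚᵘ i d))
  where
  cross : ∀ p → ℚ.toℚᵘ p ℚᵘ.≃ mkℚᵘ i d → i ℤ.* + ↧ₙ p ≡ ↥ p ℤ.* + suc d
  cross p@record{} (*≡* eq) = sym eq

1≤↧ₙ : ∀ p → 1 ≤ ↧ₙ p
1≤↧ₙ p = s≤s z≤n

^<2^⇒≺2^ : ∀ {p} i d .{{_ : NonZero d}} → 0ℚ ℚ.≤ p → p ^ d ℚ.< 2^ i → p ≺2^ (i ℚ./ d)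
^<2^⇒≺2^ {p} i d 0≤p p^d< = inj₂ (^<2^-transport {p} {i} {↥ (i ℚ./ d)} {d} (1≤↧ₙ (i ℚ./ d)) 0≤p (/-cross i d) p^d<)

2^<^⇒2^≺ : ∀ {p} i d .{{_ : NonZero d}} → 0ℚ ℚ.< p → 2^ i ℚ.< p ^ d → 2^ (i ℚ./ d) ≺ p
2^<^⇒2^≺ {p} i d 0<p 2^i< = 0<p , 2^<^-transport {p} {i} {↥ (i ℚ./ d)} {d} (1≤↧ₙ (i ℚ./ d)) (ℚ.<⇒≤ 0<p) (/-cross i d) 2^i<

^ℕ-distribʳ-* : ∀ a b n → (a * b) ^ℕ n ≡ a ^ℕ n * b ^ℕ n
^ℕ-distribʳ-* a b zero    = refl
^ℕ-distribʳ-* a b (suc n) = trans (cong (a * b *_) (^ℕ-distribʳ-* a b n)) (lemma a b (a ^ℕ n) (b ^ℕ n))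
  where
  lemma : ∀ a b p q → a * b * (p * q) ≡ a * p * (b * q)
  lemma = solve-∀

^-lower-bound : ∀ a n → a ^ℕ n * (a + n) ≤ suc a ^ℕ n * a
^-lower-bound a zero    = ℕ.≤-reflexive (lemma a)
  where
  lemma : ∀ a → 1 * (a + 0) ≡ 1 * a
  lemma = solve-∀
^-lower-bound a (suc n) = begin
  a * a ^ℕ n * (a + suc n)                ≡⟨ lemma a (a ^ℕ n) n ⟩
  a ^ℕ n * (a * (a + n) + a)              ≤⟨ ℕ.*-monoʳ-≤ (a ^ℕ n) (ℕ.+-monoʳ-≤ (a * (a + n)) (ℕ.m≤m+n a n)) ⟩
  a ^ℕ n * (a * (a + n) + (a + n))        ≡⟨ lemma′ a (a ^ℕ n) n ⟩
  suc a * (a ^ℕ n * (a + n))              ≤⟨ ℕ.*-monoʳ-≤ (suc a) (^-lower-bound a n) ⟩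
  suc a * (suc a ^ℕ n * a)                ≡⟨ ℕ.*-assoc (suc a) (suc a ^ℕ n) a ⟨
  suc a * suc a ^ℕ n * a                  ∎
  where
  open ℕ.≤-Reasoning
  lemma : ∀ a p n → a * p * (a + suc n) ≡ p * (a * (a + n) + a)
  lemma = solve-∀
  lemma′ : ∀ a p n → p * (a * (a + n) + (a + n)) ≡ suc a * (p * (a + n))
  lemma′ = solve-∀

2a^n<[1+a]^n : ∀ a → a ^ℕ suc a * 2 < suc a ^ℕ suc a
2a^n<[1+a]^n zero      = s≤s z≤n
2a^n<[1+a]^n a@(suc _) = ℕ.*-cancelʳ-< a _ _ (begin-strict
  a ^ℕ suc a * 2 * a                    ≡⟨ lemma (a ^ℕ suc a) a ⟩
  a ^ℕ suc a * (a + a)                  <⟨ ℕ.*-monoʳ-< (a ^ℕ suc a) {{ℕ.m^n≢0 a (suc a)}} (ℕ.+-monoʳ-< a (ℕ.n<1+n a)) ⟩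
  a ^ℕ suc a * (a + suc a)              ≤⟨ ^-lower-bound a (suc a) ⟩
  suc a ^ℕ suc a * a                    ∎)
  where
  open ℕ.≤-Reasoning
  lemma : ∀ p a → p * 2 * a ≡ p * (a + a)
  lemma = solve-∀

-- With p = a / b and N = a + 1, the witness n - 1/N works, since (p / 2ⁿ)^N < 1/2.

below-2^ : ∀ p n → 1 ≤ n → p ℚ.< ι (2 ^ℕ n) → ∃[ q ] (q ℚ.< ι n × p ≺2^ q)
below-2^ p@(ℚ.mkℚ -[1+ a ] b-1 _) n 1≤n p<  = 0ℚ , 0<ι {n} 1≤n , inj₁ (ℚ.*<* ℤ.-<+)
below-2^ p@(ℚ.mkℚ (+ a) b-1 _)    n 1≤n p<  = q , q<n , ^<2^⇒≺2^ (+ e) N 0≤p p^N<2^e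
  where
  b N e : ℕ
  b = suc b-1
  N = suc a
  e = ℕ.pred (n * N)
  q : ℚ
  q = + e ℚ./ N
  instance
    nN≢0 : NonZero (n * N)
    nN≢0 = ℕ.m*n≢0 n N {{ℕ.>-nonZero 1≤n}}
  suc-e : suc e ≡ n * N
  suc-e = ℕ.suc-pred (n * N)
  pb≡a : p ℚ.* ι b ≡ ι a
  pb≡a = trans (cong (ℚ._* ι b) (sym (ℚ.↥p/↧p≡p p))) (/-*-ι a b)
  0≤p : 0ℚ ℚ.≤ p
  0≤p = ℚ*-cancelʳ-≤ (ι b) (0<ι {b} (s≤s z≤n)) (subst (ℚ._≤ p ℚ.* ι b) (sym (ℚ.*-zeroˡ (ι b))) (subst (0ℚ ℚ.≤_) (sym pb≡a) (0≤ι a)))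
  q<n : q ℚ.< ι n
  q<n = ℚ*-cancelʳ-< (ι N) (0≤ι N) (subst (ℚ._< ι n ℚ.* ι N) (sym (/-*-ι e N))
    (subst (ι e ℚ.<_) (ι-* n N) (ι-mono-< {e} {n * N} (ℕ.≤-reflexive suc-e))))
  a<2^nb : a < 2 ^ℕ n * b
  a<2^nb = ι-cancel-< {a} {2 ^ℕ n * b} (subst (ι a ℚ.<_) (sym (ι-* (2 ^ℕ n) b)) (subst (ℚ._< ι (2 ^ℕ n) ℚ.* ι b) pb≡a
    (ℚ*-monoˡ-< (0<ι {b} (s≤s z≤n)) p<)))
  powers : a ^ℕ N * 2 < 2 ^ℕ e * (2 * b ^ℕ N)
  powers = begin-strict
    a ^ℕ N * 2                      <⟨ 2a^n<[1+a]^n a ⟩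
    suc a ^ℕ N                      ≤⟨ ℕ.^-monoˡ-≤ N a<2^nb ⟩
    (2 ^ℕ n * b) ^ℕ N               ≡⟨ ^ℕ-distribʳ-* (2 ^ℕ n) b N ⟩
    (2 ^ℕ n) ^ℕ N * b ^ℕ N          ≡⟨ cong (_* b ^ℕ N) (trans (ℕ.^-*-assoc 2 n N) (cong (2 ^ℕ_) (sym suc-e))) ⟩
    2 * 2 ^ℕ e * b ^ℕ N             ≡⟨ lemma (2 ^ℕ e) (b ^ℕ N) ⟩
    2 ^ℕ e * (2 * b ^ℕ N)           ∎
    where
    open ℕ.≤-Reasoning
    lemma : ∀ x y → 2 * x * y ≡ x * (2 * y)
    lemma = solve-∀
  p^N<2^e : p ^ N ℚ.< 2^ (+ e)
  p^N<2^e = ℚ*-cancelʳ-< (ι (2 * b ^ℕ N)) (0≤ι (2 * b ^ℕ N)) (begin-strict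
    p ^ N ℚ.* ι (2 * b ^ℕ N)           ≡⟨ cong (p ^ N ℚ.*_) (trans (cong ι (ℕ.*-comm 2 (b ^ℕ N))) (trans (ι-* (b ^ℕ N) 2) (cong (ℚ._* ι 2) (ι-^ b N)))) ⟩
    p ^ N ℚ.* (ι b ^ N ℚ.* ι 2)        ≡⟨ ℚ.*-assoc (p ^ N) (ι b ^ N) (ι 2) ⟨
    p ^ N ℚ.* ι b ^ N ℚ.* ι 2          ≡⟨ cong (ℚ._* ι 2) (trans (sym (^-distrib-* p (ι b) N)) (trans (cong (_^ N) pb≡a) (sym (ι-^ a N)))) ⟩
    ι (a ^ℕ N) ℚ.* ι 2                 ≡⟨ ι-* (a ^ℕ N) 2 ⟨
    ι (a ^ℕ N * 2)                     <⟨ ι-mono-< {a ^ℕ N * 2} {2 ^ℕ e * (2 * b ^ℕ N)} powers ⟩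
    ι (2 ^ℕ e * (2 * b ^ℕ N))          ≡⟨ trans (ι-* (2 ^ℕ e) (2 * b ^ℕ N)) (cong (ℚ._* ι (2 * b ^ℕ N)) (ι-^ 2 e)) ⟩
    ι 2 ^ e ℚ.* ι (2 * b ^ℕ N)         ∎)
    where open ℚ.≤-Reasoning

-- Iterated logarithms of natural numbers

-- The upper bound has to lie strictly below `lg i k + 1`, because the next logarithm needs room
-- below a power of two to find its own rational witness by `below-2^`.
log^< : ∀ i k → ∃[ p ] (U (log^ i (fromℕ k)) p × p ℚ.< ι (suc (lg i k)))
log^< zero    k = ℚ.<-dense (ι-mono-< {k} {suc k} ℕ.≤-refl)
log^< (suc i) k =
  let p , Up , p<     = log^< i k
      q , q< , p≺2^q  = below-2^ p (suc (lg (suc i) k)) (s≤s z≤n) (ℚ.<-≤-trans p<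
        (ι-mono-≤ {suc (lg i k)} {2 ^ℕ suc (lg (suc i) k)} (n<2^1+⌊log₂n⌋ (lg i k))))
  in q , (p , Up , p≺2^q) , q<

IsLog*⇒2≤lg : ∀ {k s} → IsLog* (fromℕ k) s → ∀ {i} → i < s → 2 ≤ lg i k
IsLog*⇒2≤lg {k} (_ , least) {i} i<s = ℕ.≮⇒≥ λ lg<2 → case log^< i k of λ where
  (p , Up , p<) → least i<s (p , Up , ℚ.<-≤-trans p< (ι-mono-≤ {suc (lg i k)} {2} lg<2))

≺2^⇒< : ∀ {p} q → 0ℚ ℚ.≤ p → p ≺2^ q → p ^ ↧ₙ q ℚ.< 2^ (↥ q)
≺2^⇒< q 0≤p (inj₁ p<0) = contradiction 0≤p (ℚ<⇒≱ p<0)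
≺2^⇒< q 0≤p (inj₂ p^<) = p^<

≺2^-lower : ∀ {p} q l → ι (2 ^ℕ l) ℚ.≤ p → p ≺2^ q → ι l ℚ.< q
≺2^-lower {p} q l 2^l≤p p≺2^q = lemma q (2^-cancel-< {+ l ℤ.* + ↧ₙ q} {↥ q} (begin-strict
  2^ (+ l ℤ.* + ↧ₙ q)        ≡⟨ 2^-* (+ l) (↧ₙ q) ⟩
  (ι 2 ^ l) ^ ↧ₙ q           ≡⟨ cong (_^ ↧ₙ q) (ι-^ 2 l) ⟨
  ι (2 ^ℕ l) ^ ↧ₙ q          ≤⟨ ^-mono-≤ (↧ₙ q) (0≤ι (2 ^ℕ l)) 2^l≤p ⟩
  p ^ ↧ₙ q                   <⟨ ≺2^⇒< q (ℚ.≤-trans (0≤ι (2 ^ℕ l)) 2^l≤p) p≺2^q ⟩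
  2^ (↥ q)                   ∎))
  where
  open ℚ.≤-Reasoning
  lemma : ∀ q → + l ℤ.* + ↧ₙ q ℤ.< ↥ q → ι l ℚ.< q
  lemma q@record{} h = ℚ.toℚᵘ-cancel-< (ℚᵘ.<-respˡ-≃ (ℚᵘ.≃-sym (toℚᵘ-ι l)) (*<* (subst (+ l ℤ.* + ↧ₙ q ℤ.<_) (sym (ℤ.*-identityʳ (↥ q))) h)))

-- The integer form of `i ≤ log* k`. It ensures that every logarithm taken on the way to `lg i k`
-- has an argument of at least 2, so that real and truncated logarithms stay comparable.
Large : ℕ → ℕ → Set
Large k i = ∀ {j} → j < i → 2 ≤ lg j k

1≤lg : ∀ {k i} → 1 ≤ k → Large k i → 1 ≤ lg i k
1≤lg {i = zero}  1≤k _     = 1≤k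
1≤lg {i = suc i} 1≤k large = ⌊log₂⌋-mono-≤ {2} (large ℕ.≤-refl)

<log^ : ∀ i k → Large k i → ∀ {q} → U (log^ i (fromℕ k)) q → ι (lg i k) ℚ.< q
<log^ zero    k large k<q = k<q
<log^ (suc i) k large {q} (p , Up , p≺2^q) = ≺2^-lower q (lg (suc i) k)
  (ℚ.≤-trans (ι-mono-≤ {2 ^ℕ lg (suc i) k} {lg i k} (2^⌊log₂n⌋≤n (lg i k) (ℕ.<⇒≤ (large ℕ.≤-refl))))
             (ℚ.<⇒≤ (<log^ i k (λ j<i → large (ℕ.m≤n⇒m≤1+n j<i)) Up)))
  p≺2^q

-- Since `lg i k` may equal the iterated logarithm, it need not belong to the open lower cut. The
-- offset `½` gives a strict lower bound that survives taking logarithms.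
minus½ : ℕ → ℚ
minus½ l = + ℕ.pred (2 * l) ℚ./ 2

minus½*2 : ∀ l → minus½ l ℚ.* ι 2 ≡ ι (ℕ.pred (2 * l))
minus½*2 l = /-*-ι (ℕ.pred (2 * l)) 2

minus½< : ∀ l → 1 ≤ l → minus½ l ℚ.< ι l
minus½< l@(suc l-1) _ = ℚ*-cancelʳ-< (ι 2) (0≤ι 2) (subst (ℚ._< ι l ℚ.* ι 2) (sym (minus½*2 l))
  (subst (ι (ℕ.pred (2 * l)) ℚ.<_) (ι-* l 2) (ι-mono-< {ℕ.pred (2 * l)} {l * 2} (ℕ.≤-reflexive (ℕ.*-comm 2 l)))))

-- Squared, the claim is `2^(2l) / 2 < (l′ - ½)²`; it follows from `l′² / 2 < (l′ - ½)²`, valid for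
-- `l′ ≥ 2`.
minus½-log : ∀ l l′ → 1 ≤ l → 2 ≤ l′ → 2 ^ℕ l ≤ l′ → 2^ (minus½ l) ≺ minus½ l′
minus½-log l@(suc l-1) l′ 1≤l 2≤l′ 2^l≤l′ = 2^<^⇒2^≺ (+ ℕ.pred (2 * l)) 2 0<minus½ (ℚ*-cancelʳ-< (ι 4) (0≤ι 4) (begin-strict
  ι 2 ^ ℕ.pred (2 * l) ℚ.* ι 4          ≡⟨ cong (ℚ._* ι 4) (ι-^ 2 (ℕ.pred (2 * l))) ⟨
  ι (2 ^ℕ ℕ.pred (2 * l)) ℚ.* ι 4       ≡⟨ ι-* (2 ^ℕ ℕ.pred (2 * l)) 4 ⟨
  ι (2 ^ℕ ℕ.pred (2 * l) * 4)           <⟨ ι-mono-< {2 ^ℕ ℕ.pred (2 * l) * 4} {x * x} (squares l′ 2≤l′ 2^l≤l′) ⟩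
  ι (x * x)                             ≡⟨ ι-* x x ⟩
  ι x ℚ.* ι x                           ≡⟨ cong₂ ℚ._*_ (minus½*2 l′) (minus½*2 l′) ⟨
  minus½ l′ ℚ.* ι 2 ℚ.* (minus½ l′ ℚ.* ι 2) ≡⟨ square (minus½ l′) (ι 2) ⟩
  minus½ l′ ^ 2 ℚ.* ι 4                   ∎))
  where
  open ℚ.≤-Reasoning
  x : ℕ
  x = ℕ.pred (2 * l′)
  square : ∀ a b → a ℚ.* b ℚ.* (a ℚ.* b) ≡ a ^ 2 ℚ.* (b ℚ.* b)
  square a b = trans (lemma a b) (cong (λ y → a ℚ.* y ℚ.* (b ℚ.* b)) (sym (ℚ.*-identityʳ a)))
    where
    lemma : ∀ a b → a ℚ.* b ℚ.* (a ℚ.* b) ≡ a ℚ.* a ℚ.* (b ℚ.* b)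
    lemma a b = trans (ℚ.*-assoc a b (a ℚ.* b)) (trans (cong (a ℚ.*_) (trans (sym (ℚ.*-assoc b a b)) (trans (cong (ℚ._* b) (ℚ.*-comm b a)) (ℚ.*-assoc a b b)))) (sym (ℚ.*-assoc a a (b ℚ.* b))))
  0<minus½ : 0ℚ ℚ.< minus½ l′
  0<minus½ = ℚ*-cancelʳ-< (ι 2) (0≤ι 2) (subst (0ℚ ℚ.<_) (sym (minus½*2 l′)) (0<ι {x} (ℕ.<⇒≤pred (ℕ.≤-trans 2≤l′ (ℕ.m≤n*m l′ 2)))))
  squares : ∀ l′ → 2 ≤ l′ → 2 ^ℕ l ≤ l′ → 2 ^ℕ ℕ.pred (2 * l) * 4 < ℕ.pred (2 * l′) * ℕ.pred (2 * l′)
  squares (suc zero)       (s≤s ()) _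
  squares l′@(suc (suc j)) _ 2^l≤l′ = ℕ.≤-<-trans (ℕ.≤-trans (ℕ.≤-reflexive double) (ℕ.*-monoʳ-≤ 2 (ℕ.*-mono-≤ 2^l≤l′ 2^l≤l′)))
    (ℕ.≤-trans (ℕ.≤-reflexive (lemma₁ j)) (ℕ.≤-trans (ℕ.m≤m+n _ (2 * (j * j) + 4 * j)) (ℕ.≤-reflexive (lemma₂ j))))
    where
    double : 2 ^ℕ ℕ.pred (2 * l) * 4 ≡ 2 * (2 ^ℕ l * 2 ^ℕ l)
    double = trans (rearrange (2 ^ℕ ℕ.pred (2 * l))) (cong (2 *_) (trans (cong (λ e → 2 ^ℕ (l + e)) (ℕ.+-identityʳ l)) (ℕ.^-distribˡ-+-* 2 l l)))
      where
      rearrange : ∀ x → x * 4 ≡ 2 * (2 * x)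
      rearrange = solve-∀
    lemma₁ : ∀ j → suc (2 * (suc (suc j) * suc (suc j))) ≡ 9 + 8 * j + 2 * (j * j)
    lemma₁ = solve-∀
    lemma₂ : ∀ j → 9 + 8 * j + 2 * (j * j) + (2 * (j * j) + 4 * j) ≡ (suc j + suc (suc j + 0)) * (suc j + suc (suc j + 0))
    lemma₂ = solve-∀

minus½<log^ : ∀ i k → 1 ≤ k → Large k i → L (log^ i (fromℕ k)) (minus½ (lg i k))
minus½<log^ zero    k 1≤k large = minus½< k 1≤k
minus½<log^ (suc i) k 1≤k large = minus½ (lg i k) , minus½<log^ i k 1≤k (λ j<i → large (ℕ.m≤n⇒m≤1+n j<i)) ,
  minus½-log (lg (suc i) k) (lg i k) (1≤lg {k} {suc i} 1≤k large) (large ℕ.≤-refl)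
    (2^⌊log₂n⌋≤n (lg i k) (ℕ.<⇒≤ (large ℕ.≤-refl)))

+-fraction-≤ : ∀ y x e n .{{_ : NonZero n}} → y ℚ.+ + e ℚ./ n ℚ.≤ x →
               (↥ y ℤ.* + n ℤ.+ + e ℤ.* ↧ y) ℤ.* ↧ x ℤ.≤ ↥ x ℤ.* (↧ y ℤ.* + n)
+-fraction-≤ y@record{} x@record{} e (suc n) y+e/n≤x
  with *≤* h ← ℚᵘ.≤-respˡ-≃ (ℚᵘ.≃-trans (ℚ.toℚᵘ-homo-+ y (+ e ℚ./ suc n)) (ℚᵘ.+-congʳ (ℚ.toℚᵘ y) (ℚ.toℚᵘ-fromℚᵘ (mkℚᵘ (+ e) n))))
                 (ℚ.toℚᵘ-mono-≤ y+e/n≤x) = h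

-- This is `p′/p ≥ 2^(x-y) ≥ 2^(e/n) ≥ (a/b)^e`, with `a/b` a rational lower bound for `2^(1/n)`.
-- Raising everything to the power `B`, the product of the three denominators, makes all exponents
-- of 2 integers.
exponential-gap : ∀ n e a b {p p′} y x .{{_ : NonZero n}} → a ^ℕ n ≤ 2 * b ^ℕ n → 1 ≤ b →
                  0ℚ ℚ.≤ p → p ≺2^ y → 2^ x ≺ p′ → y ℚ.+ + e ℚ./ n ℚ.≤ x →
                  p ℚ.* ι a ^ e ℚ.≤ p′ ℚ.* ι b ^ e
exponential-gap n e a b {p} {p′} y x a≤2b 1≤b 0≤p p≺2^y (0<p′ , 2^x<p′) y+e/n≤x =
  ℚ.≮⇒≥ λ gap → ℚ<⇒≱ (^-mono-< B 1≤B (0≤* (ℚ.<⇒≤ 0<p′) (0≤^ e (0≤ι b))) gap) (begin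
    (p ℚ.* ι a ^ e) ^ B
      ≡⟨ ^-distrib-* p (ι a ^ e) B ⟩
    p ^ B ℚ.* (ι a ^ e) ^ B
      ≤⟨ ℚ*-mono-≤ (0≤^ B 0≤p) p^B≤ (0≤^ B (0≤^ e (0≤ι a))) a^B≤ ⟩
    2^ (↥ y ℤ.* + (n * f)) ℚ.* (ι 2 ^ (e * (d * f)) ℚ.* (ι b ^ e) ^ B)
      ≡⟨ ℚ.*-assoc (2^ (↥ y ℤ.* + (n * f))) (ι 2 ^ (e * (d * f))) ((ι b ^ e) ^ B) ⟨
    2^ (↥ y ℤ.* + (n * f)) ℚ.* ι 2 ^ (e * (d * f)) ℚ.* (ι b ^ e) ^ B
      ≡⟨ cong (ℚ._* (ι b ^ e) ^ B) (2^-+ (↥ y ℤ.* + (n * f)) (e * (d * f))) ⟨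
    2^ (↥ y ℤ.* + (n * f) ℤ.+ + (e * (d * f))) ℚ.* (ι b ^ e) ^ B
      ≤⟨ ℚ*-monoˡ-≤ (0≤^ B (0≤^ e (0≤ι b))) (2^-mono-≤ exponents) ⟩
    2^ (↥ x ℤ.* + (d * n)) ℚ.* (ι b ^ e) ^ B
      ≤⟨ ℚ*-monoˡ-≤ (0≤^ B (0≤^ e (0≤ι b))) ≤p′^B ⟩
    p′ ^ B ℚ.* (ι b ^ e) ^ B
      ≡⟨ ^-distrib-* p′ (ι b ^ e) B ⟨
    (p′ ℚ.* ι b ^ e) ^ B ∎)
  where
  open ℚ.≤-Reasoning
  d f B : ℕ
  d = ↧ₙ y
  f = ↧ₙ x
  B = d * (n * f)
  1≤B : 1 ≤ B
  1≤B = ℕ.*-mono-≤ (1≤↧ₙ y) (ℕ.*-mono-≤ (ℕ.>-nonZero⁻¹ n) (1≤↧ₙ x))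
  p^B≤ : p ^ B ℚ.≤ 2^ (↥ y ℤ.* + (n * f))
  p^B≤ = begin
    p ^ B                      ≡⟨ ^-assocʳ p d (n * f) ⟨
    (p ^ d) ^ (n * f)          ≤⟨ ^-mono-≤ (n * f) (0≤^ d 0≤p) (ℚ.<⇒≤ (≺2^⇒< y 0≤p p≺2^y)) ⟩
    (2^ (↥ y)) ^ (n * f)       ≡⟨ 2^-* (↥ y) (n * f) ⟨
    2^ (↥ y ℤ.* + (n * f))     ∎
  ≤p′^B : 2^ (↥ x ℤ.* + (d * n)) ℚ.≤ p′ ^ B
  ≤p′^B = begin
    2^ (↥ x ℤ.* + (d * n))     ≡⟨ 2^-* (↥ x) (d * n) ⟩
    (2^ (↥ x)) ^ (d * n)       ≤⟨ ^-mono-≤ (d * n) (ℚ.<⇒≤ (0<2^ (↥ x))) (ℚ.<⇒≤ 2^x<p′) ⟩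
    (p′ ^ f) ^ (d * n)         ≡⟨ trans (^-assocʳ p′ f (d * n)) (cong (p′ ^_) (rot f d n)) ⟩
    p′ ^ B                     ∎
    where
    rot : ∀ f d n → f * (d * n) ≡ d * (n * f)
    rot = solve-∀
  a^B≤ : (ι a ^ e) ^ B ℚ.≤ ι 2 ^ (e * (d * f)) ℚ.* (ι b ^ e) ^ B
  a^B≤ = begin
    (ι a ^ e) ^ B                                   ≡⟨ regroup (ι a) ⟩
    (ι a ^ n) ^ (e * (d * f))                       ≤⟨ ^-mono-≤ (e * (d * f)) (0≤^ n (0≤ι a)) a^n≤ ⟩
    (ι 2 ℚ.* ι b ^ n) ^ (e * (d * f))               ≡⟨ ^-distrib-* (ι 2) (ι b ^ n) (e * (d * f)) ⟩
    ι 2 ^ (e * (d * f)) ℚ.* (ι b ^ n) ^ (e * (d * f)) ≡⟨ cong (ι 2 ^ (e * (d * f)) ℚ.*_) (regroup (ι b)) ⟨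
    ι 2 ^ (e * (d * f)) ℚ.* (ι b ^ e) ^ B           ∎
    where
    rot : ∀ e d n f → e * (d * (n * f)) ≡ n * (e * (d * f))
    rot = solve-∀
    regroup : ∀ q → (q ^ e) ^ B ≡ (q ^ n) ^ (e * (d * f))
    regroup q = trans (^-assocʳ q e B) (trans (cong (q ^_) (rot e d n f)) (sym (^-assocʳ q n (e * (d * f)))))
    a^n≤ : ι a ^ n ℚ.≤ ι 2 ℚ.* ι b ^ n
    a^n≤ = begin
      ι a ^ n              ≡⟨ ι-^ a n ⟨
      ι (a ^ℕ n)           ≤⟨ ι-mono-≤ {a ^ℕ n} {2 * b ^ℕ n} a≤2b ⟩
      ι (2 * b ^ℕ n)       ≡⟨ trans (ι-* 2 (b ^ℕ n)) (cong (ι 2 ℚ.*_) (ι-^ b n)) ⟩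
      ι 2 ℚ.* ι b ^ n      ∎
  exponents : ↥ y ℤ.* + (n * f) ℤ.+ + (e * (d * f)) ℤ.≤ ↥ x ℤ.* + (d * n)
  exponents = subst₂ ℤ._≤_ left≡ (cong (↥ x ℤ.*_) (sym (ℤ.pos-* d n))) (+-fraction-≤ y x e n y+e/n≤x)
    where
    left≡ : (↥ y ℤ.* + n ℤ.+ + e ℤ.* ↧ y) ℤ.* ↧ x ≡ ↥ y ℤ.* + (n * f) ℤ.+ + (e * (d * f))
    left≡ = trans (ℤ.*-distribʳ-+ (+ f) (↥ y ℤ.* + n) (+ e ℤ.* + d)) (cong₂ ℤ._+_
      (trans (ℤ.*-assoc (↥ y) (+ n) (+ f)) (cong (↥ y ℤ.*_) (sym (ℤ.pos-* n f))))
      (trans (ℤ.*-assoc (+ e) (+ d) (+ f)) (trans (cong (+ e ℤ.*_) (sym (ℤ.pos-* d f))) (sym (ℤ.pos-* e (d * f))))))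

-- Real arithmetic

L-* : ∀ {x y a b c d q} → L x a → U x b → L y c → U y d → 0ℚ ℚ.≤ a → a ℚ.≤ b → 0ℚ ℚ.≤ c → c ℚ.≤ d →
      q ℚ.< a ℚ.* c → L (x *ᴿ y) q
L-* {a = a} {b} {c} {d} La Ub Lc Ud 0≤a a≤b 0≤c c≤d q<ac = a , b , c , d , La , Ub , Lc , Ud ,
  q<ac ,
  ℚ.<-≤-trans q<ac (ℚ*-monoʳ-≤ 0≤a c≤d) ,
  ℚ.<-≤-trans q<ac (ℚ*-monoˡ-≤ 0≤c a≤b) ,
  ℚ.<-≤-trans q<ac (ℚ*-mono-≤ 0≤a a≤b 0≤c c≤d)

U-* : ∀ {x y a b c d q} → L x a → U x b → L y c → U y d → 0ℚ ℚ.≤ a → a ℚ.≤ b → 0ℚ ℚ.≤ c → c ℚ.≤ d →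
      b ℚ.* d ℚ.< q → U (x *ᴿ y) q
U-* {a = a} {b} {c} {d} La Ub Lc Ud 0≤a a≤b 0≤c c≤d bd<q = a , b , c , d , La , Ub , Lc , Ud ,
  ℚ.≤-<-trans (ℚ*-mono-≤ 0≤a a≤b 0≤c c≤d) bd<q ,
  ℚ.≤-<-trans (ℚ*-monoˡ-≤ (ℚ.≤-trans 0≤c c≤d) a≤b) bd<q ,
  ℚ.≤-<-trans (ℚ*-monoʳ-≤ (ℚ.≤-trans 0≤a a≤b) c≤d) bd<q ,
  bd<q

-- The strict lower bounds `C₁`, `k - 1` and `lg i k - ½` stand for the three factors. Each of the
-- last two loses at most a factor 2, and another factor 2 buys strictness, whence the 8.
fromℕ≤product : ∀ {n C₀ C₁ i k} → 2 ≤ k → Large k i → C₀ * 8 ≤ C₁ → n ≤ C₀ * (k * lg i k) →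
                fromℕ n ≤ᴿ fromℕ (suc C₁) *ᴿ (fromℕ k *ᴿ log^ i (fromℕ k))
fromℕ≤product {n} {C₀} {C₁} {i} {k@(suc k-1)} 2≤k large 8C₀≤C₁ n≤ q q<n
  with p , Up , p< ← log^< i k = L-* {fromℕ (suc C₁)} {fromℕ k *ᴿ log^ i (fromℕ k)}
    (ι-mono-< {C₁} {suc C₁} ℕ.≤-refl) (ι-mono-< {suc C₁} {suc (suc C₁)} ℕ.≤-refl) Lc Ud
    (0≤ι C₁) (ι-mono-≤ {C₁} {suc (suc C₁)} (ℕ.m≤n⇒m≤1+n (ℕ.n≤1+n C₁))) 0≤c c≤d (ℚ.<-≤-trans q<n n≤C₁c)
  where
  l : ℕ
  l = lg i k
  1≤l : 1 ≤ l
  1≤l = 1≤lg {k} {i} (ℕ.<⇒≤ 2≤k) large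
  c d : ℚ
  c = + (k * l) ℚ./ 8
  d = ι (suc k) ℚ.* p ℚ.+ 1ℚ
  minus½<p : minus½ l ℚ.< p
  minus½<p = ℚ.<-trans (minus½< l 1≤l) (<log^ i k large Up)
  0≤minus½ : 0ℚ ℚ.≤ minus½ l
  0≤minus½ = ℚ*-cancelʳ-≤ (ι 2) (0<ι {2} (s≤s z≤n)) (subst₂ ℚ._≤_ (sym (ℚ.*-zeroˡ (ι 2))) (sym (minus½*2 l)) (0≤ι (ℕ.pred (2 * l))))
  k-1<k+1 : ι k-1 ℚ.≤ ι (suc k)
  k-1<k+1 = ι-mono-≤ {k-1} {suc k} (ℕ.m≤n⇒m≤1+n (ℕ.n≤1+n k-1))
  c<[k-1]minus½ : c ℚ.< ι k-1 ℚ.* minus½ l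
  c<[k-1]minus½ = ℚ*-cancelʳ-< (ι 8) (0≤ι 8) (begin-strict
    c ℚ.* ι 8                              ≡⟨ /-*-ι (k * l) 8 ⟩
    ι (k * l)                              <⟨ ι-mono-< {k * l} {k-1 * ℕ.pred (2 * l) * 4} (product< k l 2≤k 1≤l) ⟩
    ι (k-1 * ℕ.pred (2 * l) * 4)           ≡⟨ ι-* (k-1 * ℕ.pred (2 * l)) 4 ⟩
    ι (k-1 * ℕ.pred (2 * l)) ℚ.* ι 4       ≡⟨ cong (ℚ._* ι 4) (trans (ι-* k-1 (ℕ.pred (2 * l))) (cong (ι k-1 ℚ.*_) (sym (minus½*2 l)))) ⟩
    ι k-1 ℚ.* (minus½ l ℚ.* ι 2) ℚ.* ι 4     ≡⟨ regroup (ι k-1) (minus½ l) (ι 2) (ι 4) ⟩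
    ι k-1 ℚ.* minus½ l ℚ.* ι 8               ∎)
    where
    open ℚ.≤-Reasoning
    regroup : ∀ a b c d → a ℚ.* (b ℚ.* c) ℚ.* d ≡ a ℚ.* b ℚ.* (c ℚ.* d)
    regroup = Solver.solve-∀ ℚ-ring
    product< : ∀ k l → 2 ≤ k → 1 ≤ l → k * l < ℕ.pred k * ℕ.pred (2 * l) * 4
    product< (suc (suc x)) (suc y) _ _ = ℕ.≤-trans (ℕ.m≤m+n _ (1 + 6 * y + 3 * x + 7 * (x * y))) (ℕ.≤-reflexive (lemma x y))
      where
      lemma : ∀ x y → suc ((2 + x) * suc y) + (1 + 6 * y + 3 * x + 7 * (x * y)) ≡ suc x * (y + suc (y + 0)) * 4
      lemma = solve-∀
    product< (suc zero) _ (s≤s ()) _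
  0≤c : 0ℚ ℚ.≤ c
  0≤c = ℚ*-cancelʳ-≤ (ι 8) (0<ι {8} (s≤s z≤n)) (subst₂ ℚ._≤_ (sym (ℚ.*-zeroˡ (ι 8))) (sym (/-*-ι (k * l) 8)) (0≤ι (k * l)))
  Lc : L (fromℕ k *ᴿ log^ i (fromℕ k)) c
  Lc = L-* {fromℕ k} {log^ i (fromℕ k)} (ι-mono-< {k-1} {k} ℕ.≤-refl) (ι-mono-< {k} {suc k} ℕ.≤-refl)
         (minus½<log^ i k (ℕ.<⇒≤ 2≤k) large) Up (0≤ι k-1) k-1<k+1 0≤minus½ (ℚ.<⇒≤ minus½<p) c<[k-1]minus½
  <+1 : ∀ p → p ℚ.< p ℚ.+ 1ℚ
  <+1 p = subst (ℚ._< p ℚ.+ 1ℚ) (ℚ.+-identityʳ p) (ℚ.+-monoʳ-< p (0<ι {1} ℕ.≤-refl))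
  Ud : U (fromℕ k *ᴿ log^ i (fromℕ k)) d
  Ud = U-* {fromℕ k} {log^ i (fromℕ k)} (ι-mono-< {k-1} {k} ℕ.≤-refl) (ι-mono-< {k} {suc k} ℕ.≤-refl)
         (minus½<log^ i k (ℕ.<⇒≤ 2≤k) large) Up (0≤ι k-1) k-1<k+1 0≤minus½ (ℚ.<⇒≤ minus½<p) (<+1 (ι (suc k) ℚ.* p))
  c≤d : c ℚ.≤ d
  c≤d = ℚ.≤-trans (ℚ.<⇒≤ c<[k-1]minus½) (ℚ.≤-trans (ℚ*-mono-≤ (0≤ι k-1) k-1<k+1 0≤minus½ (ℚ.<⇒≤ minus½<p)) (ℚ.<⇒≤ (<+1 (ι (suc k) ℚ.* p))))
  n≤C₁c : ι n ℚ.≤ ι C₁ ℚ.* c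
  n≤C₁c = ℚ*-cancelʳ-≤ (ι 8) (0<ι {8} (s≤s z≤n)) (begin
    ι n ℚ.* ι 8              ≡⟨ ι-* n 8 ⟨
    ι (n * 8)                ≤⟨ ι-mono-≤ {n * 8} {C₁ * (k * l)} n8≤ ⟩
    ι (C₁ * (k * l))         ≡⟨ ι-* C₁ (k * l) ⟩
    ι C₁ ℚ.* ι (k * l)       ≡⟨ cong (ι C₁ ℚ.*_) (/-*-ι (k * l) 8) ⟨
    ι C₁ ℚ.* (c ℚ.* ι 8)     ≡⟨ ℚ.*-assoc (ι C₁) c (ι 8) ⟨
    ι C₁ ℚ.* c ℚ.* ι 8       ∎)
    where
    open ℚ.≤-Reasoning
    swap : ∀ a b c → a * b * c ≡ a * c * b
    swap = solve-∀
    n8≤ : n * 8 ≤ C₁ * (k * l)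
    n8≤ = ℕ.≤-trans (ℕ.*-monoˡ-≤ 8 n≤) (ℕ.≤-trans (ℕ.≤-reflexive (swap C₀ (k * l) 8)) (ℕ.*-monoˡ-≤ (k * l) 8C₀≤C₁))

fromℕ≤multiple : ∀ {n C₀ k} → 2 ≤ k → n ≤ C₀ * k → fromℕ n ≤ᴿ fromℕ (suc (2 * C₀)) *ᴿ fromℕ k
fromℕ≤multiple {n} {C₀} {k@(suc k-1)} (s≤s 1≤k-1) n≤ q q<n = L-* {fromℕ (suc C₁)} {fromℕ k}
  (ι-mono-< {C₁} {suc C₁} ℕ.≤-refl) (ι-mono-< {suc C₁} {suc (suc C₁)} ℕ.≤-refl)
  (ι-mono-< {k-1} {k} ℕ.≤-refl) (ι-mono-< {k} {suc k} ℕ.≤-refl)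
  (0≤ι C₁) (ι-mono-≤ {C₁} {suc (suc C₁)} (ℕ.m≤n⇒m≤1+n (ℕ.n≤1+n C₁)))
  (0≤ι k-1) (ι-mono-≤ {k-1} {suc k} (ℕ.m≤n⇒m≤1+n (ℕ.n≤1+n k-1)))
  (ℚ.<-≤-trans q<n (subst (ι n ℚ.≤_) (ι-* C₁ k-1) (ι-mono-≤ {n} {C₁ * k-1} (ℕ.≤-trans n≤
    (ℕ.≤-trans (ℕ.*-monoʳ-≤ C₀ (ℕ.+-monoˡ-≤ k-1 1≤k-1)) (ℕ.≤-reflexive (lemma C₀ k-1)))))))
  where
  C₁ : ℕ
  C₁ = 2 * C₀
  lemma : ∀ a b → a * (b + b) ≡ 2 * a * b
  lemma = solve-∀

-- An upper bound has to be strict, so `2^n′` becomes `2^n′ + 1`. The margin of one below the tower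
-- absorbs this, because `2^n′ + 2 ≤ 2^(n′+1)` for `n′ ≥ 1`.
U-exp^ : ∀ r {y n N} → U y (ι n) → 1 ≤ n → suc n ≤ N →
         ∃[ n′ ] (U (exp^ r y) (ι n′) × 1 ≤ n′ × suc n′ ≤ tower r N)
U-exp^ zero    {n = n} Uy 1≤n n<N = n , Uy , 1≤n , n<N
U-exp^ (suc r) {y} {n} {N} Uy 1≤n n<N with n′ , Uy′ , 1≤n′ , n′<N′ ← U-exp^ r Uy 1≤n n<N =
  suc (2 ^ℕ n′) ,
  (ι n′ , Uy′ , 2^<^⇒2^≺ (+ n′) 1 (0<ι {suc (2 ^ℕ n′)} (s≤s z≤n)) (subst₂ ℚ._<_ (ι-^ 2 n′) (sym (ℚ.*-identityʳ (ι (suc (2 ^ℕ n′)))))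
    (ι-mono-< {2 ^ℕ n′} {suc (2 ^ℕ n′)} ℕ.≤-refl))) ,
  s≤s z≤n ,
  (begin
    2 + 2 ^ℕ n′                 ≤⟨ ℕ.+-monoˡ-≤ (2 ^ℕ n′) (ℕ.^-monoʳ-≤ 2 {1} {n′} 1≤n′) ⟩
    2 ^ℕ n′ + 2 ^ℕ n′           ≡⟨ cong (_+_ (2 ^ℕ n′)) (ℕ.+-identityʳ (2 ^ℕ n′)) ⟨
    2 ^ℕ suc n′                 ≤⟨ ℕ.^-monoʳ-≤ 2 n′<N′ ⟩
    2 ^ℕ tower r N              ≡⟨ tower-suc r N ⟨
    tower (suc r) N             ∎)
  where open ℕ.≤-Reasoning

-- Some positive lower bound is required for the reciprocal to have an upper bound at all, and
-- interval multiplication asks for one; `½ < 2^½` makes `½` stable.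
L-exp^ : ∀ r {y} → L y ½ → L (exp^ r y) ½
L-exp^ zero    Ly = Ly
L-exp^ (suc r) Ly = ½ , L-exp^ r Ly , inj₂ (ℚ.*<* (ℤ.+<+ (ℕ.m≤m+n 2 6)))

below-natural : ∀ q → ∃[ n ] q ℚ.< ι n
below-natural q@record{} = suc ℤ.∣ ↥ q ∣ , ℚ.toℚᵘ-cancel-< (ℚᵘ.<-respʳ-≃ (ℚᵘ.≃-sym (toℚᵘ-ι (suc ℤ.∣ ↥ q ∣)))
  (*<* (ℤ.≤-<-trans (ℤ.≤-reflexive (ℤ.*-identityʳ (↥ q))) (ℤ.≤-<-trans (i≤∣i∣ (↥ q))
    (ℤ.<-≤-trans (ℤ.+<+ (ℕ.n<1+n ℤ.∣ ↥ q ∣)) (ℤ.≤-trans (ℤ.+≤+ (ℕ.m≤m*n (suc ℤ.∣ ↥ q ∣) (↧ₙ q))) (ℤ.≤-reflexive (ℤ.pos-* (suc ℤ.∣ ↥ q ∣) (↧ₙ q)))))))))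
  where
  i≤∣i∣ : ∀ i → i ℤ.≤ + ℤ.∣ i ∣
  i≤∣i∣ (+ n)     = ℤ.≤-refl
  i≤∣i∣ -[1+ n ]  = ℤ.-≤+

L<U : ∀ {x p q} → IsReal x → L x p → U x q → p ℚ.< q
L<U {x} {p} {q} real Lp Uq = ℚ.≰⇒> λ q≤p → IsReal.disjoint real (lower q≤p , Uq)
  where
  lower : q ℚ.≤ p → L x q
  lower q≤p with ℚ.<-cmp q p
  ... | tri< q<p _ _ = IsReal.L-lower real q<p Lp
  ... | tri≈ _ refl _ = Lp
  ... | tri> _ _ p<q = contradiction q≤p (ℚ<⇒≱ p<q)

½≤minus½ : ∀ l → 1 ≤ l → ½ ℚ.≤ minus½ l
½≤minus½ l 1≤l = ℚ*-cancelʳ-≤ (ι 2) (0<ι {2} (s≤s z≤n)) (subst (½ ℚ.* ι 2 ℚ.≤_) (sym (minus½*2 l)) (ι-mono-≤ {1} {ℕ.pred (2 * l)} (ℕ.pred-mono-≤ (ℕ.*-monoʳ-≤ 2 1≤l))))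

module ScaledLog {c} (real : IsReal c) (1<c : fromℕ 1 <ᴿ c) (k i : ℕ) (1≤k : 1 ≤ k) (large : Large k i) where

  private
    a b : ℚ
    a = proj₁ 1<c
    1<a : ι 1 ℚ.< a
    1<a = proj₁ (proj₂ 1<c)
    La : L c a
    La = proj₂ (proj₂ 1<c)
    b = proj₁ (IsReal.U-inhabited real)
    Ub : U c b
    Ub = proj₂ (IsReal.U-inhabited real)
    0≤a : 0ℚ ℚ.≤ a
    0≤a = ℚ.<⇒≤ (ℚ.<-trans (0<ι {1} ℕ.≤-refl) 1<a)
    a≤b : a ℚ.≤ b
    a≤b = ℚ.<⇒≤ (L<U real La Ub)
    c₁ l : ℕ
    c₁ = proj₁ (below-natural b)
    l = lg i k
    1≤l : 1 ≤ l
    1≤l = 1≤lg {k} {i} 1≤k large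
    p : ℚ
    p = proj₁ (log^< i k)
    Up : U (log^ i (fromℕ k)) p
    Up = proj₁ (proj₂ (log^< i k))
    p<1+l : p ℚ.< ι (suc l)
    p<1+l = proj₂ (proj₂ (log^< i k))
    minus½<p : minus½ l ℚ.< p
    minus½<p = ℚ.<-trans (minus½< l 1≤l) (<log^ i k large Up)
    0≤minus½ : 0ℚ ℚ.≤ minus½ l
    0≤minus½ = ℚ.≤-trans (ℚ.<⇒≤ (ℚ.*<* (ℤ.+<+ (s≤s z≤n)))) (½≤minus½ l 1≤l)

  scaled-lower : L (c *ᴿ log^ i (fromℕ k)) ½
  scaled-lower = L-* {c} {log^ i (fromℕ k)} La Ub (minus½<log^ i k 1≤k large) Up 0≤a a≤b 0≤minus½ (ℚ.<⇒≤ minus½<p)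
    (ℚ.≤-<-trans (½≤minus½ l 1≤l) (subst (ℚ._< a ℚ.* minus½ l) (ℚ.*-identityˡ (minus½ l))
      (ℚ*-monoˡ-< (ℚ.<-≤-trans (ℚ.*<* (ℤ.+<+ (s≤s z≤n))) (½≤minus½ l 1≤l)) 1<a)))

  scaled-upper : U (c *ᴿ log^ i (fromℕ k)) (ι (proj₁ (below-natural (proj₁ (IsReal.U-inhabited real))) * suc (lg i k)))
  scaled-upper = U-* {c} {log^ i (fromℕ k)} La Ub (minus½<log^ i k 1≤k large) Up 0≤a a≤b 0≤minus½ (ℚ.<⇒≤ minus½<p)
    (ℚ.≤-<-trans (ℚ*-monoʳ-≤ (ℚ.≤-trans 0≤a a≤b) (ℚ.<⇒≤ p<1+l))
      (subst (b ℚ.* ι (suc l) ℚ.<_) (sym (ι-* c₁ (suc l))) (ℚ*-monoˡ-< (0<ι {suc l} (s≤s z≤n)) (proj₂ (below-natural b)))))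

-- Error probabilities compared with the real error bound

½^*2^ : ∀ n → ½ ^ n ℚ.* ι (2 ^ℕ n) ≡ 1ℚ
½^*2^ n = trans (cong (½ ^ n ℚ.*_) (ι-^ 2 n)) (trans (sym (^-distrib-* ½ (ι 2) n)) (1^ n))
  where
  1^ : ∀ n → 1ℚ ^ n ≡ 1ℚ
  1^ zero    = refl
  1^ (suc n) = trans (ℚ.*-identityˡ (1ℚ ^ n)) (1^ n)

0<½^ : ∀ n → 0ℚ ℚ.< ½ ^ n
0<½^ n = 0<^ n (ℚ.*<* (ℤ.+<+ (s≤s z≤n)))

½^≤1 : ∀ n → ½ ^ n ℚ.≤ 1ℚ
½^≤1 zero    = ℚ.≤-refl
½^≤1 (suc n) = ℚ.≤-trans (ℚ*-mono-≤ {½} {1ℚ} (ℚ.*≤* (ℤ.+≤+ z≤n)) (ℚ.*≤* (ℤ.+≤+ (s≤s z≤n))) (ℚ.<⇒≤ (0<½^ n)) (½^≤1 n)) (ℚ.≤-reflexive refl)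

½^-anti : ∀ {m n} → m ≤ n → ½ ^ n ℚ.≤ ½ ^ m
½^-anti {m} {n} m≤n = ℚ*-cancelʳ-≤ (ι (2 ^ℕ n)) (0<ι {2 ^ℕ n} (1≤2^ n)) (begin
  ½ ^ n ℚ.* ι (2 ^ℕ n)      ≡⟨ trans (½^*2^ n) (sym (½^*2^ m)) ⟩
  ½ ^ m ℚ.* ι (2 ^ℕ m)      ≤⟨ ℚ*-monoʳ-≤ (ℚ.<⇒≤ (0<½^ m)) (ι-mono-≤ {2 ^ℕ m} {2 ^ℕ n} (ℕ.^-monoʳ-≤ 2 m≤n)) ⟩
  ½ ^ m ℚ.* ι (2 ^ℕ n)      ∎)
  where open ℚ.≤-Reasoning

error-fraction : ∀ e s .{{_ : NonZero s}} m n → e * (2 ^ℕ n * 2 ^ℕ m) ≤ s * (2 * 2 ^ℕ n + 5 * 2 ^ℕ m) →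
                 + e ℚ./ s ℚ.≤ ι 5 ℚ.* (½ ^ m ℚ.+ ½ ^ n)
error-fraction e s m n e≤ = ℚ*-cancelʳ-≤ (ι s ℚ.* (ι W ℚ.* ι R)) (0<* (0<ι {s} (ℕ.>-nonZero⁻¹ s)) (0<* (0<ι {W} (1≤2^ n)) (0<ι {R} (1≤2^ m)))) (begin
  + e ℚ./ s ℚ.* (ι s ℚ.* (ι W ℚ.* ι R))     ≡⟨ ℚ.*-assoc (+ e ℚ./ s) (ι s) (ι W ℚ.* ι R) ⟨
  + e ℚ./ s ℚ.* ι s ℚ.* (ι W ℚ.* ι R)       ≡⟨ cong₂ ℚ._*_ (/-*-ι e s) (sym (ι-* W R)) ⟩
  ι e ℚ.* ι (W * R)                         ≡⟨ ι-* e (W * R) ⟨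
  ι (e * (W * R))                           ≤⟨ ι-mono-≤ {e * (W * R)} {s * (5 * (W + R))} (ℕ.≤-trans e≤ (ℕ.*-monoʳ-≤ s (ℕ.≤-trans
                                                 (ℕ.+-monoˡ-≤ (5 * R) (ℕ.*-monoˡ-≤ W {2} {5} (s≤s (s≤s z≤n)))) (ℕ.≤-reflexive (sym (ℕ.*-distribˡ-+ 5 W R)))))) ⟩
  ι (s * (5 * (W + R)))                     ≡⟨ trans (ι-* s (5 * (W + R))) (cong (ι s ℚ.*_) (trans (ι-* 5 (W + R)) (cong (ι 5 ℚ.*_) (ι-+ W R)))) ⟩
  ι s ℚ.* (ι 5 ℚ.* (ι W ℚ.+ ι R))           ≡⟨ cong (λ x → ι s ℚ.* (ι 5 ℚ.* x)) (cong₂ ℚ._+_ (sym (ℚ.*-identityˡ (ι W))) (sym (ℚ.*-identityˡ (ι R)))) ⟩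
  ι s ℚ.* (ι 5 ℚ.* (1ℚ ℚ.* ι W ℚ.+ 1ℚ ℚ.* ι R))
    ≡⟨ cong₂ (λ x y → ι s ℚ.* (ι 5 ℚ.* (x ℚ.* ι W ℚ.+ y ℚ.* ι R))) (½^*2^ m) (½^*2^ n) ⟨
  ι s ℚ.* (ι 5 ℚ.* (½ ^ m ℚ.* ι R ℚ.* ι W ℚ.+ ½ ^ n ℚ.* ι W ℚ.* ι R))
    ≡⟨ lemma (ι s) (ι 5) (½ ^ m) (½ ^ n) (ι W) (ι R) ⟩
  ι 5 ℚ.* (½ ^ m ℚ.+ ½ ^ n) ℚ.* (ι s ℚ.* (ι W ℚ.* ι R)) ∎)
  where
  open ℚ.≤-Reasoning
  W R : ℕ
  W = 2 ^ℕ n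
  R = 2 ^ℕ m
  lemma : ∀ s f u v W R → s ℚ.* (f ℚ.* (u ℚ.* R ℚ.* W ℚ.+ v ℚ.* W ℚ.* R)) ≡ f ℚ.* (u ℚ.+ v) ℚ.* (s ℚ.* (W ℚ.* R))
  lemma = Solver.solve-∀ ℚ-ring

-- The exponent witness is `-Q < -√k`; the additional factor `½` supplies the strict comparison with
-- `2^(-Q)`.
L-exp-√ : ∀ {k} Q → 1 ≤ Q → k < Q * Q → L (exp (-ᴿ (√ (fromℕ k)))) (½ ^ suc Q)
L-exp-√ {k} Q@(suc Q-1) _ k<Q² = -[1+ Q-1 ] ℚ./ 1 , (0<-p , k<p²) , ^<2^⇒≺2^ -[1+ Q-1 ] 1 (ℚ.<⇒≤ (0<½^ (suc Q))) shrink
  where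
  neg-p≡Q : ℚ.- (-[1+ Q-1 ] ℚ./ 1) ≡ ι Q
  neg-p≡Q = neg-neg (ι Q)
    where
    neg-neg : ∀ q → ℚ.- (ℚ.- q) ≡ q
    neg-neg = Solver.solve-∀ ℚ-ring
  0<-p : 0ℚ ℚ.< ℚ.- (-[1+ Q-1 ] ℚ./ 1)
  0<-p = subst (0ℚ ℚ.<_) (sym neg-p≡Q) (0<ι {Q} (s≤s z≤n))
  k<p² : ι k ℚ.< ℚ.- (-[1+ Q-1 ] ℚ./ 1) ℚ.* ℚ.- (-[1+ Q-1 ] ℚ./ 1)
  k<p² = subst (λ x → ι k ℚ.< x ℚ.* x) (sym neg-p≡Q) (subst (ι k ℚ.<_) (ι-* Q Q) (ι-mono-< {k} {Q * Q} k<Q²))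
  shrink : (½ ^ suc Q) ^ 1 ℚ.< ½ ^ Q
  shrink = subst₂ ℚ._<_ (sym (ℚ.*-identityʳ (½ ^ suc Q))) (ℚ.*-identityˡ (½ ^ Q)) (ℚ*-monoˡ-< (0<½^ Q) (ℚ.*<* {½} {1ℚ} (ℤ.+<+ (s≤s (s≤s z≤n)))))

U-exp-√ : ∀ k → U (exp (-ᴿ (√ (fromℕ k)))) (ι 3)
U-exp-√ k = ι 1 , inj₁ (ℚ.*<* ℤ.-<+) , 0<ι {3} (s≤s z≤n) , ℚ.*<* (ℤ.+<+ (ℕ.m≤m+n 3 0))

L-inv : ∀ {x n m} → U x (ι n) → 1 ≤ n → n < 2 ^ℕ m → L (inv x) (½ ^ m)
L-inv {x} {n} {m} Un 1≤n n<2^m = ι n , Un , 0<ι {n} 1≤n , subst (½ ^ m ℚ.* ι n ℚ.<_) (½^*2^ m)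
  (subst₂ ℚ._<_ (ℚ.*-comm (ι n) (½ ^ m)) (ℚ.*-comm (ι (2 ^ℕ m)) (½ ^ m)) (ℚ*-monoˡ-< (0<½^ m) (ι-mono-< {n} {2 ^ℕ m} n<2^m)))

U-inv : ∀ {x} → L x ½ → U (inv x) (ι 3)
U-inv Lx = ½ , Lx , ℚ.*<* (ℤ.+<+ (s≤s z≤n)) , ℚ.*<* (ℤ.+<+ (s≤s (s≤s (s≤s z≤n))))

fromℚ≤multiple : ∀ {x y u d} C₁ → 0ℚ ℚ.≤ u → L y u → u ℚ.≤ d → U y d → x ℚ.≤ ι C₁ ℚ.* u → fromℚ x ≤ᴿ fromℕ (suc C₁) *ᴿ y
fromℚ≤multiple {x} {y} {u} {d} C₁ 0≤u Lu u≤d Ud x≤ q q<x = L-* {fromℕ (suc C₁)} {y}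
  (ι-mono-< {C₁} {suc C₁} ℕ.≤-refl) (ι-mono-< {suc C₁} {suc (suc C₁)} ℕ.≤-refl) Lu Ud
  (0≤ι C₁) (ι-mono-≤ {C₁} {suc (suc C₁)} (ℕ.m≤n⇒m≤1+n (ℕ.n≤1+n C₁))) 0≤u u≤d (ℚ.<-≤-trans q<x x≤)

-- Half of `½^m + ½^Q` lies strictly below the error bound, as `½^(Q+1)` is already half of `½^Q`
-- and halving `½^m` makes the sum strict. The factor lost turns 5 into 10.
≤errorBound : ∀ {x} c k r n m Q C₁ → 10 ≤ C₁ → L (exp^ r (c *ᴿ log^ r (fromℕ k))) ½ →
              U (exp^ r (c *ᴿ log^ r (fromℕ k))) (ι n) → 1 ≤ n → n < 2 ^ℕ m → 1 ≤ Q → k < Q * Q →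
              x ℚ.≤ ι 5 ℚ.* (½ ^ m ℚ.+ ½ ^ Q) → fromℚ x ≤ᴿ fromℕ (suc C₁) *ᴿ errorBound c k r
≤errorBound {x} c k r n m Q C₁ 10≤C₁ LY UY 1≤n n<2^m 1≤Q k<Q² x≤ = fromℚ≤multiple {y = errorBound c k r} C₁ 0≤mean
  (u , v , L-inv {Y} {n} {m} UY 1≤n n<2^m , L-exp-√ Q 1≤Q k<Q² , mean<)
  mean≤7
  (ι 3 , ι 3 , U-inv {Y} LY , U-exp-√ k , ℚ.*<* (ℤ.+<+ (ℕ.m≤m+n 7 0)))
  (ℚ.≤-trans x≤ (begin
    ι 5 ℚ.* (u ℚ.+ w)              ≡⟨ cong (ℚ._* (u ℚ.+ w)) {ι 5} {ι 10 ℚ.* ½} refl ⟩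
    ι 10 ℚ.* ½ ℚ.* (u ℚ.+ w)       ≡⟨ ℚ.*-assoc (ι 10) ½ (u ℚ.+ w) ⟩
    ι 10 ℚ.* (½ ℚ.* (u ℚ.+ w))     ≤⟨ ℚ*-monoˡ-≤ 0≤mean (ι-mono-≤ {10} {C₁} 10≤C₁) ⟩
    ι C₁ ℚ.* (½ ℚ.* (u ℚ.+ w))     ∎))
  where
  open ℚ.≤-Reasoning
  u v w : ℚ
  u = ½ ^ m
  v = ½ ^ suc Q
  w = ½ ^ Q
  Y : ℝ
  Y = exp^ r (c *ᴿ log^ r (fromℕ k))
  0≤½ : 0ℚ ℚ.≤ ½
  0≤½ = ℚ.*≤* (ℤ.+≤+ z≤n)
  0≤mean : 0ℚ ℚ.≤ ½ ℚ.* (u ℚ.+ w)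
  0≤mean = 0≤* 0≤½ (ℚ.+-mono-≤ (ℚ.<⇒≤ (0<½^ m)) (ℚ.<⇒≤ (0<½^ Q)))
  mean< : ½ ℚ.* (u ℚ.+ w) ℚ.< u ℚ.+ v
  mean< = subst (ℚ._< u ℚ.+ v) (sym (ℚ.*-distribˡ-+ ½ u w)) (ℚ.+-monoˡ-< v
    (subst (½ ℚ.* u ℚ.<_) (ℚ.*-identityˡ u) (ℚ*-monoˡ-< (0<½^ m) (ℚ.*<* {½} {1ℚ} (ℤ.+<+ (s≤s (s≤s z≤n)))))))
  mean≤7 : ½ ℚ.* (u ℚ.+ w) ℚ.≤ ι 7
  mean≤7 = ℚ.≤-trans (ℚ*-monoʳ-≤ 0≤½ (ℚ.+-mono-≤ (½^≤1 m) (½^≤1 Q))) (ℚ.*≤* (ℤ.+≤+ (s≤s z≤n)))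

≤exp-√ : ∀ {x} k m Q → Q ≤ m → 1 ≤ Q → k < Q * Q → x ℚ.≤ ι 5 ℚ.* (½ ^ m ℚ.+ ½ ^ Q) →
         ∀ C₁ → 20 ≤ C₁ → fromℚ x ≤ᴿ fromℕ (suc C₁) *ᴿ exp (-ᴿ (√ (fromℕ k)))
≤exp-√ {x} k m Q Q≤m 1≤Q k<Q² x≤ C₁ 20≤C₁ = fromℚ≤multiple {y = exp (-ᴿ (√ (fromℕ k)))} C₁ (ℚ.<⇒≤ (0<½^ (suc Q)))
  (L-exp-√ Q 1≤Q k<Q²) (ℚ.≤-trans (½^≤1 (suc Q)) (ι-mono-≤ {1} {3} (s≤s z≤n))) (U-exp-√ k)
  (ℚ.≤-trans x≤ (begin
    ι 5 ℚ.* (½ ^ m ℚ.+ ½ ^ Q)        ≤⟨ ℚ*-monoʳ-≤ (0≤ι 5) (ℚ.+-monoˡ-≤ (½ ^ Q) (½^-anti Q≤m)) ⟩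
    ι 5 ℚ.* (½ ^ Q ℚ.+ ½ ^ Q)        ≡⟨ cong (ι 5 ℚ.*_) (trans (cong₂ ℚ._+_ one one) (sym (ℚ.*-distribʳ-+ (½ ^ Q) 1ℚ 1ℚ))) ⟩
    ι 5 ℚ.* (ι 2 ℚ.* ½ ^ Q)          ≡⟨ ℚ.*-assoc (ι 5) (ι 2) (½ ^ Q) ⟨
    ι 10 ℚ.* ½ ^ Q                   ≡⟨ cong (ℚ._* ½ ^ Q) {ι 10} {ι 20 ℚ.* ½} refl ⟩
    ι 20 ℚ.* ½ ℚ.* ½ ^ Q             ≡⟨ ℚ.*-assoc (ι 20) ½ (½ ^ Q) ⟩
    ι 20 ℚ.* ½ ^ suc Q               ≤⟨ ℚ*-monoˡ-≤ (ℚ.<⇒≤ (0<½^ (suc Q))) (ι-mono-≤ {20} {C₁} 20≤C₁) ⟩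
    ι C₁ ℚ.* ½ ^ suc Q               ∎))
  where
  open ℚ.≤-Reasoning
  one : ½ ^ Q ≡ 1ℚ ℚ.* ½ ^ Q
  one = sym (ℚ.*-identityˡ (½ ^ Q))

-- Asymptotics of the error bound

-- Ahead n x y says that y exceeds x by at least 1/n additively and by at least
-- 1 + 1/(2n) multiplicatively.  It passes from (log x , y) to (x , exp y) when
-- x ≥ 2, because 2^(1/n) ≥ 1 + 1/(2n).

Ahead : ∀ n .{{_ : NonZero n}} → ℝ → ℝ → Set
Ahead n x y = ∀ {q} → U y q → ∃[ p ] (U x p × p ℚ.* ι (suc (2 * n)) ℚ.≤ q ℚ.* ι (2 * n) × p ℚ.+ + 1 ℚ./ n ℚ.≤ q)

above-one : ∀ a → ι 1 ℚ.< a → ι (suc (↧ₙ a)) ℚ.≤ a ℚ.* ι (↧ₙ a)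
above-one a@(ℚ.mkℚ (+ i) d-1 _) 1<a = subst (ι (suc d) ℚ.≤_) (sym ad≡i)
  (ι-mono-≤ {suc d} {i} (ι-cancel-< {d} {i} (subst₂ ℚ._<_ (ℚ.*-identityˡ (ι d)) ad≡i (ℚ*-monoˡ-< (0<ι {d} (s≤s z≤n)) 1<a))))
  where
  d : ℕ
  d = suc d-1
  ad≡i : a ℚ.* ι d ≡ ι i
  ad≡i = trans (cong (ℚ._* ι d) (sym (ℚ.↥p/↧p≡p a))) (/-*-ι i d)
above-one a@(ℚ.mkℚ -[1+ i ] d-1 _) 1<a = contradiction (ℚ.<-trans (0<ι {1} ℕ.≤-refl) 1<a) λ where (ℚ.*<* ())

-- A rational `a > 1` with denominator `n` is at least `1 + 1/n`; this is the origin of the gap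
-- parameter. The additive gap follows because the iterated logarithm is at least 1.
Ahead-scaled : ∀ {c a k i} → IsReal c → ι 1 ℚ.< a → L c a → 1 ≤ k → Large k i →
               Ahead (↧ₙ a) (log^ i (fromℕ k)) (c *ᴿ log^ i (fromℕ k))
Ahead-scaled {c} {a} {k} {i} real 1<a La 1≤k large {q} (_ , B , _ , D , _ , UB , _ , UD , _ , _ , _ , BD<q) =
  D , UD , multiplicative , additive
  where
  open ℚ.≤-Reasoning
  n : ℕ
  n = ↧ₙ a
  1<D : ι 1 ℚ.< D
  1<D = ℚ.≤-<-trans (ι-mono-≤ {1} {lg i k} (1≤lg {k} {i} 1≤k large)) (<log^ i k large UD)
  0≤D : 0ℚ ℚ.≤ D
  0≤D = ℚ.<⇒≤ (ℚ.<-trans (0<ι {1} ℕ.≤-refl) 1<D)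
  D[1+n]≤qn : D ℚ.* ι (suc n) ℚ.≤ q ℚ.* ι n
  D[1+n]≤qn = begin
    D ℚ.* ι (suc n)            ≤⟨ ℚ*-monoʳ-≤ 0≤D (above-one a 1<a) ⟩
    D ℚ.* (a ℚ.* ι n)          ≤⟨ ℚ*-monoʳ-≤ 0≤D (ℚ*-monoˡ-≤ (0≤ι n) (ℚ.<⇒≤ (L<U real La UB))) ⟩
    D ℚ.* (B ℚ.* ι n)          ≡⟨ lemma D B (ι n) ⟩
    B ℚ.* D ℚ.* ι n            ≤⟨ ℚ*-monoˡ-≤ (0≤ι n) (ℚ.<⇒≤ BD<q) ⟩
    q ℚ.* ι n                  ∎
    where
    lemma : ∀ x y z → x ℚ.* (y ℚ.* z) ≡ y ℚ.* x ℚ.* z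
    lemma = Solver.solve-∀ ℚ-ring
  multiplicative : D ℚ.* ι (suc (2 * n)) ℚ.≤ q ℚ.* ι (2 * n)
  multiplicative = begin
    D ℚ.* ι (suc (2 * n))      ≤⟨ ℚ*-monoʳ-≤ 0≤D (ι-mono-≤ {suc (2 * n)} {2 * suc n} (ℕ.≤-trans (ℕ.n≤1+n _) (ℕ.≤-reflexive (sym (ℕ.*-suc 2 n))))) ⟩
    D ℚ.* ι (2 * suc n)        ≡⟨ trans (cong (D ℚ.*_) (ι-* 2 (suc n))) (swap D (ι 2) (ι (suc n))) ⟩
    ι 2 ℚ.* (D ℚ.* ι (suc n))  ≤⟨ ℚ*-monoʳ-≤ (0≤ι 2) D[1+n]≤qn ⟩
    ι 2 ℚ.* (q ℚ.* ι n)        ≡⟨ trans (swap (ι 2) q (ι n)) (cong (q ℚ.*_) (sym (ι-* 2 n))) ⟩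
    q ℚ.* ι (2 * n)            ∎
    where
    swap : ∀ x y z → x ℚ.* (y ℚ.* z) ≡ y ℚ.* (x ℚ.* z)
    swap = Solver.solve-∀ ℚ-ring
  additive : D ℚ.+ + 1 ℚ./ n ℚ.≤ q
  additive = ℚ*-cancelʳ-≤ (ι n) (0<ι {n} (1≤↧ₙ a)) (begin
    (D ℚ.+ + 1 ℚ./ n) ℚ.* ι n          ≡⟨ trans (ℚ.*-distribʳ-+ (ι n) D (+ 1 ℚ./ n)) (cong (ℚ._+_ (D ℚ.* ι n)) (/-*-ι 1 n)) ⟩
    D ℚ.* ι n ℚ.+ ι 1                  ≤⟨ ℚ.+-monoʳ-≤ (D ℚ.* ι n) (ℚ.<⇒≤ 1<D) ⟩
    D ℚ.* ι n ℚ.+ D                    ≡⟨ trans (cong (ℚ._+_ (D ℚ.* ι n)) (sym (ℚ.*-identityʳ D))) (sym (ℚ.*-distribˡ-+ D (ι n) (ι 1))) ⟩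
    D ℚ.* (ι n ℚ.+ ι 1)                ≡⟨ cong (D ℚ.*_) (trans (sym (ι-+ n 1)) (cong ι (ℕ.+-comm n 1))) ⟩
    D ℚ.* ι (suc n)                    ≤⟨ D[1+n]≤qn ⟩
    q ℚ.* ι n                          ∎)

-- The additive gap `1/n` between exponents becomes the factor `1 + 1/(2n)`; from `x ≥ 2` this
-- factor restores the additive gap, as `x/(2n) ≥ 1/n`. So `n` never deteriorates, however many
-- exponentials are taken.
Ahead-exp : ∀ n .{{_ : NonZero n}} {x y} → (∀ {p} → U x p → ι 2 ℚ.≤ p) → Ahead n (log x) y → Ahead n x (exp y)
Ahead-exp n {x} {y} 2≤x ahead {q} (z , Uz , 2^z≺q) with ahead Uz
... | p₁ , (p , Up , p≺2^p₁) , _ , p₁+1/n≤z = p , Up , multiplicative , additive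
  where
  open ℚ.≤-Reasoning
  1≤n : 1 ≤ n
  1≤n = ℕ.>-nonZero⁻¹ n
  multiplicative : p ℚ.* ι (suc (2 * n)) ℚ.≤ q ℚ.* ι (2 * n)
  multiplicative = subst₂ (λ s t → p ℚ.* s ℚ.≤ q ℚ.* t) (ℚ.*-identityʳ (ι (suc (2 * n)))) (ℚ.*-identityʳ (ι (2 * n)))
    (exponential-gap n 1 (suc (2 * n)) (2 * n) p₁ z (suc-^-half {n} {n} ℕ.≤-refl) (ℕ.≤-trans 1≤n (ℕ.m≤n*m n 2))
      (ℚ.≤-trans (0≤ι 2) (2≤x Up)) p≺2^p₁ 2^z≺q p₁+1/n≤z)
  additive : p ℚ.+ + 1 ℚ./ n ℚ.≤ q
  additive = ℚ*-cancelʳ-≤ (ι (2 * n)) (0<ι {2 * n} (ℕ.≤-trans 1≤n (ℕ.m≤n*m n 2))) (begin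
    (p ℚ.+ + 1 ℚ./ n) ℚ.* ι (2 * n)         ≡⟨ ℚ.*-distribʳ-+ (ι (2 * n)) p (+ 1 ℚ./ n) ⟩
    p ℚ.* ι (2 * n) ℚ.+ + 1 ℚ./ n ℚ.* ι (2 * n)
      ≡⟨ cong (ℚ._+_ (p ℚ.* ι (2 * n))) (trans (cong (+ 1 ℚ./ n ℚ.*_) (trans (cong ι (ℕ.*-comm 2 n)) (ι-* n 2)))
          (trans (sym (ℚ.*-assoc (+ 1 ℚ./ n) (ι n) (ι 2))) (cong (ℚ._* ι 2) (/-*-ι 1 n)))) ⟩
    p ℚ.* ι (2 * n) ℚ.+ ι 2                 ≤⟨ ℚ.+-monoʳ-≤ (p ℚ.* ι (2 * n)) (2≤x Up) ⟩
    p ℚ.* ι (2 * n) ℚ.+ p                   ≡⟨ split p ⟩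
    p ℚ.* ι (suc (2 * n))                   ≤⟨ multiplicative ⟩
    q ℚ.* ι (2 * n)                         ∎)
    where
    split : ∀ p → p ℚ.* ι (2 * n) ℚ.+ p ≡ p ℚ.* ι (suc (2 * n))
    split p = trans (cong (ℚ._+_ (p ℚ.* ι (2 * n))) (sym (ℚ.*-identityʳ p))) (trans (sym (ℚ.*-distribˡ-+ p (ι (2 * n)) (ι 1)))
      (cong (p ℚ.*_) (trans (sym (ι-+ (2 * n) 1)) (cong ι (ℕ.+-comm (2 * n) 1)))))

Ahead-exp^ : ∀ n .{{_ : NonZero n}} {k y} j i → Large k (j + i) → Ahead n (log^ (j + i) (fromℕ k)) y →
             Ahead n (log^ i (fromℕ k)) (exp^ j y)
Ahead-exp^ n         zero    i large ahead = ahead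
Ahead-exp^ n {k} {y} (suc j) i large ahead = Ahead-exp n {log^ i (fromℕ k)} {exp^ j y} 2≤
  (Ahead-exp^ n j (suc i) (subst (Large k) (sym (ℕ.+-suc j i)) large)
    (subst (λ e → Ahead n (log^ e (fromℕ k)) y) (sym (ℕ.+-suc j i)) ahead))
  where
  2≤ : ∀ {p} → U (log^ i (fromℕ k)) p → ι 2 ℚ.≤ p
  2≤ Up = ℚ.≤-trans (ι-mono-≤ {2} {lg i k} (large (s≤s (ℕ.m≤n+m i j))))
    (ℚ.<⇒≤ (<log^ i k (λ j′<i → large (ℕ.<-≤-trans j′<i (ℕ.≤-trans (ℕ.n≤1+n i) (s≤s (ℕ.m≤n+m i j))))) Up))

-- The multiplicative gap at `log k` is worth `(log k)/(2n) ≥ G` in the exponent, so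
-- `exp y ≥ k 2^G ≥ k G`.
Ahead⇒multiple≤exp : ∀ n .{{_ : NonZero n}} {k y} G → Large k 1 → 2 * n * G ≤ lg 1 k → Ahead n (log^ 1 (fromℕ k)) y →
                     ∀ {q} → U (exp y) q → ι (k * G) ℚ.≤ q
Ahead⇒multiple≤exp n {k} {y} G large 2nG≤ ahead {q} (z , Uz , 2^z≺q) with ahead Uz
... | p₁ , Up₁@(p , k<p , p≺2^p₁) , p₁[2n+1]≤z2n , _ = begin
  ι (k * G)              ≤⟨ ι-mono-≤ {k * G} {k * 2 ^ℕ G} (ℕ.*-monoʳ-≤ k (ℕ.<⇒≤ (n<2^n G))) ⟩
  ι (k * 2 ^ℕ G)         ≡⟨ trans (ι-* k (2 ^ℕ G)) (cong (ι k ℚ.*_) (ι-^ 2 G)) ⟩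
  ι k ℚ.* ι 2 ^ G        ≤⟨ ℚ*-monoˡ-≤ (0≤^ G (0≤ι 2)) (ℚ.<⇒≤ k<p) ⟩
  p ℚ.* ι 2 ^ G          ≤⟨ exponential-gap 1 G 2 1 p₁ z ℕ.≤-refl ℕ.≤-refl (ℚ.<⇒≤ (ℚ.≤-<-trans (0≤ι k) k<p)) p≺2^p₁ 2^z≺q p₁+G≤z ⟩
  q ℚ.* ι 1 ^ G          ≡⟨ trans (cong (q ℚ.*_) (trans (sym (ι-^ 1 G)) (cong ι (ℕ.^-zeroˡ G)))) (ℚ.*-identityʳ q) ⟩
  q                      ∎
  where
  open ℚ.≤-Reasoning
  p₁+G≤z : p₁ ℚ.+ ι G ℚ.≤ z
  p₁+G≤z = ℚ*-cancelʳ-≤ (ι (2 * n)) (0<ι {2 * n} (ℕ.≤-trans (ℕ.>-nonZero⁻¹ n) (ℕ.m≤n*m n 2))) (begin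
    (p₁ ℚ.+ ι G) ℚ.* ι (2 * n)                ≡⟨ trans (ℚ.*-distribʳ-+ (ι (2 * n)) p₁ (ι G)) (cong (ℚ._+_ (p₁ ℚ.* ι (2 * n))) (trans (sym (ι-* G (2 * n))) (cong ι (ℕ.*-comm G (2 * n))))) ⟩
    p₁ ℚ.* ι (2 * n) ℚ.+ ι (2 * n * G)        ≤⟨ ℚ.+-monoʳ-≤ (p₁ ℚ.* ι (2 * n)) (ℚ.≤-trans (ι-mono-≤ {2 * n * G} {lg 1 k} 2nG≤) (ℚ.<⇒≤ (<log^ 1 k large Up₁))) ⟩
    p₁ ℚ.* ι (2 * n) ℚ.+ p₁                   ≡⟨ split p₁ ⟩
    p₁ ℚ.* ι (suc (2 * n))                    ≤⟨ p₁[2n+1]≤z2n ⟩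
    z ℚ.* ι (2 * n)                           ∎)
    where
    split : ∀ p → p ℚ.* ι (2 * n) ℚ.+ p ≡ p ℚ.* ι (suc (2 * n))
    split p = trans (cong (ℚ._+_ (p ℚ.* ι (2 * n))) (sym (ℚ.*-identityʳ p))) (trans (sym (ℚ.*-distribˡ-+ p (ι (2 * n)) (ι 1)))
      (cong (p ℚ.*_) (trans (sym (ι-+ (2 * n) 1)) (cong ι (ℕ.+-comm (2 * n) 1)))))

neg*≤ : ∀ {p} n m → p ℚ.≤ 0ℚ → p ℚ.* ι n ℚ.≤ ι m
neg*≤ {p} n m p≤0 = ℚ.≤-trans (subst (p ℚ.* ι n ℚ.≤_) (ℚ.*-zeroˡ (ι n)) (ℚ*-monoˡ-≤ (0≤ι n) p≤0)) (0≤ι m)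

L-inv-upper : ∀ {x} n → (∀ {p} → U x p → ι n ℚ.≤ p) → ∀ {u} → L (inv x) u → u ℚ.* ι n ℚ.≤ ι 1
L-inv-upper n n≤x {u} (p , Up , 0<p , up<1) with ℚ.≤-total u 0ℚ
... | inj₁ u≤0 = neg*≤ n 1 u≤0
... | inj₂ 0≤u = ℚ.≤-trans (ℚ*-monoʳ-≤ 0≤u (n≤x Up)) (ℚ.<⇒≤ up<1)

L-exp-√-upper : ∀ {k} n w → w * w ≤ k → n ≤ 2 ^ℕ w → ∀ {v} → L (exp (-ᴿ (√ (fromℕ k)))) v → v ℚ.* ι n ℚ.≤ ι 1
L-exp-√-upper {k} n w w²≤k n≤2^w {v} (p , (0<-p , k<p²) , v≺2^p) with ℚ.≤-total v 0ℚ
... | inj₁ v≤0 = neg*≤ n 1 v≤0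
... | inj₂ 0≤v = ℚ.≤-trans (ℚ*-monoʳ-≤ 0≤v (ι-mono-≤ {n} {2 ^ℕ w} n≤2^w)) (ℚ.<⇒≤ (^-cancel-< d (0≤ι 1) (begin-strict
  (v ℚ.* ι (2 ^ℕ w)) ^ d           ≡⟨ trans (^-distrib-* v (ι (2 ^ℕ w)) d) (cong (v ^ d ℚ.*_) (trans (cong (_^ d) (ι-^ 2 w)) (^-assocʳ (ι 2) w d))) ⟩
  v ^ d ℚ.* ι 2 ^ (w * d)          <⟨ ℚ*-monoˡ-< (0<^ (w * d) (0<ι {2} (s≤s z≤n))) (≺2^⇒< p 0≤v v≺2^p) ⟩
  2^ (↥ p) ℚ.* ι 2 ^ (w * d)       ≡⟨ 2^-+ (↥ p) (w * d) ⟨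
  2^ (↥ p ℤ.+ + (w * d))           ≤⟨ 2^-mono-≤ {_} {+ 0} (exponent p p<-w) ⟩
  1ℚ                               ≡⟨ trans (cong ι (sym (ℕ.^-zeroˡ d))) (ι-^ 1 d) ⟩
  ι 1 ^ d                          ∎)))
  where
  open ℚ.≤-Reasoning
  d : ℕ
  d = ↧ₙ p
  neg-neg : ∀ q → ℚ.- (ℚ.- q) ≡ q
  neg-neg = Solver.solve-∀ ℚ-ring
  w<-p : ι w ℚ.< ℚ.- p
  w<-p = ℚ.≰⇒> λ -p≤w → ℚ<⇒≱ k<p² (ℚ.≤-trans (ℚ*-mono-≤ (ℚ.<⇒≤ 0<-p) -p≤w (ℚ.<⇒≤ 0<-p) -p≤w)
    (subst (ℚ._≤ ι k) (ι-* w w) (ι-mono-≤ {w * w} {k} w²≤k)))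
  p<-w : p ℚ.< ℚ.- ι w
  p<-w = subst (ℚ._< ℚ.- ι w) (neg-neg p) (ℚ.neg-antimono-< w<-p)
  exponent : ∀ p → p ℚ.< ℚ.- ι w → ↥ p ℤ.+ + (w * ↧ₙ p) ℤ.≤ + 0
  exponent p@record{} p<-w with *<* h ← ℚᵘ.<-respʳ-≃ (ℚᵘ.≃-trans (ℚ.toℚᵘ-homo‿- (ι w)) (ℚᵘ.-‿cong (toℚᵘ-ι w))) (ℚ.toℚᵘ-mono-< p<-w) =
    ℤ.≤-trans (ℤ.+-monoˡ-≤ (+ (w * ↧ₙ p)) (ℤ.≤-trans (ℤ.≤-reflexive (sym (ℤ.*-identityʳ (↥ p)))) (ℤ.≤-trans (ℤ.<⇒≤ h)
        (ℤ.≤-reflexive (trans (sym (ℤ.neg-distribˡ-* (+ w) (↧ p))) (cong ℤ.-_ (sym (ℤ.pos-* w (↧ₙ p)))))))))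
      (ℤ.≤-reflexive (ℤ.+-inverseˡ (+ (w * ↧ₙ p))))

L-multiple-upper : ∀ {x C n m} → (∀ {c} → L x c → c ℚ.* ι n ℚ.≤ ι m) → ∀ {q} → L (fromℕ C *ᴿ x) q → q ℚ.* ι n ℚ.≤ ι (C * m)
L-multiple-upper {x} {C} {n} {m} bound {q} (a , b , c , d , a<C , C<b , Lc , _ , q<ac , _ , q<bc , _) with ℚ.≤-total c 0ℚ
... | inj₁ c≤0 = neg*≤ n (C * m) (ℚ.≤-trans (ℚ.<⇒≤ q<bc) (subst (b ℚ.* c ℚ.≤_) (ℚ.*-zeroʳ b) (ℚ*-monoʳ-≤ (ℚ.≤-trans (0≤ι C) (ℚ.<⇒≤ C<b)) c≤0)))
... | inj₂ 0≤c = begin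
  q ℚ.* ι n              ≤⟨ ℚ*-monoˡ-≤ (0≤ι n) (ℚ.≤-trans (ℚ.<⇒≤ q<ac) (ℚ*-monoˡ-≤ 0≤c (ℚ.<⇒≤ a<C))) ⟩
  ι C ℚ.* c ℚ.* ι n      ≡⟨ ℚ.*-assoc (ι C) c (ι n) ⟩
  ι C ℚ.* (c ℚ.* ι n)    ≤⟨ ℚ*-monoʳ-≤ (0≤ι C) (bound Lc) ⟩
  ι C ℚ.* ι m            ≡⟨ ι-* C m ⟨
  ι (C * m)              ∎
  where open ℚ.≤-Reasoning

-- The factor 4 comes from the strict lower bounds `ε/2` and `1/(2k)` of the two factors.
L-scaled-inv : ∀ {ε k q} → 0ℚ ℚ.< ε → 2 ≤ k → q ℚ.* ι 4 ℚ.* ι k ℚ.< ε → L (fromℚ ε *ᴿ inv (fromℕ k)) q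
L-scaled-inv {ε} {k@(suc k-1)} {q} 0<ε 2≤k 4kq<ε = L-* {fromℚ ε} {inv (fromℕ k)}
  half-ε< ε<ε+1
  (ι (suc k) , ι-mono-< {k} {suc k} ℕ.≤-refl , 0<ι {suc k} (s≤s z≤n) , c[1+k]<1)
  (ι 1 , ι-mono-< {1} {k} 2≤k , 0<ι {1} ℕ.≤-refl , ℚ.*<* (ℤ.+<+ ℕ.≤-refl))
  (ℚ.<⇒≤ (0<* 0<ε 0<½)) (ℚ.≤-trans (ℚ.<⇒≤ half-ε<) (ℚ.<⇒≤ ε<ε+1)) 0≤c c≤2 q<
  where
  open ℚ.≤-Reasoning
  c : ℚ
  c = + 1 ℚ./ (2 * k)
  c2k≡1 : c ℚ.* ι (2 * k) ≡ ι 1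
  c2k≡1 = /-*-ι 1 (2 * k)
  0<½ : 0ℚ ℚ.< ½
  0<½ = ℚ.*<* (ℤ.+<+ (s≤s z≤n))
  half-ε< : ε ℚ.* ½ ℚ.< ε
  half-ε< = subst₂ ℚ._<_ (ℚ.*-comm ½ ε) (ℚ.*-identityˡ ε) (ℚ*-monoˡ-< 0<ε (ℚ.*<* {½} {1ℚ} (ℤ.+<+ (s≤s (s≤s z≤n)))))
  ε<ε+1 : ε ℚ.< ε ℚ.+ 1ℚ
  ε<ε+1 = subst (ℚ._< ε ℚ.+ 1ℚ) (ℚ.+-identityʳ ε) (ℚ.+-monoʳ-< ε (0<ι {1} ℕ.≤-refl))
  0≤c : 0ℚ ℚ.≤ c
  0≤c = ℚ*-cancelʳ-≤ (ι (2 * k)) (0<ι {2 * k} (s≤s z≤n)) (subst₂ ℚ._≤_ (sym (ℚ.*-zeroˡ (ι (2 * k)))) (sym c2k≡1) (0≤ι 1))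
  c≤2 : c ℚ.≤ ι 2
  c≤2 = ℚ*-cancelʳ-≤ (ι (2 * k)) (0<ι {2 * k} (s≤s z≤n)) (subst₂ ℚ._≤_ (sym c2k≡1) (ι-* 2 (2 * k)) (ι-mono-≤ {1} {2 * (2 * k)} (s≤s z≤n)))
  c[1+k]<1 : c ℚ.* ι (suc k) ℚ.< 1ℚ
  c[1+k]<1 = subst₂ ℚ._<_ (ℚ.*-comm (ι (suc k)) c) (trans (ℚ.*-comm (ι (2 * k)) c) c2k≡1)
    (ℚ*-monoˡ-< (ℚ*-cancelʳ-< (ι (2 * k)) (0≤ι (2 * k)) (subst₂ ℚ._<_ (sym (ℚ.*-zeroˡ (ι (2 * k)))) (sym c2k≡1) (0<ι {1} ℕ.≤-refl)))
      (ι-mono-< {suc k} {2 * k} (ℕ.≤-trans (ℕ.+-monoˡ-≤ k 2≤k) (ℕ.≤-reflexive (cong (_+_ k) (sym (ℕ.+-identityʳ k)))))))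
  q< : q ℚ.< ε ℚ.* ½ ℚ.* c
  q< = ℚ*-cancelʳ-< (ι 4 ℚ.* ι k) (0≤* (0≤ι 4) (0≤ι k)) (begin-strict
    q ℚ.* (ι 4 ℚ.* ι k)                         ≡⟨ ℚ.*-assoc q (ι 4) (ι k) ⟨
    q ℚ.* ι 4 ℚ.* ι k                           <⟨ 4kq<ε ⟩
    ε                                           ≡⟨ trans (cong (λ x → ε ℚ.* x) c2k≡1) (ℚ.*-identityʳ ε) ⟨
    ε ℚ.* (c ℚ.* ι (2 * k))                     ≡⟨ cong (λ x → ε ℚ.* (c ℚ.* x)) (ι-* 2 k) ⟩
    ε ℚ.* (c ℚ.* (ι 2 ℚ.* ι k))                 ≡⟨ cong (λ x → ε ℚ.* (c ℚ.* (x ℚ.* ι k))) {ι 2} {½ ℚ.* ι 4} refl ⟩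
    ε ℚ.* (c ℚ.* (½ ℚ.* ι 4 ℚ.* ι k))           ≡⟨ lemma ε c ½ (ι 4) (ι k) ⟩
    ε ℚ.* ½ ℚ.* c ℚ.* (ι 4 ℚ.* ι k)             ∎)
    where
    lemma : ∀ e c h f k → e ℚ.* (c ℚ.* (h ℚ.* f ℚ.* k)) ≡ e ℚ.* h ℚ.* c ℚ.* (f ℚ.* k)
    lemma = Solver.solve-∀ ℚ-ring

positive-denominator : ∀ ε → 0ℚ ℚ.< ε → ι 1 ℚ.≤ ε ℚ.* ι (↧ₙ ε)
positive-denominator ε@(ℚ.mkℚ (+ i) d-1 _) 0<ε = subst (ι 1 ℚ.≤_) (sym εd≡i)
  (ι-mono-≤ {1} {i} (ι-cancel-< {0} {i} (subst (0ℚ ℚ.<_) εd≡i (0<* 0<ε (0<ι {suc d-1} (s≤s z≤n))))))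
  where
  εd≡i : ε ℚ.* ι (suc d-1) ≡ ι i
  εd≡i = trans (cong (ℚ._* ι (suc d-1)) (sym (ℚ.↥p/↧p≡p ε))) (/-*-ι i (suc d-1))
positive-denominator (ℚ.mkℚ -[1+ i ] d-1 _) (ℚ.*<* ())

3h≤2^h : ∀ h → 4 ≤ h → 3 * h ≤ 2 ^ℕ h
3h≤2^h h 4≤h with j , refl ← ℕ.m≤n⇒∃[o]m+o≡n 4≤h = begin
  3 * (4 + j)          ≡⟨ ℕ.*-distribˡ-+ 3 4 j ⟩
  12 + 3 * j           ≤⟨ ℕ.+-mono-≤ (ℕ.m≤m+n 12 4) (ℕ.*-monoˡ-≤ j {3} {16} (ℕ.m≤m+n 3 13)) ⟩
  16 + 16 * j          ≡⟨ ℕ.*-suc 16 j ⟨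
  16 * suc j           ≤⟨ ℕ.*-monoʳ-≤ 16 (n<2^n j) ⟩
  16 * 2 ^ℕ j          ≡⟨ ℕ.^-distribˡ-+-* 2 4 j ⟨
  2 ^ℕ (4 + j)         ∎
  where open ℕ.≤-Reasoning

-- The witness `w = 2^h`, with `h` half the logarithm of `k`, is a power of two below `√k`. Then
-- `k G ≤ 2^(2h + 2 + G)`, and `G + 4 ≤ h` gives both `2h + 2 + G ≤ 3h` and the `h ≥ 4` required for
-- `3h ≤ 2^h`.
multiple≤2^root : ∀ k G → 1 ≤ k → (G + 4) + (G + 4) ≤ ⌊log₂ k ⌋ → ∃[ w ] (w * w ≤ k × k * G ≤ 2 ^ℕ w)
multiple≤2^root k G 1≤k G≤ = 2 ^ℕ h , square , multiple
  where
  open ℕ.≤-Reasoning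
  l h : ℕ
  l = ⌊log₂ k ⌋
  h = ℕ.⌊ l /2⌋
  G+4≤h : G + 4 ≤ h
  G+4≤h = ℕ.≤-trans (ℕ.≤-reflexive (ℕ.n≡⌊n+n/2⌋ (G + 4))) (ℕ.⌊n/2⌋-mono G≤)
  square : 2 ^ℕ h * 2 ^ℕ h ≤ k
  square = begin
    2 ^ℕ h * 2 ^ℕ h      ≡⟨ ℕ.^-distribˡ-+-* 2 h h ⟨
    2 ^ℕ (h + h)         ≤⟨ ℕ.^-monoʳ-≤ 2 (ℕ.≤-trans (ℕ.+-monoʳ-≤ h (ℕ.⌊n/2⌋≤⌈n/2⌉ l)) (ℕ.≤-reflexive (ℕ.⌊n/2⌋+⌈n/2⌉≡n l))) ⟩
    2 ^ℕ l               ≤⟨ 2^⌊log₂n⌋≤n k 1≤k ⟩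
    k                    ∎
  ⌈n/2⌉≤1+⌊n/2⌋ : ∀ n → ℕ.⌈ n /2⌉ ≤ suc ℕ.⌊ n /2⌋
  ⌈n/2⌉≤1+⌊n/2⌋ zero          = z≤n
  ⌈n/2⌉≤1+⌊n/2⌋ (suc zero)    = ℕ.≤-refl
  ⌈n/2⌉≤1+⌊n/2⌋ (suc (suc n)) = s≤s (⌈n/2⌉≤1+⌊n/2⌋ n)
  exponent : suc l + G ≤ 2 ^ℕ h
  exponent = begin
    suc l + G                        ≡⟨ cong (λ x → suc x + G) (ℕ.⌊n/2⌋+⌈n/2⌉≡n l) ⟨
    suc (h + ℕ.⌈ l /2⌉) + G          ≤⟨ ℕ.+-monoˡ-≤ G (s≤s (ℕ.+-monoʳ-≤ h (⌈n/2⌉≤1+⌊n/2⌋ l))) ⟩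
    suc (h + suc h) + G              ≡⟨ lemma h G ⟩
    h + (h + (G + 2))                ≤⟨ ℕ.+-monoʳ-≤ h (ℕ.+-monoʳ-≤ h (ℕ.≤-trans (ℕ.+-monoʳ-≤ G (ℕ.m≤m+n 2 2)) G+4≤h)) ⟩
    h + (h + h)                      ≡⟨ cong (λ x → h + (h + x)) (ℕ.+-identityʳ h) ⟨
    3 * h                            ≤⟨ 3h≤2^h h (ℕ.≤-trans (ℕ.m≤n+m 4 G) G+4≤h) ⟩
    2 ^ℕ h                           ∎
    where
    lemma : ∀ h G → suc (h + suc h) + G ≡ h + (h + (G + 2))
    lemma = solve-∀
  multiple : k * G ≤ 2 ^ℕ (2 ^ℕ h)
  multiple = begin
    k * G                    ≤⟨ ℕ.*-mono-≤ (ℕ.<⇒≤ (n<2^1+⌊log₂n⌋ k)) (ℕ.<⇒≤ (n<2^n G)) ⟩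
    2 ^ℕ suc l * 2 ^ℕ G      ≡⟨ ℕ.^-distribˡ-+-* 2 (suc l) G ⟨
    2 ^ℕ (suc l + G)         ≤⟨ ℕ.^-monoʳ-≤ 2 exponent ⟩
    2 ^ℕ (2 ^ℕ h)            ∎

-- The threshold makes `log k` large enough for both summands of the error bound to be at most
-- `1/(k G)`. It does not depend on `r`, since the gap parameter `n` is the same for every number of
-- exponentials.
errorBound-small : ∀ C c → IsReal c → fromℕ 1 <ᴿ c → ∀ ε → 0ℚ ℚ.< ε →
  ∃[ K ] (∀ k r → 2 ≤ k → K ≤ k → Large k (suc r) → fromℕ C *ᴿ errorBound c k (suc r) ≤ᴿ fromℚ ε *ᴿ inv (fromℕ k))
errorBound-small C c real (a , 1<a , La) ε 0<ε = 2 ^ℕ (2 * n * G + ((G + 4) + (G + 4))) , λ k r 2≤k K≤k large q Lq →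
  let log≥ = ℕ.≤-trans (ℕ.≤-reflexive (sym (⌊log₂[2^n]⌋≡n (2 * n * G + ((G + 4) + (G + 4)))))) (⌊log₂⌋-mono-≤ K≤k)
      large₁ : Large k 1
      large₁ j<1 = large (ℕ.<-≤-trans j<1 (s≤s z≤n))
      ahead = Ahead-exp^ n r 1 (subst (Large k) (ℕ.+-comm 1 r) large)
                (subst (λ e → Ahead n (log^ e (fromℕ k)) (c *ᴿ log^ (suc r) (fromℕ k))) (ℕ.+-comm 1 r)
                  (Ahead-scaled {c} {a} {k} {suc r} real 1<a La (ℕ.<⇒≤ 2≤k) large))
      w , w²≤k , kG≤2^w = multiple≤2^root k G (ℕ.<⇒≤ 2≤k) (ℕ.≤-trans (ℕ.m≤n+m _ (2 * n * G)) log≥)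
      first  : ∀ {u} → L (inv (exp^ (suc r) (c *ᴿ log^ (suc r) (fromℕ k)))) u → u ℚ.* ι (k * G) ℚ.≤ ι 1
      first {u} = L-inv-upper {exp^ (suc r) (c *ᴿ log^ (suc r) (fromℕ k))} (k * G) (Ahead⇒multiple≤exp n {k} {exp^ r (c *ᴿ log^ (suc r) (fromℕ k))} G large₁ (ℕ.≤-trans (ℕ.m≤m+n (2 * n * G) _) log≥) ahead) {u}
      second : ∀ {v} → L (exp (-ᴿ (√ (fromℕ k)))) v → v ℚ.* ι (k * G) ℚ.≤ ι 1
      second {v} = L-exp-√-upper {k} (k * G) w w²≤k kG≤2^w {v}
  in L-scaled-inv {ε} {k} {q} 0<ε 2≤k (final k q (L-multiple-upper {errorBound c k (suc r)} {C} {k * G} {2} (sum k r (λ {u} → first {u}) (λ {v} → second {v})) Lq))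
  where
  open ℚ.≤-Reasoning
  n G : ℕ
  n = ↧ₙ a
  -- Two summands and the factor 4 of `L-scaled-inv` give `8 C`; the successor makes the comparison
  -- strict, and `ε` times its denominator is at least 1.
  G = ↧ₙ ε * suc (8 * C)
  sum : ∀ k r → (∀ {u} → L (inv (exp^ (suc r) (c *ᴿ log^ (suc r) (fromℕ k)))) u → u ℚ.* ι (k * G) ℚ.≤ ι 1) →
        (∀ {v} → L (exp (-ᴿ (√ (fromℕ k)))) v → v ℚ.* ι (k * G) ℚ.≤ ι 1) →
        ∀ {x} → L (errorBound c k (suc r)) x → x ℚ.* ι (k * G) ℚ.≤ ι 2
  sum k r first second {x} (u , v , Lu , Lv , x<u+v) = begin
    x ℚ.* ι (k * G)                            ≤⟨ ℚ*-monoˡ-≤ (0≤ι (k * G)) (ℚ.<⇒≤ x<u+v) ⟩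
    (u ℚ.+ v) ℚ.* ι (k * G)                    ≡⟨ ℚ.*-distribʳ-+ (ι (k * G)) u v ⟩
    u ℚ.* ι (k * G) ℚ.+ v ℚ.* ι (k * G)        ≤⟨ ℚ.+-mono-≤ (first {u} Lu) (second {v} Lv) ⟩
    ι 2                                        ∎
  final : ∀ k q → q ℚ.* ι (k * G) ℚ.≤ ι (C * 2) → q ℚ.* ι 4 ℚ.* ι k ℚ.< ε
  final k q q≤ = ℚ*-cancelʳ-< (ι G) (0≤ι G) (begin-strict
    q ℚ.* ι 4 ℚ.* ι k ℚ.* ι G               ≡⟨ lemma q (ι 4) (ι k) (ι G) ⟩
    q ℚ.* (ι k ℚ.* ι G) ℚ.* ι 4             ≡⟨ cong (λ x → q ℚ.* x ℚ.* ι 4) (ι-* k G) ⟨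
    q ℚ.* ι (k * G) ℚ.* ι 4                 ≤⟨ ℚ*-monoˡ-≤ (0≤ι 4) q≤ ⟩
    ι (C * 2) ℚ.* ι 4                       ≡⟨ ι-* (C * 2) 4 ⟨
    ι (C * 2 * 4)                           <⟨ ι-mono-< {C * 2 * 4} {suc (8 * C)} (s≤s (ℕ.≤-reflexive (eight C))) ⟩
    ι (suc (8 * C))                         ≡⟨ ℚ.*-identityˡ (ι (suc (8 * C))) ⟨
    ι 1 ℚ.* ι (suc (8 * C))                 ≤⟨ ℚ*-monoˡ-≤ (0≤ι (suc (8 * C))) (positive-denominator ε 0<ε) ⟩
    ε ℚ.* ι (↧ₙ ε) ℚ.* ι (suc (8 * C))      ≡⟨ ℚ.*-assoc ε (ι (↧ₙ ε)) (ι (suc (8 * C))) ⟩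
    ε ℚ.* (ι (↧ₙ ε) ℚ.* ι (suc (8 * C)))    ≡⟨ cong (ε ℚ.*_) (ι-* (↧ₙ ε) (suc (8 * C))) ⟨
    ε ℚ.* ι G                               ∎)
    where
    lemma : ∀ a b c d → a ℚ.* b ℚ.* c ℚ.* d ≡ a ℚ.* (c ℚ.* d) ℚ.* b
    lemma = Solver.solve-∀ ℚ-ring
    eight : ∀ C → C * 2 * 4 ≡ 8 * C
    eight = solve-∀

-- Assembling the protocols

errorProbability≡ : ∀ {m k r} (P : DISJ-Protocol m k r) S T → errors P S T ≡ 0 → errorProbability (DISJ m k) P S T ≡ 0ℚ
errorProbability≡ P S T eq = trans (cong (λ e → + e ℚ./ size P) eq) (ℚ.0/n≡0 (size P))

IsLog*⇒Large : ∀ {k s r} → IsLog* (fromℕ k) s → r ≤ s → Large k r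
IsLog*⇒Large isLog* r≤s j<r = IsLog*⇒2≤lg isLog* (ℕ.<-≤-trans j<r r≤s)

disj-protocol : ∀ c → IsReal c → fromℕ 1 <ᴿ c → ∃[ C ] (∀ k m r → 2 ≤ k → Large k (suc r) →
  Σ (DISJ-Protocol m k (suc r)) λ P →
    TotalCommunication≤ P (fromℕ C *ᴿ (fromℕ k *ᴿ log^ (suc r) (fromℕ k)))
  × (∀ S T → ¬ Disjoint S T → errorProbability (DISJ m k) P S T ≡ 0ℚ)
  × (∀ S T → Disjoint S T → fromℚ (errorProbability (DISJ m k) P S T) ≤ᴿ fromℕ C *ᴿ errorBound c k (suc r)))
disj-protocol c real 1<c = suc C₁ , protocols
  where
  open ℕ.≤-Reasoning
  b : ℚ
  b = proj₁ (IsReal.U-inhabited real)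
  c₁ D C₁ : ℕ
  c₁ = proj₁ (below-natural b)
  -- The summand 10 serves `log-budget`; together with `2 c₁` it yields `D l ≥ c₁ (l + 1) + 1`, a
  -- strict integer bound above `c log^(r) k`.
  D  = 10 + 2 * c₁
  C₁ = 10 + costFactor * D * 8
  1≤c₁ : 1 ≤ c₁
  1≤c₁ = ℕ.<⇒≤ (ι-cancel-< {1} {c₁} (ℚ.<-trans (proj₁ (proj₂ 1<c))
    (ℚ.<-trans (L<U real (proj₂ (proj₂ 1<c)) (proj₂ (IsReal.U-inhabited real))) (proj₂ (below-natural b)))))
  protocols : ∀ k m r → 2 ≤ k → Large k (suc r) → Σ (DISJ-Protocol m k (suc r)) _
  protocols k m r 2≤k large = P
    , (λ ω x y → fromℕ≤product {C₀ = costFactor * D} {C₁} {suc r} {k} 2≤k large (ℕ.m≤n+m _ 10) (bits≤ ω x y))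
    , (λ S T ¬dis → errorProbability≡ P S T (intersecting S T ¬dis))
    , λ S T dis → ≤errorBound c k (suc r) n t (root k) C₁ (ℕ.m≤m+n 10 _)
        (L-exp^ (suc r) scaled-lower) Un 1≤n (ℕ.≤-trans n< (ℕ.≤-reflexive (tower-suc r (D * l))))
        (1≤2^ (4 * eighth k)) (k<root² k) (error-fraction (errors P S T) (size P) {{size≢0 P}} t (root k) (disjoint S T dis))
    where
    open ScaledLog real 1<c k (suc r) (ℕ.<⇒≤ 2≤k) large
    l t : ℕ
    l = lg (suc r) k
    t = tower r (D * l)
    1≤l : 1 ≤ l
    1≤l = 1≤lg {k} {suc r} (ℕ.<⇒≤ 2≤k) large
    bounds = integer-bounds k m r l D 2≤k 1≤l (s≤s z≤n) (log-budget r k D (ℕ.m≤m+n 10 _) 1≤l)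
    P = proj₁ bounds
    bits≤ = proj₁ (proj₂ bounds)
    intersecting = proj₁ (proj₂ (proj₂ bounds))
    disjoint = proj₂ (proj₂ (proj₂ bounds))
    1+n≤Dl : suc (c₁ * suc l) ≤ D * l
    1+n≤Dl = begin
      1 + c₁ * suc l                  ≤⟨ ℕ.+-mono-≤ (ℕ.≤-trans 1≤l (ℕ.m≤n*m l 10)) (ℕ.*-monoʳ-≤ c₁ (ℕ.+-monoˡ-≤ l 1≤l)) ⟩
      10 * l + c₁ * (l + l)           ≡⟨ lemma c₁ l ⟩
      D * l                           ∎
      where
      lemma : ∀ c l → 10 * l + c * (l + l) ≡ (10 + 2 * c) * l
      lemma = solve-∀
    growth = U-exp^ (suc r) {n = c₁ * suc l} {N = D * l} scaled-upper (ℕ.*-mono-≤ 1≤c₁ (s≤s z≤n)) 1+n≤Dl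
    n = proj₁ growth
    Un = proj₁ (proj₂ growth)
    1≤n = proj₁ (proj₂ (proj₂ growth))
    n< = proj₂ (proj₂ (proj₂ growth))

-- After `d` further logarithms the value is below 2, so its floor is at most 1; going back up, one
-- is added before exponentiating, which starts the tower at 2.
log*-bound : ∀ {k i d} → IsLog* (fromℕ k) (i + d) → lg i k ≤ tower d 2
log*-bound {k} {i} {d} isLog*@((q , Uq , q<2) , _) = ℕ.<⇒≤ (ℕ.≤-trans (lg<tower d i k) (tower-mono d
  (ι-cancel-< {lg (d + i) k} {2} (ℚ.<-trans (<log^ (d + i) k (subst (Large k) (ℕ.+-comm i d) (IsLog*⇒Large isLog* ℕ.≤-refl))
     (subst (λ j → U (log^ j (fromℕ k)) q) (ℕ.+-comm i d) Uq)) q<2))))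

disj-protocol-log* : ∀ d → ∃[ C ] (∀ k m r → 2 ≤ k → IsLog* (fromℕ k) (suc r + d) →
  Σ (DISJ-Protocol m k (suc r)) λ P →
    TotalCommunication≤ P (fromℕ C *ᴿ fromℕ k)
  × (∀ S T → fromℚ (errorProbability (DISJ m k) P S T) ≤ᴿ fromℕ C *ᴿ exp (-ᴿ (√ (fromℕ k)))))
disj-protocol-log* d = suc (2 * C₀) , protocols
  where
  Λ D C₀ : ℕ
  Λ  = tower d 2
  -- The multiple required by `root≤tower`; it depends on `d` alone, so the cost remains linear in
  -- `k`.
  D  = 16 * 2 ^ℕ suc Λ
  C₀ = 20 + costFactor * D * Λ
  16≤D : 16 ≤ D
  16≤D = ℕ.*-monoʳ-≤ 16 (1≤2^ (suc Λ))
  protocols : ∀ k m r → 2 ≤ k → IsLog* (fromℕ k) (suc r + d) → Σ (DISJ-Protocol m k (suc r)) _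
  protocols k m r 2≤k isLog* = P
    , (λ ω x y → fromℕ≤multiple {C₀ = C₀} 2≤k (communication (bits≤ ω x y)))
    , λ S T → ≤exp-√ k t (root k) (root≤tower r k Λ (ℕ.<⇒≤ 2≤k) 1≤l l≤Λ)
        (1≤2^ (4 * eighth k)) (k<root² k) (bounded S T (errors P S T) (intersecting S T) (disjoint S T))
        (2 * C₀) (ℕ.≤-trans (ℕ.m≤m+n 20 _) (ℕ.m≤n*m C₀ 2))
    where
    open ℕ.≤-Reasoning
    large : Large k (suc r)
    large = IsLog*⇒Large isLog* (ℕ.m≤m+n (suc r) d)
    1≤l : 1 ≤ lg (suc r) k
    1≤l = 1≤lg {k} {suc r} (ℕ.<⇒≤ 2≤k) large
    l≤Λ : lg (suc r) k ≤ Λ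
    l≤Λ = log*-bound {k} {suc r} {d} isLog*
    t : ℕ
    t = tower r (D * lg (suc r) k)
    bounds = integer-bounds k m r (lg (suc r) k) D 2≤k 1≤l (ℕ.≤-trans (s≤s z≤n) 16≤D)
               (log-budget r k D (ℕ.≤-trans (ℕ.m≤m+n 10 6) 16≤D) 1≤l)
    P = proj₁ bounds
    bits≤ = proj₁ (proj₂ bounds)
    intersecting = proj₁ (proj₂ (proj₂ bounds))
    disjoint = proj₂ (proj₂ (proj₂ bounds))
    communication : ∀ {n} → n ≤ costFactor * D * (k * lg (suc r) k) → n ≤ C₀ * k
    communication {n} n≤ = begin
      n                                  ≤⟨ n≤ ⟩
      costFactor * D * (k * lg (suc r) k)     ≤⟨ ℕ.*-monoʳ-≤ (costFactor * D) (ℕ.*-monoʳ-≤ k l≤Λ) ⟩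
      costFactor * D * (k * Λ)                ≡⟨ lemma (costFactor * D) k Λ ⟩
      costFactor * D * Λ * k                  ≤⟨ ℕ.*-monoˡ-≤ k (ℕ.m≤n+m (costFactor * D * Λ) 20) ⟩
      C₀ * k                             ∎
      where
      lemma : ∀ a b c → a * (b * c) ≡ a * c * b
      lemma = solve-∀
    bounded : ∀ S T e → (¬ Disjoint S T → e ≡ 0) →
              (Disjoint S T → e * (2 ^ℕ root k * 2 ^ℕ t) ≤ size P * (2 * 2 ^ℕ root k + 5 * 2 ^ℕ t)) →
              (+ e ℚ./ size P) {{size≢0 P}} ℚ.≤ ι 5 ℚ.* (½ ^ t ℚ.+ ½ ^ root k)
    bounded S T e e≡0 e≤ = error-fraction e (size P) {{size≢0 P}} t (root k) (case nonempty? (proj₁ S ∩ proj₁ T) of λ where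
      (yes ne) → ℕ.≤-trans (ℕ.≤-reflexive (cong (_* (2 ^ℕ root k * 2 ^ℕ t)) (e≡0 λ dis → dis ne))) z≤n
      (no dis) → e≤ dis)

theorem1 : (∀ (c : ℝ) → IsReal c → fromℕ 1 <ᴿ c →
    ∃[ C ]
    ( (∀ (k m r s : ℕ) → 2 ≤ k → 1 ≤ m → IsLog* (fromℕ k) s → 1 ≤ r → r ≤ s →
    Σ (DISJ-Protocol m k r) λ P →
    TotalCommunication≤ P (fromℕ C *ᴿ (fromℕ k *ᴿ log^ r (fromℕ k)))
    × (∀ S T → ¬ Disjoint S T → errorProbability (DISJ m k) P S T ≡ 0ℚ)
    × (∀ S T → Disjoint S T →
    fromℚ (errorProbability (DISJ m k) P S T) ≤ᴿ fromℕ C *ᴿ errorBound c k r))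
    × (∀ (ε : ℚ) → 0ℚ <ℚ ε →
    Σ ℕ λ K → ∀ (k r s : ℕ) → 2 ≤ k → K ≤ k → IsLog* (fromℕ k) s → 1 ≤ r → r ≤ s →
    fromℕ C *ᴿ errorBound c k r ≤ᴿ fromℚ ε *ᴿ inv (fromℕ k))))
    ×
    (∀ (d : ℕ) →
    ∃[ C ]
    (∀ (k m r : ℕ) → 2 ≤ k → 1 ≤ m → IsLog* (fromℕ k) (r + d) → 1 ≤ r →
    Σ (DISJ-Protocol m k r) λ P →
    TotalCommunication≤ P (fromℕ C *ᴿ fromℕ k)
    × (∀ S T →
    fromℚ (errorProbability (DISJ m k) P S T) ≤ᴿ
    fromℕ C *ᴿ exp (-ᴿ (√ (fromℕ k))))))
theorem1 = bounded-error , log*-rounds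
  where
  bounded-error : ∀ c → IsReal c → fromℕ 1 <ᴿ c → ∃[ C ] _
  bounded-error c real 1<c = C , (λ where
      k m (suc r) s 2≤k _ isLog* _ r≤s → proj₂ (disj-protocol c real 1<c) k m r 2≤k (IsLog*⇒Large isLog* r≤s)) ,
    λ ε 0<ε → proj₁ (errorBound-small C c real 1<c ε 0<ε) , λ where
      k (suc r) s 2≤k K≤k isLog* _ r≤s → proj₂ (errorBound-small C c real 1<c ε 0<ε) k r 2≤k K≤k (IsLog*⇒Large isLog* r≤s)
    where
    C : ℕ
    C = proj₁ (disj-protocol c real 1<c)
  log*-rounds : ∀ d → ∃[ C ] _
  log*-rounds d = proj₁ (disj-protocol-log* d) , λ where
    k m (suc r) 2≤k _ isLog* _ → proj₂ (disj-protocol-log* d) k m r 2≤k isLog*
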